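{- Let $q$ be an odd prime power and let $\alpha,\beta\in\mathbb{F}_{q^2}$ with $\alpha\neq 0$ be such that $d=(\beta^q-\beta)^2+4\alpha^{q+1}$ is a nonsquare in $\mathbb{F}_q$, so that $\mathcal U_{\alpha\beta}$ is a non-classical orthogonal Buekenhout–Metz unital in $\mathrm{PG}(2,q^2)$. Let $P$ be a point with $P\notin\mathcal U_{\alpha\beta}\cup\ell_\infty$. Then the points of $\mathrm{pedal}(P)$ lie on the lines of a Baer pencil whose vertex is a point of $\ell_\infty$. Moreover: (1) If $\alpha$ is a nonsquare in $\mathbb{F}_{q^2}$, then $\mathrm{pedal}(P)$ is an arc. (2) If $\alpha$ is a nonzero square in $\mathbb{F}_{q^2}$, then (a) $\mathrm{pedal}(P)$ is a set of class $(0,1,2,4)$; (b) there are at least $\frac{q-3}{4}$ lines meeting $\mathrm{pedal}(P)$ in exactly $4$ points; (c) every line meeting $\mathrm{pedal}(P)$ in exactly $4$ points contains the vertex of the Baer pencil containing $\mathrm{pedal}(P)$.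
   Context: Points of $\mathrm{PG}(2,q^2)$ have homogeneous coordinates $(x,y,z)$ over $\mathbb{F}_{q^2}$; $\ell_\infty$ is the line $z=0$. For $\alpha,\beta\in\mathbb{F}_{q^2}$, $\mathcal U_{\alpha\beta}=\{(x,\alpha x^2+\beta x^{q+1}+r,1): x\in\mathbb{F}_{q^2}, r\in\mathbb{F}_q\}\cup\{(0,1,0)\}$. Under the stated nonsquare condition on $d$, $\mathcal U_{\alpha\beta}$ is a unital (a set of $q^3+1$ points meeting every line in $1$ or $q+1$ points), and $\alpha\neq0$ means it is non-classical. A tangent line is a line meeting the unital in exactly one point. For a point $P$ not on the unital there are exactly $q+1$ tangent lines through $P$; their points of contact with the unital are the feet of $P$, and the set of feet is $\mathrm{pedal}(P)$. A point set $\mathcal K$ is of type $(a_1,\dots,a_k)$ if every line meets $\mathcal K$ in some $a_i$ points, and of class $(a_1,\dots,a_k)$ if moreover each $a_i$ occurs as an intersection size for some line. An arc is a set of type $(0,1,2)$. A Baer subline is a set of $q+1$ points of a line of $\mathrm{PG}(2,q^2)$ projectively equivalent to $\{(a,b,0): (a,b)\in\mathbb{F}_q^2\setminus\{(0,0)\}\}$; a Baer pencil is the set of $q+1$ lines joining a point (the vertex) to the points of a Baer subline (the base). -}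

module Defs where

open import Level using (Level; _⊔_)
open import Algebra.Bundles using (CommutativeRing; Semiring)
open import Algebra.Definitions using (Invertible)
import Algebra.Definitions.RawSemiring as RawSemiringDefinitions
open import Data.Fin.Base using (Fin)
open import Data.List.Base using (List)
open import Data.List.Membership.Propositional using () renaming (_∈_ to _∈ˡ_)
open import Data.Nat.Base as ℕ using (ℕ)
open import Data.Nat.Primality using (Prime)
open import Data.Product.Base using (Σ; ∃; ∃₂; _×_; _,_; proj₁)
open import Data.Sum.Base using (_⊎_)
open import Data.Vec.Functional using (Vector; []; _∷_; zipWith)
import Data.Vec.Functional.Relation.Binary.Equality.Setoid as VectorEquality
open import Function.Bundles using (Bijection; Injection)
open import Relation.Binary.Bundles using (Setoid)
import Relation.Binary.Construct.On as On
open import Relation.Binary.PropositionalEquality using (_≡_) renaming (setoid to ≡-setoid)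
open import Relation.Nullary.Negation using (¬_)
open import Relation.Unary using (Pred; _∈_; _∩_; _⊆_)

private
  variable
    a b p : Level

IsPrimePower : ℕ → Set
IsPrimePower q = ∃₂ λ r k → Prime r × 1 ℕ.≤ k × q ≡ r ℕ.^ k

module _ (S : Setoid a b) where

  open Setoid S using (Carrier)

  Restrict : Pred Carrier p → Setoid (a ⊔ p) b
  Restrict P = On.setoid {B = Σ Carrier P} S proj₁

  -- Elements are counted up to the equality of S.
  HasSize : Pred Carrier p → ℕ → Set (a ⊔ b ⊔ p)
  HasSize P n = Bijection (≡-setoid (Fin n)) (Restrict P)

  HasSizeAtLeast : Pred Carrier p → ℕ → Set (a ⊔ b ⊔ p)
  HasSizeAtLeast P n = Injection (≡-setoid (Fin n)) (Restrict P)

module _ (F : CommutativeRing a b) where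

  open CommutativeRing F

  record IsField : Set (a ⊔ b) where
    field
      1≉0      : ¬ 1# ≈ 0#
      inverses : ∀ x → ¬ x ≈ 0# → Invertible _≈_ 1# _*_ x

  record IsSubfield (K : Pred Carrier p) : Set (a ⊔ b ⊔ p) where
    field
      resp-≈    : ∀ {x y} → x ≈ y → x ∈ K → y ∈ K
      0-closed  : 0# ∈ K
      1-closed  : 1# ∈ K
      +-closed  : ∀ {x y} → x ∈ K → y ∈ K → x + y ∈ K
      -‿closed  : ∀ {x} → x ∈ K → - x ∈ K
      *-closed  : ∀ {x y} → x ∈ K → y ∈ K → x * y ∈ K
      ⁻¹-closed : ∀ {x y} → x ∈ K → x * y ≈ 1# → y ∈ K

  IsSquareIn : Pred Carrier p → Carrier → Set (a ⊔ b ⊔ p)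
  IsSquareIn K x = ∃ λ y → y ∈ K × y * y ≈ x

-- The plane PG(2,q²) over F = 𝔽_{q²}, with K the subfield 𝔽_q.
module PG2 (F : CommutativeRing a b) (isField : IsField F)
           (K : Pred (CommutativeRing.Carrier F) p) (q : ℕ) where

  open CommutativeRing F
  open IsField isField
  open RawSemiringDefinitions (Semiring.rawSemiring semiring) using (_^_; sum) renaming (_×_ to _·_)
  open VectorEquality setoid using (_≋_)

  infix 4 _∼_ _on_
  infixr 8 _⊙_

  0ᵥ : Vector Carrier 3
  0ᵥ _ = 0#

  _∼_ : Vector Carrier 3 → Vector Carrier 3 → Set (a ⊔ b)
  v ∼ w = ∃ λ c → (¬ c ≈ 0#) × (∀ i → v i ≈ c * w i)

  ∼-refl : ∀ {v} → v ∼ v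
  ∼-refl {v} = 1# , 1≉0 , λ i → sym (*-identityˡ (v i))

  ∼-sym : ∀ {v w} → v ∼ w → w ∼ v
  ∼-sym {v} {w} (c , c≉0 , v≈cw) with inverses c c≉0
  ... | d , dc≈1 , _ = d , d≉0 , w≈dv
    where
    d≉0 : ¬ d ≈ 0#
    d≉0 d≈0 = 1≉0 (trans (sym dc≈1) (trans (*-congʳ d≈0) (zeroˡ c)))

    w≈dv : ∀ i → w i ≈ d * v i
    w≈dv i = trans (sym (*-identityˡ (w i)))
            (trans (*-congʳ (sym dc≈1))
            (trans (*-assoc d c (w i)) (*-congˡ (sym (v≈cw i)))))

  ∼-trans : ∀ {u v w} → u ∼ v → v ∼ w → u ∼ w
  ∼-trans {u} {v} {w} (c , c≉0 , u≈cv) (d , d≉0 , v≈dw) = c * d , cd≉0 , u≈cdw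
    where
    cd≉0 : ¬ c * d ≈ 0#
    cd≉0 cd≈0 with inverses c c≉0
    ... | e , ec≈1 , _ = d≉0
      (trans (sym (*-identityˡ d))
      (trans (*-congʳ (sym ec≈1))
      (trans (*-assoc e c d)
      (trans (*-congˡ cd≈0) (zeroʳ e)))))

    u≈cdw : ∀ i → u i ≈ (c * d) * w i
    u≈cdw i = trans (u≈cv i) (trans (*-congˡ (v≈dw i)) (sym (*-assoc c d (w i))))

  ∼-setoid : Setoid a (a ⊔ b)
  ∼-setoid = record
    { Carrier       = Vector Carrier 3
    ; _≈_           = _∼_
    ; isEquivalence = record { refl = ∼-refl ; sym = ∼-sym ; trans = ∼-trans }
    }

  -- Homogeneous coordinates; a line [u,v,w] is the locus ux + vy + wz = 0.
  Points Lines : Setoid (a ⊔ b) (a ⊔ b)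
  Points = Restrict ∼-setoid λ v → ¬ v ≋ 0ᵥ
  Lines  = Restrict ∼-setoid λ v → ¬ v ≋ 0ᵥ

  Point Line : Set (a ⊔ b)
  Point = Setoid.Carrier Points
  Line  = Setoid.Carrier Lines

  coords : Point → Vector Carrier 3
  coords = proj₁

  coeffs : Line → Vector Carrier 3
  coeffs = proj₁

  dot : Vector Carrier 3 → Vector Carrier 3 → Carrier
  dot v w = sum (zipWith _*_ v w)

  _on_ : Point → Line → Set b
  P on ℓ = dot (coeffs ℓ) (coords P) ≈ 0#

  ℓ∞ : Line
  ℓ∞ = (0# ∷ 0# ∷ 1# ∷ []) , λ eq → 1≉0 (eq (Fin.suc (Fin.suc Fin.zero)))

  MeetsIn : ∀ {s} → Pred Point s → ℕ → Pred Line (a ⊔ b ⊔ s)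
  MeetsIn 𝒦 n ℓ = HasSize Points (𝒦 ∩ (_on ℓ)) n

  OfType : ∀ {s} → Pred Point s → List ℕ → Set (a ⊔ b ⊔ s)
  OfType 𝒦 as = ∀ ℓ → ∃ λ n → n ∈ˡ as × ℓ ∈ MeetsIn 𝒦 n

  OfClass : ∀ {s} → Pred Point s → List ℕ → Set (a ⊔ b ⊔ s)
  OfClass 𝒦 as = OfType 𝒦 as × (∀ n → n ∈ˡ as → ∃ λ ℓ → ℓ ∈ MeetsIn 𝒦 n)

  IsArc : ∀ {s} → Pred Point s → Set (a ⊔ b ⊔ s)
  IsArc 𝒦 = OfType 𝒦 (0 List.∷ 1 List.∷ 2 List.∷ List.[])

  Tangent : ∀ {s} → Pred Point s → Pred Line (a ⊔ b ⊔ s)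
  Tangent 𝒦 = MeetsIn 𝒦 1

  discriminant : Carrier → Carrier → Carrier
  discriminant α β = (β ^ q - β) ^ 2 + 4 · (α ^ (q ℕ.+ 1))

  𝒰 : Carrier → Carrier → Pred Point (a ⊔ b ⊔ p)
  𝒰 α β P =
    (∃₂ λ x r → r ∈ K ×
       coords P ∼ (x ∷ (α * x ^ 2 + β * x ^ (q ℕ.+ 1) + r) ∷ 1# ∷ []))
    ⊎ coords P ∼ (0# ∷ 1# ∷ 0# ∷ [])

  pedal : ∀ {s} → Pred Point s → Point → Pred Point (a ⊔ b ⊔ s)
  pedal 𝒱 P Q = ∃ λ ℓ → ℓ ∈ Tangent 𝒱 × P on ℓ × Q ∈ 𝒱 × Q on ℓ

  Matrix : Set a
  Matrix = Vector (Vector Carrier 3) 3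

  _⊙_ : Matrix → Vector Carrier 3 → Vector Carrier 3
  (M ⊙ v) i = dot (M i) v

  record Projectivity : Set (a ⊔ b) where
    field
      matrix inverse : Matrix
      inverseˡ : ∀ v → inverse ⊙ matrix ⊙ v ≋ v
      inverseʳ : ∀ v → matrix ⊙ inverse ⊙ v ≋ v

  -- The image of {(s,t,0) : (s,t) ∈ K² ∖ {(0,0)}} under a projectivity.
  BaerSubline : Projectivity → Pred Point (a ⊔ b ⊔ p)
  BaerSubline φ Q = ∃₂ λ s t → s ∈ K × t ∈ K × ¬ (s ≈ 0# × t ≈ 0#) ×
    coords Q ∼ Projectivity.matrix φ ⊙ (s ∷ t ∷ 0# ∷ [])

  record BaerPencil : Set (a ⊔ b ⊔ p) where
    field
      vertex   : Point
      φ        : Projectivity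
      baseLine : Line
      base⊆baseLine : BaerSubline φ ⊆ (_on baseLine)
      -- Otherwise there would be a single joining line instead of q + 1.
      vertex∉baseLine : ¬ vertex on baseLine

    lines : Pred Line (a ⊔ b ⊔ p)
    lines ℓ = vertex on ℓ × (∃ λ Q → Q ∈ BaerSubline φ × Q on ℓ)

    Covers : ∀ {s} → Pred Point s → Set (a ⊔ b ⊔ p ⊔ s)
    Covers 𝒦 = ∀ Q → Q ∈ 𝒦 → ∃ λ ℓ → ℓ ∈ lines × Q on ℓ

{-# OPTIONS --safe #-}

-- Write x̄ = x^q, δ = β - β̄, P = (x₀, y₀, 1), Q(u) = αu² - ᾱū² + δuū and c = (y₀ - ȳ₀) - Q(x₀) ≠ 0. The form Q is anisotropic
-- because d = δ² + 4αᾱ is a nonsquare of 𝔽_q. Completing the square on the lines through P shows that the feet are the points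
-- (x₀ + u, y₀ + Au + W(u), 1) with Q(u) = -c, where A = 2αx₀ + δx̄₀ and W(u) = 2αu² + δuū. On feet, W(u) + c lies in 𝔽_q, so they
-- lie on the lines of a Baer pencil with vertex (1, A, 0). A line not through the vertex contains only feet u + τr with r ∈ 𝔽_q,
-- hence at most two; a line through the vertex cuts out a level set of W. If u and v are feet on such a line with v ≠ ±u, then
-- αuve/W(u), where e² = d, is an element of 𝔽_q whose square is αᾱ, so α is a square. Conversely, if α = s², then an 𝔽_q-linear
-- substitution z = ζ(u) turns Q into the norm zz̄ and W into z² + z̄² (up to constants), so that the feet form a norm circle
-- of q + 1 elements, and the level sets of W are the orbits {±z, ±z̄}; at most four elements z lie in degenerate orbits.
module Submission where

open import Defs
import Algebra.Properties.AbelianGroup as AbelianGroupProperties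
import Algebra.Properties.CommutativeMonoid.Sum as Sums
import Algebra.Properties.Ring as RingProperties
import Algebra.Properties.Semiring.Mult.TCOptimised as Multiples
import Algebra.Solver.Ring as RingSolver
open import Algebra.Bundles using (CommutativeRing)
open import Algebra.Solver.Ring.AlmostCommutativeRing using (AlmostCommutativeRing; fromCommutativeRing; _-Raw-AlmostCommutative⟶_; Induced-equivalence)
open import Data.Empty using (⊥)
open import Data.Fin.Base using (Fin; zero; suc; combine; inject≤; join; punchIn; punchOut; remQuot; splitAt)
open import Data.Fin.Patterns
open import Data.Fin.Permutation as Perm using (Permutation; permutation; _⟨$⟩ʳ_)
import Data.Fin.Properties as Finₚ
open import Data.Integer.Base as ℤ using (ℤ; +_; -[1+_]; 0ℤ; 1ℤ)
import Data.Integer.Properties as ℤₚ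
open import Data.List.Base using ([]; _∷_)
open import Data.List.Membership.Propositional using () renaming (_∈_ to _∈ˡ_)
open import Data.List.Relation.Unary.Any using (here; there)
open import Data.Maybe.Base using (just; nothing)
open import Data.Nat.Base as ℕ using (ℕ; zero; suc)
open import Data.Nat.Divisibility using (_∣_; ∣-refl; ∣m∣n⇒∣m+n; _∣0)
import Data.Nat.Properties as ℕₚ
import Data.Nat.Solver as ℕSolver
open import Data.Product.Base using (∃; _×_; _,_; proj₁; proj₂)
open import Data.Sum.Base as Sum using (_⊎_; inj₁; inj₂)
open import Data.Vec.Functional using (Vector; removeAt; replicate) renaming ([] to []ᵥ; _∷_ to _∷ᵥ_)
open import Function.Base using (_∘_; id)
open import Function.Bundles using (Bijection)
open import Level using (Level; _⊔_)
open import Relation.Binary.Bundles using (Setoid)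
open import Relation.Binary.Definitions using (WeaklyDecidable)
open import Relation.Binary.PropositionalEquality as ≡ using (_≡_)
open import Relation.Nullary.Decidable using (Dec; yes; no; map′; ¬?; _×-dec_; decidable-stable)
open import Relation.Nullary.Negation using (¬_; contradiction)
open import Relation.Unary using (Pred; U; _∈_; _∉_; _∩_; Decidable)

-- The level sets of `W` are governed by a quadratic equation. The norm n = uū satisfies dn² -
-- 2δQ(u)n - W(u)·conj(W(u)) = 0, whose coefficients depend on W(u) alone because W - conj W = 2Q. A
-- level set thus carries at most two norms, each of which fixes u up to sign, and Vieta's relations
-- for two different norms yield the square of αuve/W(u). For α = s² the substitution ζ is a linear
-- factor of Q over 𝔽_{q²}, viewed as a binary form in su and its conjugate. The constant in (q -
-- 3)/4 comes from q + 1 points on the norm circle, of which at most four are degenerate, namely the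
-- square roots of κ and of -κ, where κ is the norm; the rest fall into orbits of four. The bound is
-- empty at q = 3, while class (0,1,2,4) demands a line with four feet, so that case has to be
-- refuted separately: there no square α satisfies the condition on d. The fields are given only by
-- their sizes. Additivity of x^q, its fixed field and the surjectivity of the norm are therefore
-- all obtained by counting roots of polynomial functions.

private
  variable
    a b p : Level

-- Ring solver with integer coefficients

module IntegerCoefficients {a b} (R : CommutativeRing a b) where

  open CommutativeRing R
  open Multiples semiring using (1+×; ×-homo-+; ×1-homo-*) renaming (_×_ to _·_)
  open RingProperties ring using (-‿distribˡ-*; -‿distribʳ-*)
  open AbelianGroupProperties +-abelianGroup using (ε⁻¹≈ε; ⁻¹-involutive; ⁻¹-∙-comm)
  open import Relation.Binary.Reasoning.Setoid setoid

  -- With the optimised multiples the numerals 1 and 2 evaluate to `1#` and `1# + 1#`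
  -- definitionally, so solved identities with `con` fit the ring terms as they stand.
  fromℤ : ℤ → Carrier
  fromℤ (+ n)    = n · 1#
  fromℤ -[1+ n ] = - (suc n · 1#)

  fromℤ-neg : ∀ i → fromℤ (ℤ.- i) ≈ - fromℤ i
  fromℤ-neg (+ zero)  = sym ε⁻¹≈ε
  fromℤ-neg (+ suc n) = refl
  fromℤ-neg -[1+ n ]  = sym (⁻¹-involutive _)

  fromℤ-⊖ : ∀ m n → fromℤ (m ℤ.⊖ n) ≈ m · 1# - n · 1#
  fromℤ-⊖ m zero = begin
    fromℤ (m ℤ.⊖ 0)    ≡⟨ ≡.cong fromℤ (ℤₚ.⊖-≥ {m} {0} ℕ.z≤n) ⟩
    m · 1#             ≈⟨ +-identityʳ _ ⟨
    m · 1# + 0#        ≈⟨ +-congˡ ε⁻¹≈ε ⟨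
    m · 1# - 0#        ∎
  fromℤ-⊖ zero (suc n) = sym (+-identityˡ _)
  fromℤ-⊖ (suc m) (suc n) = begin
    fromℤ (suc m ℤ.⊖ suc n)                ≡⟨ ≡.cong fromℤ (ℤₚ.[1+m]⊖[1+n]≡m⊖n m n) ⟩
    fromℤ (m ℤ.⊖ n)                        ≈⟨ fromℤ-⊖ m n ⟩
    m · 1# - n · 1#                        ≈⟨ +-congʳ (+-identityˡ _) ⟨
    (0# + m · 1#) - n · 1#                 ≈⟨ +-congʳ (+-congʳ (-‿inverseʳ 1#)) ⟨
    ((1# - 1#) + m · 1#) - n · 1#          ≈⟨ +-congʳ (trans (+-assoc _ _ _) (+-congˡ (+-comm _ _))) ⟩
    (1# + (m · 1# - 1#)) - n · 1#          ≈⟨ trans (+-congʳ (sym (+-assoc _ _ _))) (+-assoc _ _ _) ⟩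
    (1# + m · 1#) + (- 1# - n · 1#)        ≈⟨ +-congˡ (⁻¹-∙-comm _ _) ⟩
    (1# + m · 1#) - (1# + n · 1#)          ≈⟨ +-cong (1+× m 1#) (-‿cong (1+× n 1#)) ⟨
    suc m · 1# - suc n · 1#                ∎

  fromℤ-+ : ∀ i j → fromℤ (i ℤ.+ j) ≈ fromℤ i + fromℤ j
  fromℤ-+ (+ m)    (+ n)    = ×-homo-+ 1# m n
  fromℤ-+ (+ m)    -[1+ n ] = fromℤ-⊖ m (suc n)
  fromℤ-+ -[1+ m ] (+ n)    = trans (fromℤ-⊖ n (suc m)) (+-comm _ _)
  fromℤ-+ -[1+ m ] -[1+ n ] = trans (-‿cong lemma) (sym (⁻¹-∙-comm _ _))
    where
    lemma : suc (suc (m ℕ.+ n)) · 1# ≈ suc m · 1# + suc n · 1#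
    lemma = trans (reflexive (≡.cong (_· 1#) (≡.sym (ℕₚ.+-suc (suc m) n)))) (×-homo-+ 1# (suc m) (suc n))

  fromℤ-*⁺ : ∀ m n → fromℤ (+ m ℤ.* + n) ≈ m · 1# * (n · 1#)
  fromℤ-*⁺ m n = begin
    fromℤ (+ m ℤ.* + n)   ≡⟨ ≡.cong fromℤ (ℤₚ.pos-* m n) ⟨
    (m ℕ.* n) · 1#        ≈⟨ ×1-homo-* m n ⟩
    m · 1# * (n · 1#)     ∎

  fromℤ-* : ∀ i j → fromℤ (i ℤ.* j) ≈ fromℤ i * fromℤ j
  fromℤ-* (+ m)    (+ n)    = fromℤ-*⁺ m n
  fromℤ-* (+ m)    -[1+ n ] = begin
    fromℤ (+ m ℤ.* ℤ.- (+ suc n))     ≡⟨ ≡.cong fromℤ (ℤₚ.neg-distribʳ-* (+ m) (+ suc n)) ⟨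
    fromℤ (ℤ.- (+ m ℤ.* + suc n))     ≈⟨ fromℤ-neg (+ m ℤ.* + suc n) ⟩
    - fromℤ (+ m ℤ.* + suc n)         ≈⟨ -‿cong (fromℤ-*⁺ m (suc n)) ⟩
    - (m · 1# * (suc n · 1#))         ≈⟨ -‿distribʳ-* _ _ ⟩
    m · 1# * - (suc n · 1#)           ∎
  fromℤ-* -[1+ m ] (+ n)    = begin
    fromℤ (ℤ.- (+ suc m) ℤ.* + n)     ≡⟨ ≡.cong fromℤ (ℤₚ.neg-distribˡ-* (+ suc m) (+ n)) ⟨
    fromℤ (ℤ.- (+ suc m ℤ.* + n))     ≈⟨ fromℤ-neg (+ suc m ℤ.* + n) ⟩
    - fromℤ (+ suc m ℤ.* + n)         ≈⟨ -‿cong (fromℤ-*⁺ (suc m) n) ⟩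
    - (suc m · 1# * (n · 1#))         ≈⟨ -‿distribˡ-* _ _ ⟩
    - (suc m · 1#) * (n · 1#)         ∎
  fromℤ-* -[1+ m ] -[1+ n ] = begin
    fromℤ (+ suc m ℤ.* + suc n)       ≈⟨ fromℤ-*⁺ (suc m) (suc n) ⟩
    suc m · 1# * (suc n · 1#)         ≈⟨ ⁻¹-involutive _ ⟨
    - - (suc m · 1# * (suc n · 1#))   ≈⟨ -‿cong (-‿distribˡ-* _ _) ⟩
    - (- (suc m · 1#) * (suc n · 1#)) ≈⟨ -‿distribʳ-* _ _ ⟩
    - (suc m · 1#) * - (suc n · 1#)   ∎

  private
    almostCommutativeRing : AlmostCommutativeRing a b
    almostCommutativeRing = fromCommutativeRing R

    homomorphism : ℤ.+-*-rawRing -Raw-AlmostCommutative⟶ almostCommutativeRing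
    homomorphism = record
      { ⟦_⟧    = fromℤ
      ; +-homo = fromℤ-+
      ; *-homo = fromℤ-*
      ; -‿homo = fromℤ-neg
      ; 0-homo = refl
      ; 1-homo = refl
      }

    _coeff≟_ : WeaklyDecidable (Induced-equivalence homomorphism)
    i coeff≟ j with i ℤₚ.≟ j
    ... | yes i≡j = just (reflexive (≡.cong fromℤ i≡j))
    ... | no _    = nothing

  open RingSolver ℤ.+-*-rawRing almostCommutativeRing homomorphism _coeff≟_ public
    using (solve; _:=_; _:+_; _:*_; :-_; _:-_; con; Polynomial)

-- Enumerations of finite subsets

module Enumeration (S : Setoid a b) {P : Pred (Setoid.Carrier S) p} {n : ℕ} (size : HasSize S P n) where

  open Setoid S

  element : Fin n → Carrier
  element i = proj₁ (Bijection.to size i)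

  element-∈ : ∀ i → element i ∈ P
  element-∈ i = proj₂ (Bijection.to size i)

  element-injective : ∀ {i j} → element i ≈ element j → i ≡ j
  element-injective = Bijection.injective size

  index : ∀ {x} → x ∈ P → Fin n
  index {x} x∈P = proj₁ (Bijection.surjective size (x , x∈P))

  element-index : ∀ {x} (x∈P : x ∈ P) → element (index x∈P) ≈ x
  element-index {x} x∈P = proj₂ (Bijection.surjective size (x , x∈P)) ≡.refl

module _ (S : Setoid a b) where

  open Setoid S

  hasSize : ∀ {P : Pred Carrier p} {n} (f : Fin n → Carrier) → (∀ i → f i ∈ P) →
            (∀ {i j} → f i ≈ f j → i ≡ j) → (∀ x → x ∈ P → ∃ λ i → f i ≈ x) → HasSize S P n
  hasSize f f∈P f-injective f-surjective = record
    { to        = λ i → f i , f∈P i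
    ; cong      = λ where ≡.refl → refl
    ; bijective = f-injective , λ where
        (x , x∈P) → proj₁ (f-surjective x x∈P) , λ where ≡.refl → proj₂ (f-surjective x x∈P)
    }

  size-≤ : ∀ {q} {P : Pred Carrier p} {Q : Pred Carrier q} {m n} → (∀ {x} → x ∈ P → x ∈ Q) →
           HasSize S P m → HasSize S Q n → m ℕ.≤ n
  size-≤ P⊆Q sizeP sizeQ = Finₚ.injective⇒≤ {f = λ i → ℚ.index (P⊆Q (ℙ.element-∈ i))} λ {i} {j} eq →
    ℙ.element-injective (trans (sym (ℚ.element-index (P⊆Q (ℙ.element-∈ i))))
      (trans (reflexive (≡.cong ℚ.element eq)) (ℚ.element-index (P⊆Q (ℙ.element-∈ j)))))
    where
    module ℙ = Enumeration S sizeP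
    module ℚ = Enumeration S sizeQ

-- Finite fields: polynomial functions and root counting

module FiniteField (F : CommutativeRing a b) (isField : IsField F) {N : ℕ}
  (finite : HasSize (CommutativeRing.setoid F) U N) where

  open CommutativeRing F hiding (zero)
  open IsField isField
  open IntegerCoefficients F
  open AbelianGroupProperties +-abelianGroup public using () renaming (ε⁻¹≈ε to -0≈0)
  open AbelianGroupProperties +-abelianGroup using (x∙y⁻¹≈ε⇒x≈y; x≈y⇒x∙y⁻¹≈ε)
  open Sums *-commutativeMonoid using () renaming
    (sum to product; sum-permute to product-permute; ∑-distrib-+ to product-distrib-*; sum-replicate to product-replicate;
     sum-cong-≋ to product-cong)
  open Sums +-commutativeMonoid using (sum; sum-permute; ∑-distrib-+; sum-replicate; sum-cong-≋)
  open import Algebra.Properties.CommutativeSemiring.Exp commutativeSemiring public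
  open import Algebra.Properties.Monoid.Mult +-monoid using (×-homo-+) renaming (_×_ to _·_)
  open import Relation.Binary.Reasoning.Setoid setoid
  private module 𝔽 = Enumeration setoid finite

  infix 4 _≟_
  _≟_ : ∀ x y → Dec (x ≈ y)
  x ≟ y = map′ to from (𝔽.index {x} _ Finₚ.≟ 𝔽.index {y} _)
    where
    to : 𝔽.index {x} _ ≡ 𝔽.index {y} _ → x ≈ y
    to eq = trans (sym (𝔽.element-index _)) (trans (reflexive (≡.cong 𝔽.element eq)) (𝔽.element-index _))
    from : x ≈ y → 𝔽.index {x} _ ≡ 𝔽.index {y} _
    from x≈y = 𝔽.element-injective (trans (𝔽.element-index _) (trans x≈y (sym (𝔽.element-index _))))

  inv : ∀ {x} → ¬ x ≈ 0# → Carrier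
  inv {x} x≉0 = proj₁ (inverses x x≉0)

  inv-* : ∀ {x} (x≉0 : ¬ x ≈ 0#) → inv x≉0 * x ≈ 1#
  inv-* {x} x≉0 = proj₁ (proj₂ (inverses x x≉0))

  *-zero : ∀ {x y} → x * y ≈ 0# → x ≈ 0# ⊎ y ≈ 0#
  *-zero {x} {y} xy≈0 with x ≟ 0#
  ... | yes x≈0 = inj₁ x≈0
  ... | no  x≉0 = inj₂ (begin
    y                   ≈⟨ *-identityˡ y ⟨
    1# * y              ≈⟨ *-congʳ (inv-* x≉0) ⟨
    inv x≉0 * x * y     ≈⟨ *-assoc _ _ _ ⟩
    inv x≉0 * (x * y)   ≈⟨ *-congˡ xy≈0 ⟩
    inv x≉0 * 0#        ≈⟨ zeroʳ _ ⟩
    0#                  ∎)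

  *-nonzero : ∀ {x y} → ¬ x ≈ 0# → ¬ y ≈ 0# → ¬ x * y ≈ 0#
  *-nonzero x≉0 y≉0 xy≈0 with *-zero xy≈0
  ... | inj₁ x≈0 = x≉0 x≈0
  ... | inj₂ y≈0 = y≉0 y≈0

  *-zero⇒ʳ : ∀ {x y} → ¬ x ≈ 0# → x * y ≈ 0# → y ≈ 0#
  *-zero⇒ʳ x≉0 xy≈0 with *-zero xy≈0
  ... | inj₁ x≈0 = contradiction x≈0 x≉0
  ... | inj₂ y≈0 = y≈0

  difference-zero : ∀ {x y} → x - y ≈ 0# → x ≈ y
  difference-zero = x∙y⁻¹≈ε⇒x≈y _ _

  zero-difference : ∀ {x y} → x ≈ y → x - y ≈ 0#
  zero-difference = x≈y⇒x∙y⁻¹≈ε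

  *-cancelˡ : ∀ {x y z} → ¬ x ≈ 0# → x * y ≈ x * z → y ≈ z
  *-cancelˡ {x} {y} {z} x≉0 xy≈xz = difference-zero (*-zero⇒ʳ x≉0 (begin
    x * (y - z)       ≈⟨ solve 3 (λ x y z → x :* (y :- z) := x :* y :- x :* z) refl x y z ⟩
    x * y - x * z     ≈⟨ zero-difference xy≈xz ⟩
    0#                ∎))

  product-zero : ∀ {n} (t : Vector Carrier n) → product t ≈ 0# → ∃ λ i → t i ≈ 0#
  product-zero {zero}  t 1≈0 = contradiction 1≈0 1≉0
  product-zero {suc n} t eq with *-zero eq
  ... | inj₁ t₀≈0 = zero , t₀≈0
  ... | inj₂ rest = let i , tᵢ≈0 = product-zero (t ∘ suc) rest in suc i , tᵢ≈0

  -- Polynomial functions c₀ + c₁x + ⋯ + lxⁿ; the leading coefficient l may vanish.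
  Polynomial[_,_] : Carrier → ℕ → (Carrier → Carrier) → Set (a ⊔ b)
  Polynomial[ l , zero ]  f = ∀ x → f x ≈ l
  Polynomial[ l , suc n ] f = ∃ λ c → ∃ λ g → Polynomial[ l , n ] g × (∀ x → f x ≈ c + x * g x)

  -- Horner division by x - r. The quotient keeps the leading coefficient, so splitting off `n`
  -- roots in `factorisation` leaves exactly the constant `l`.
  factor : ∀ {l n f} r → Polynomial[ l , suc n ] f →
           ∃ λ h → Polynomial[ l , n ] h × (∀ x → f x ≈ f r + (x - r) * h x)
  factor {l} {zero} {f} r (c , g , g≈l , f≈) = (λ _ → l) , (λ _ → refl) , λ x → begin
    f x                          ≈⟨ f≈ x ⟩
    c + x * g x                  ≈⟨ +-congˡ (*-congˡ (g≈l x)) ⟩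
    c + x * l                    ≈⟨ solve 4 (λ c x r l → c :+ x :* l := (c :+ r :* l) :+ (x :- r) :* l) refl c x r l ⟩
    c + r * l + (x - r) * l      ≈⟨ +-congʳ (+-congˡ (*-congˡ (g≈l r))) ⟨
    c + r * g r + (x - r) * l    ≈⟨ +-congʳ (f≈ r) ⟨
    f r + (x - r) * l            ∎
  factor {l} {suc n} {f} r (c , g , pol-g , f≈) with factor r pol-g
  ... | k , pol-k , g≈ = (λ x → g r + x * k x) , (g r , k , pol-k , λ _ → refl) , λ x → begin
    f x                                     ≈⟨ f≈ x ⟩
    c + x * g x                             ≈⟨ +-congˡ (*-congˡ (g≈ x)) ⟩
    c + x * (g r + (x - r) * k x)           ≈⟨ solve 5 (λ c x r gr kx → c :+ x :* (gr :+ (x :- r) :* kx) := (c :+ r :* gr) :+ (x :- r) :* (gr :+ x :* kx)) refl c x r (g r) (k x) ⟩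
    c + r * g r + (x - r) * (g r + x * k x) ≈⟨ +-congʳ (f≈ r) ⟨
    f r + (x - r) * (g r + x * k x)         ∎

  factorisation : ∀ {l n f} → Polynomial[ l , n ] f → (r : Fin n → Carrier) → (∀ {i j} → r i ≈ r j → i ≡ j) →
                  (∀ i → f (r i) ≈ 0#) → ∀ x → f x ≈ l * product (λ i → x - r i)
  factorisation {l} {zero}  {f} f≈l r r-injective roots x = trans (f≈l x) (sym (*-identityʳ l))
  factorisation {l} {suc n} {f} pol r r-injective roots x with factor (r zero) pol
  ... | h , pol-h , f≈ = begin
    f x                                             ≈⟨ f≈₀ x ⟩
    (x - r zero) * h x                              ≈⟨ *-congˡ (factorisation pol-h (r ∘ suc) (Finₚ.suc-injective ∘ r-injective) roots-h x) ⟩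
    (x - r zero) * (l * product (λ i → x - r (suc i))) ≈⟨ solve 3 (λ y l p → y :* (l :* p) := l :* (y :* p)) refl _ l _ ⟩
    l * ((x - r zero) * product (λ i → x - r (suc i))) ∎
    where
    f≈₀ : ∀ x → f x ≈ (x - r zero) * h x
    f≈₀ x = trans (f≈ x) (trans (+-congʳ (roots zero)) (+-identityˡ _))
    roots-h : ∀ i → h (r (suc i)) ≈ 0#
    roots-h i = *-zero⇒ʳ (λ eq → contradiction (r-injective (difference-zero eq)) λ ()) (trans (sym (f≈₀ _)) (roots (suc i)))

  -- Once `n` of the roots are split off, evaluation at the remaining one gives `l` times a product
  -- of nonzero differences.
  too-many-roots : ∀ {l n f} → Polynomial[ l , n ] f → (r : Fin (suc n) → Carrier) → (∀ {i j} → r i ≈ r j → i ≡ j) →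
                   (∀ i → f (r i) ≈ 0#) → l ≈ 0#
  too-many-roots {l} {n} {f} pol r r-injective roots
    with *-zero (trans (sym (factorisation pol (r ∘ suc) (Finₚ.suc-injective ∘ r-injective) (roots ∘ suc) (r zero))) (roots zero))
  ... | inj₁ l≈0 = l≈0
  ... | inj₂ eq with product-zero (λ i → r zero - r (suc i)) eq
  ... | i , r₀-rᵢ≈0 = contradiction (r-injective (difference-zero r₀-rᵢ≈0)) λ ()

  polynomial-- : ∀ {l m n f g} → Polynomial[ l , n ] f → Polynomial[ m , n ] g → Polynomial[ l - m , n ] (λ x → f x - g x)
  polynomial-- {n = zero}  f≈l g≈m x = +-cong (f≈l x) (-‿cong (g≈m x))
  polynomial-- {n = suc n} {f} {g} (c , f′ , pol-f′ , f≈) (d , g′ , pol-g′ , g≈) =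
    c - d , (λ x → f′ x - g′ x) , polynomial-- pol-f′ pol-g′ , λ x → begin
      f x - g x                           ≈⟨ +-cong (f≈ x) (-‿cong (g≈ x)) ⟩
      c + x * f′ x - (d + x * g′ x)       ≈⟨ solve 5 (λ c x f d g → c :+ x :* f :- (d :+ x :* g) := (c :- d) :+ x :* (f :- g)) refl c x (f′ x) d (g′ x) ⟩
      c - d + x * (f′ x - g′ x)           ∎

  -- The difference of two monic functions has leading coefficient `1# - 1#`, so `n` common values
  -- suffice instead of n + 1. For the maps of degree q below, `K` supplies exactly q points.
  agree : ∀ {n f g} → Polynomial[ 1# , n ] f → Polynomial[ 1# , n ] g → (r : Fin n → Carrier) →
          (∀ {i j} → r i ≈ r j → i ≡ j) → (∀ i → f (r i) ≈ g (r i)) → ∀ x → f x ≈ g x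
  agree {n} {f} {g} pol-f pol-g r r-injective eq x = difference-zero (begin
    f x - g x                                ≈⟨ factorisation (polynomial-- pol-f pol-g) r r-injective (zero-difference ∘ eq) x ⟩
    (1# - 1#) * product (λ i → x - r i)      ≈⟨ *-congʳ (-‿inverseʳ 1#) ⟩
    0# * product (λ i → x - r i)             ≈⟨ zeroˡ _ ⟩
    0#                                       ∎)

  -- Degree 0 is excluded because there the added constant would change the leading coefficient.
  polynomial-shift : ∀ {l n f} .{{_ : ℕ.NonZero n}} d → Polynomial[ l , n ] f → Polynomial[ l , n ] (λ x → f x + d)
  polynomial-shift {n = suc _} {f = f} d (c , g , pol-g , f≈) = d + c , g , pol-g ,
    λ x → trans (+-congʳ (f≈ x)) (solve 3 (λ c t d → (c :+ t) :+ d := (d :+ c) :+ t) refl c (x * g x) d)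

  polynomial-linear-* : ∀ {l n f} d → Polynomial[ l , n ] f → Polynomial[ l , suc n ] (λ x → (x + d) * f x)
  polynomial-linear-* {l} {zero} {f} d f≈l = d * l , (λ _ → l) , (λ _ → refl) ,
    λ x → trans (*-congˡ (f≈l x)) (solve 3 (λ x d l → (x :+ d) :* l := d :* l :+ x :* l) refl x d l)
  polynomial-linear-* {l} {suc n} {f} d (c , g , pol-g , f≈) =
    d * c , (λ x → (x + d) * g x + c) , polynomial-shift c (polynomial-linear-* d pol-g) , λ x → begin
      (x + d) * f x                         ≈⟨ *-congˡ (f≈ x) ⟩
      (x + d) * (c + x * g x)               ≈⟨ solve 4 (λ x d c g → (x :+ d) :* (c :+ x :* g) := d :* c :+ x :* ((x :+ d) :* g :+ c)) refl x d c (g x) ⟩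
      d * c + x * ((x + d) * g x + c)       ∎

  polynomial-power : ∀ n → Polynomial[ 1# , n ] (_^ n)
  polynomial-power zero    _ = refl
  polynomial-power (suc n)   = 0# , _ , polynomial-power n , λ _ → sym (+-identityˡ _)

  polynomial-^ : ∀ d n → Polynomial[ 1# , n ] (λ x → (x + d) ^ n)
  polynomial-^ d zero    x = refl
  polynomial-^ d (suc n)   = polynomial-linear-* d (polynomial-^ d n)

  polynomial-monomial-* : ∀ {l n f} m → Polynomial[ l , n ] f → Polynomial[ l , m ℕ.+ n ] (λ x → x ^ m * f x)
  polynomial-monomial-* {n = zero}  zero    pol x = trans (*-identityˡ _) (pol x)
  polynomial-monomial-* {n = suc n} zero    (c , g , pol-g , f≈) = c , g , pol-g , λ x → trans (*-identityˡ _) (f≈ x)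
  polynomial-monomial-* (suc m) pol = 0# , _ , polynomial-monomial-* m pol ,
    λ x → trans (*-assoc _ _ _) (sym (+-identityˡ _))

  polynomial-∘-^ : ∀ {l n f} m → Polynomial[ l , n ] f → Polynomial[ l , n ℕ.* suc m ] (λ x → f (x ^ suc m))
  polynomial-∘-^ {n = zero}  m f≈l x = f≈l (x ^ suc m)
  polynomial-∘-^ {n = suc n} {f} m (c , g , pol-g , f≈)
    with polynomial-shift c (polynomial-monomial-* (suc m) (polynomial-∘-^ m pol-g))
  ... | c′ , g′ , pol-g′ , f≈′ = c′ , g′ , pol-g′ , λ x → trans (f≈ _) (trans (+-comm _ _) (f≈′ x))

  polynomial-product : ∀ {n} (r : Fin n → Carrier) → Polynomial[ 1# , n ] (λ x → product (λ i → x - r i))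
  polynomial-product {zero}  r x = refl
  polynomial-product {suc n} r   = polynomial-linear-* (- r zero) (polynomial-product (r ∘ suc))

  -- The argument `Fin n` witnesses that `n` is positive, as the zeroth power of 0 is 1.
  zero-power : ∀ {n x} → Fin n → x ≈ 0# → x ^ n ≈ x
  zero-power {suc n} {x} _ x≈0 = trans (*-congʳ x≈0) (trans (zeroˡ _) (sym x≈0))

  -- Comparing the product of the nonzero values of e before and after the permutation gives xⁿ⁻¹ = 1.
  scaling-power : ∀ {n x} (e : Fin n → Carrier) → (∀ {i j} → e i ≈ e j → i ≡ j) → (z : Fin n) → e z ≈ 0# →
    (π : Permutation n n) → (∀ i → e (π ⟨$⟩ʳ i) ≈ x * e i) → x ^ n ≈ x
  scaling-power {suc n} {x} e e-injective z ez≈0 π scales = trans (*-congˡ xⁿ≈1) (*-identityʳ x)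
    where
    t : Vector Carrier n
    t = removeAt e z
    π′ : Permutation n n
    π′ = Perm.remove z π
    πz≡z : π ⟨$⟩ʳ z ≡ z
    πz≡z = e-injective (trans (scales z) (trans (*-congˡ ez≈0) (trans (zeroʳ x) (sym ez≈0))))
    scales′ : ∀ j → t (π′ ⟨$⟩ʳ j) ≈ x * t j
    scales′ j = begin
      e (punchIn z (π′ ⟨$⟩ʳ j))            ≡⟨ ≡.cong (λ i → e (punchIn i (π′ ⟨$⟩ʳ j))) πz≡z ⟨
      e (punchIn (π ⟨$⟩ʳ z) (π′ ⟨$⟩ʳ j))    ≡⟨ ≡.cong e (Perm.punchIn-permute π z j) ⟨
      e (π ⟨$⟩ʳ punchIn z j)               ≈⟨ scales _ ⟩
      x * t j                              ∎
    t≉0 : ¬ product t ≈ 0#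
    t≉0 eq with product-zero t eq
    ... | i , tᵢ≈0 = Finₚ.punchInᵢ≢i z i (e-injective (trans tᵢ≈0 (sym ez≈0)))
    xⁿ≈1 : x ^ n ≈ 1#
    xⁿ≈1 = *-cancelˡ t≉0 (begin
      product t * x ^ n                       ≈⟨ *-comm _ _ ⟩
      x ^ n * product t                       ≈⟨ *-congʳ (product-replicate n) ⟨
      product (replicate n x) * product t     ≈⟨ product-distrib-* {n} (λ _ → x) t ⟨
      product (λ j → x * t j)                 ≈⟨ product-cong {n} scales′ ⟨
      product (λ j → t (π′ ⟨$⟩ʳ j))            ≈⟨ product-permute t π′ ⟨
      product t                               ≈⟨ *-identityʳ _ ⟨
      product t * 1#                          ∎)

  -- Subfields: characteristic and Fermat's theorem

  module Subfield {K : Pred Carrier p} (isSubfield : IsSubfield F K) {q : ℕ} (sizeK : HasSize setoid K q) where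

    open IsSubfield isSubfield
    open Enumeration setoid sizeK public

    -- Turns a bijection of `K` into a permutation of indices, under which sums and products over
    -- `K` are invariant.
    K-permutation : (g g⁻¹ : Carrier → Carrier) → (∀ {x} → x ∈ K → g x ∈ K) → (∀ {x} → x ∈ K → g⁻¹ x ∈ K) →
      (∀ {x y} → x ≈ y → g x ≈ g y) → (∀ {x y} → x ≈ y → g⁻¹ x ≈ g⁻¹ y) →
      (∀ x → g (g⁻¹ x) ≈ x) → (∀ x → g⁻¹ (g x) ≈ x) →
      ∃ λ (π : Permutation q q) → ∀ i → element (π ⟨$⟩ʳ i) ≈ g (element i)
    K-permutation g g⁻¹ g∈ g⁻¹∈ g-cong g⁻¹-cong gg⁻¹ g⁻¹g =
      permutation (λ i → index (g∈ (element-∈ i))) (λ i → index (g⁻¹∈ (element-∈ i)))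
        (λ i → element-injective (trans (element-index _) (trans (g-cong (element-index _)) (gg⁻¹ _))))
        (λ i → element-injective (trans (element-index _) (trans (g⁻¹-cong (element-index _)) (g⁻¹g _)))) ,
      λ i → element-index _

    -- Translation by `1#` permutes `K`, so the sum of all elements of `K` grows by `q · 1#` and yet
    -- stays the same.
    characteristic : q · 1# ≈ 0#
    characteristic = difference-zero′ (begin
      q · 1# + sum element              ≈⟨ +-congʳ (sum-replicate q) ⟨
      sum (replicate q 1#) + sum element ≈⟨ ∑-distrib-+ {q} (λ _ → 1#) element ⟨
      sum (λ i → 1# + element i)        ≈⟨ sum-cong-≋ {q} (proj₂ shift) ⟨
      sum (λ i → element (proj₁ shift ⟨$⟩ʳ i)) ≈⟨ sum-permute element (proj₁ shift) ⟨
      sum element                       ∎)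
      where
      shift = K-permutation (λ x → 1# + x) (λ x → - 1# + x) (+-closed 1-closed) (+-closed (-‿closed 1-closed)) +-congˡ +-congˡ
        (solve 1 (λ x → con 1ℤ :+ (:- con 1ℤ :+ x) := x) refl) (solve 1 (λ x → :- con 1ℤ :+ (con 1ℤ :+ x) := x) refl)
      difference-zero′ : ∀ {x y} → x + y ≈ y → x ≈ 0#
      difference-zero′ {x} {y} eq = trans (solve 2 (λ x y → x := (x :+ y) :- y) refl x y) (zero-difference eq)

    -- For q = 2m + 1 the unit is `q · 1#` minus m times 2, and both terms would vanish.
    2≉0 : (∃ λ m → q ≡ suc (m ℕ.+ m)) → ¬ 1# + 1# ≈ 0#
    2≉0 (m , ≡.refl) 1+1≈0 = 1≉0 (begin
      1#                              ≈⟨ solve 1 (λ x → con 1ℤ := (con 1ℤ :+ (x :+ x)) :- x :* (con 1ℤ :+ con 1ℤ)) refl (m · 1#) ⟩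
      (1# + (m · 1# + m · 1#)) - m · 1# * (1# + 1#) ≈⟨ +-cong (+-congˡ (sym (×-homo-+ 1# m m))) (-‿cong (trans (*-congˡ 1+1≈0) (zeroʳ _))) ⟩
      q · 1# - 0#                     ≈⟨ +-cong characteristic -0≈0 ⟩
      0# + 0#                         ≈⟨ +-identityʳ _ ⟩
      0#                              ∎)

    -- Multiplication by a nonzero `x` permutes `K`. The module is also applied to the whole field,
    -- where this reads x^(q²) = x and makes the Frobenius map an involution.
    fermat : ∀ {x} → x ∈ K → x ^ q ≈ x
    fermat {x} x∈K with x ≟ 0#
    ... | yes x≈0 = zero-power (index 0-closed) x≈0
    ... | no  x≉0 with K-permutation (x *_) (inv x≉0 *_) (*-closed x∈K)
        (*-closed (⁻¹-closed x∈K (trans (*-comm _ _) (inv-* x≉0)))) *-congˡ *-congˡ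
        (λ y → trans (sym (*-assoc _ _ _)) (trans (*-congʳ (trans (*-comm _ _) (inv-* x≉0))) (*-identityˡ y)))
        (λ y → trans (sym (*-assoc _ _ _)) (trans (*-congʳ (inv-* x≉0)) (*-identityˡ y)))
    ... | π , scales = scaling-power element element-injective (index 0-closed) (element-index 0-closed) π scales

-- The Frobenius involution of 𝔽_{q²} over 𝔽_q

record Conjugation (F : CommutativeRing a b) (K : Pred (CommutativeRing.Carrier F) p) : Set (a ⊔ b ⊔ p) where
  open CommutativeRing F
  field
    conj            : Carrier → Carrier
    conj-cong       : ∀ {x y} → x ≈ y → conj x ≈ conj y
    conj-+          : ∀ x y → conj (x + y) ≈ conj x + conj y
    conj-*          : ∀ x y → conj (x * y) ≈ conj x * conj y
    conj-neg        : ∀ x → conj (- x) ≈ - conj x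
    conj-involutive : ∀ x → conj (conj x) ≈ x
    conj-fixed      : ∀ {x} → x ∈ K → conj x ≈ x
    fixed⇒∈         : ∀ {x} → conj x ≈ x → x ∈ K
    norm-surjective : ∀ {x} → x ∈ K → ∃ λ z → z * conj z ≈ x
    square-root     : ∀ {x} → x ∈ K → ∃ λ y → y * y ≈ x
    2≉0             : ¬ 1# + 1# ≈ 0#

module Frobenius (F : CommutativeRing a b) (isField : IsField F)
  (K : Pred (CommutativeRing.Carrier F) p) (isSubfield : IsSubfield F K)
  {q n m : ℕ} (q≡1+n : q ≡ suc n) (n≡2+2m : n ≡ suc m ℕ.+ suc m)
  (sizeF : HasSize (CommutativeRing.setoid F) U (q ℕ.^ 2)) (sizeK : HasSize (CommutativeRing.setoid F) K q) where

  open CommutativeRing F hiding (zero)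
  open IsField isField
  open IsSubfield isSubfield
  open IntegerCoefficients F
  open FiniteField F isField sizeF
  open Subfield isSubfield sizeK
  open Sums *-commutativeMonoid using () renaming (sum to product; sum-remove to product-remove)
  open import Relation.Binary.Reasoning.Setoid setoid
  private module 𝔽 = Enumeration setoid sizeF

  instance
    q-nonZero : ℕ.NonZero q
    q-nonZero = ≡.subst ℕ.NonZero (≡.sym q≡1+n) _
    n-nonZero : ℕ.NonZero n
    n-nonZero = ≡.subst ℕ.NonZero (≡.sym n≡2+2m) _

  x^q≈x*x^n : ∀ x → x ^ q ≈ x * x ^ n
  x^q≈x*x^n x = ^-congʳ x q≡1+n

  U-isSubfield : IsSubfield F U
  U-isSubfield = record {}

  -- Both sides are monic of degree q in `x` and agree on the q elements of `K`, by Fermat's theorem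
  -- for `x` and for `x + y`.
  frobenius-shift : ∀ {y} → y ∈ K → ∀ x → (x + y) ^ q ≈ x ^ q + y
  frobenius-shift {y} y∈K = agree (polynomial-^ y q) (polynomial-shift y (polynomial-power q)) element element-injective λ i → begin
    (element i + y) ^ q    ≈⟨ fermat (+-closed (element-∈ i) y∈K) ⟩
    element i + y          ≈⟨ +-congʳ (fermat (element-∈ i)) ⟨
    element i ^ q + y      ∎

  -- The same comparison for arbitrary `y`: at points of `K` the two sides agree by
  -- `frobenius-shift` with the summands exchanged. No binomial coefficients enter.
  frobenius-+ : ∀ x y → (x + y) ^ q ≈ x ^ q + y ^ q
  frobenius-+ x y = agree (polynomial-^ y q) (polynomial-shift (y ^ q) (polynomial-power q)) element element-injective (λ i → begin
    (element i + y) ^ q      ≈⟨ ^-congˡ q (+-comm _ _) ⟩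
    (y + element i) ^ q      ≈⟨ frobenius-shift (element-∈ i) y ⟩
    y ^ q + element i        ≈⟨ +-comm _ _ ⟩
    element i + y ^ q        ≈⟨ +-congʳ (fermat (element-∈ i)) ⟨
    element i ^ q + y ^ q    ∎) x

  frobenius-neg : ∀ x → (- x) ^ q ≈ - (x ^ q)
  frobenius-neg x = begin
    (- x) ^ q                      ≈⟨ solve 2 (λ s t → s := (t :+ s) :- t) refl _ (x ^ q) ⟩
    (x ^ q + (- x) ^ q) - x ^ q    ≈⟨ +-congʳ (frobenius-+ x (- x)) ⟨
    (x - x) ^ q - x ^ q            ≈⟨ +-congʳ (zero-power (index 0-closed) (-‿inverseʳ x)) ⟩
    (x - x) - x ^ q                ≈⟨ +-congʳ (-‿inverseʳ x) ⟩
    0# - x ^ q                     ≈⟨ +-identityˡ _ ⟩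
    - (x ^ q)                      ∎

  frobenius-involutive : ∀ x → (x ^ q) ^ q ≈ x
  frobenius-involutive x = begin
    (x ^ q) ^ q      ≈⟨ ^-assocʳ x q q ⟩
    x ^ (q ℕ.* q)    ≡⟨ ≡.cong (λ k → x ^ (q ℕ.* k)) (ℕₚ.*-identityʳ q) ⟨
    x ^ (q ℕ.^ 2)    ≈⟨ Subfield.fermat U-isSubfield sizeF {x} _ ⟩
    x                ∎

  -- The factor `x + 0#` brings x^q - x into the shape covered by `polynomial-linear-*`.
  polynomial-x^q-x : Polynomial[ 1# , q ] (λ x → (x + 0#) * (x ^ n - 1#))
  polynomial-x^q-x = ≡.subst (λ k → Polynomial[ 1# , k ] (λ x → (x + 0#) * (x ^ n - 1#))) (≡.sym q≡1+n)
    (polynomial-linear-* 0# (polynomial-shift (- 1#) (polynomial-power n)))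

  x^q-x-root : ∀ {x} → x ^ q ≈ x → (x + 0#) * (x ^ n - 1#) ≈ 0#
  x^q-x-root {x} eq = begin
    (x + 0#) * (x ^ n - 1#)   ≈⟨ solve 2 (λ x y → (x :+ con 0ℤ) :* (y :- con 1ℤ) := x :* y :- x) refl x (x ^ n) ⟩
    x * x ^ n - x             ≈⟨ +-congʳ (x^q≈x*x^n x) ⟨
    x ^ q - x                 ≈⟨ zero-difference eq ⟩
    0#                        ∎

  -- The q elements of `K` are roots of the monic x^q - x of degree q, which therefore splits into
  -- the factors x - c with c in `K`.
  frobenius-fixed⇒∈ : ∀ {x} → x ^ q ≈ x → x ∈ K
  frobenius-fixed⇒∈ {x} fixed = resp-≈ (sym (difference-zero (proj₂ root))) (element-∈ (proj₁ root))
    where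
    root : ∃ λ i → x - element i ≈ 0#
    root = product-zero (λ i → x - element i) (begin
      product (λ i → x - element i)        ≈⟨ *-identityˡ _ ⟨
      1# * product (λ i → x - element i)   ≈⟨ factorisation polynomial-x^q-x element element-injective
                                                (λ i → x^q-x-root (fermat (element-∈ i))) x ⟨
      (x + 0#) * (x ^ n - 1#)              ≈⟨ x^q-x-root fixed ⟩
      0#                                   ∎)

  norm-∈ : ∀ x → x * x ^ q ∈ K
  norm-∈ x = frobenius-fixed⇒∈ (begin
    (x * x ^ q) ^ q       ≈⟨ ^-distrib-* x (x ^ q) q ⟩
    x ^ q * (x ^ q) ^ q   ≈⟨ *-congˡ (frobenius-involutive x) ⟩
    x ^ q * x             ≈⟨ *-comm _ _ ⟩
    x * x ^ q             ∎)

  vanishing-product : ∀ {k} (t : Fin k → Carrier) i → t i ≈ 0# → product t ≈ 0#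
  vanishing-product {suc k} t i tᵢ≈0 = trans (product-remove {i = i} t) (trans (*-congʳ tᵢ≈0) (zeroˡ _))

  -- In fact an equality, 1 + (q - 1)(q + 1) = q²: the field has just one element more than the
  -- degree of the polynomial in `norm-onto`.
  degree-bound : suc (n ℕ.* suc q) ℕ.≤ q ℕ.^ 2
  degree-bound = ℕₚ.≤-reflexive (≡.trans (≡.cong (λ k → suc (n ℕ.* suc k)) q≡1+n)
    (≡.trans (ℕS.solve 1 (λ n → ℕS.con 1 ℕS.:+ n ℕS.:* (ℕS.con 2 ℕS.:+ n) ℕS.:= (ℕS.con 1 ℕS.:+ n) ℕS.:^ 2) ≡.refl n)
    (≡.cong (ℕ._^ 2) (≡.sym q≡1+n))))
    where module ℕS = ℕSolver.+-*-Solver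

  others : ∀ {x} → x ∈ K → Fin n → Carrier
  others x∈K j = element (≡.subst Fin (≡.sym q≡1+n) (punchIn (≡.subst Fin q≡1+n (index x∈K)) j))

  others-complete : ∀ {x y} (x∈K : x ∈ K) → y ∈ K → ¬ y ≈ x → ∃ λ j → others x∈K j ≈ y
  others-complete {x} {y} x∈K y∈K y≉x = punchOut i≢j , (begin
    others x∈K (punchOut i≢j)                               ≡⟨ ≡.cong (element ∘ ≡.subst Fin (≡.sym q≡1+n)) (Finₚ.punchIn-punchOut i≢j) ⟩
    element (≡.subst Fin (≡.sym q≡1+n) (≡.subst Fin q≡1+n (index y∈K)))  ≡⟨ ≡.cong element (≡.subst-sym-subst q≡1+n) ⟩
    element (index y∈K)                                     ≈⟨ element-index y∈K ⟩
    y                                                       ∎)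
    where
    i≢j : ¬ ≡.subst Fin q≡1+n (index x∈K) ≡ ≡.subst Fin q≡1+n (index y∈K)
    i≢j eq = y≉x (begin
      y                     ≈⟨ element-index y∈K ⟨
      element (index y∈K)   ≡⟨ ≡.cong element (≡.subst-injective q≡1+n eq) ⟨
      element (index x∈K)   ≈⟨ element-index x∈K ⟩
      x                     ∎)

  norm-polynomial : ∀ {x} → x ∈ K → Carrier → Carrier
  norm-polynomial x∈K y = product (λ j → y - others x∈K j)

  norm-polynomial-root : ∀ {x} (x∈K : x ∈ K) y → ¬ y * y ^ q ≈ x → norm-polynomial x∈K (y ^ suc q) ≈ 0#
  norm-polynomial-root x∈K y ≉x = vanishing-product (λ j → y ^ suc q - others x∈K j) (proj₁ other) (zero-difference (sym (proj₂ other)))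
    where
    other : ∃ λ j → others x∈K j ≈ y * y ^ q
    other = others-complete x∈K (norm-∈ y) ≉x

  element↑ : Fin (suc (n ℕ.* suc q)) → Carrier
  element↑ i = 𝔽.element (inject≤ i degree-bound)

  element↑-injective : ∀ {i j} → element↑ i ≈ element↑ j → i ≡ j
  element↑-injective eq = Finₚ.inject≤-injective degree-bound degree-bound _ _ (𝔽.element-injective eq)

  -- If x is not a norm, then the product of yᵠ⁺¹ - c over c ∈ K, c ≠ x, has degree q² - 1 and vanishes at all q² elements y.
  norm-onto : ∀ {x} → x ∈ K → ∃ λ z → z * z ^ q ≈ x
  norm-onto {x} x∈K = search (Finₚ.any? (λ i → 𝔽.element i * 𝔽.element i ^ q ≟ x))
    where
    search : Dec (∃ λ i → 𝔽.element i * 𝔽.element i ^ q ≈ x) → ∃ λ z → z * z ^ q ≈ x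
    search (yes (i , eq)) = 𝔽.element i , eq
    search (no not-norm)  = contradiction
      (too-many-roots {1#} {n ℕ.* suc q} {λ y → norm-polynomial x∈K (y ^ suc q)}
        (polynomial-∘-^ {1#} {n} {norm-polynomial x∈K} q (polynomial-product (others x∈K))) element↑ element↑-injective
        (λ i → norm-polynomial-root x∈K (element↑ i) (λ eq → not-norm (inject≤ i degree-bound , eq))))
      1≉0

  frobenius : Conjugation F K
  frobenius = record
    { conj            = _^ q
    ; conj-cong       = ^-congˡ q
    ; conj-+          = frobenius-+
    ; conj-*          = λ x y → ^-distrib-* x y q
    ; conj-neg        = frobenius-neg
    ; conj-involutive = frobenius-involutive
    ; conj-fixed      = fermat
    ; fixed⇒∈         = frobenius-fixed⇒∈
    ; norm-surjective = norm-onto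
    ; square-root     = square-root
    ; 2≉0             = 2≉0 (suc m , ≡.trans q≡1+n (≡.cong suc n≡2+2m))
    }
    where
    -- Here q + 1 = 2(m + 2), so a norm z^(q+1) is the square of z^(m+2).
    square-root : ∀ {x} → x ∈ K → ∃ λ y → y * y ≈ x
    square-root {x} x∈K with norm-onto x∈K
    ... | z , norm = z ^ suc (suc m) , (begin
      z ^ suc (suc m) * z ^ suc (suc m)   ≈⟨ ^-homo-* z (suc (suc m)) (suc (suc m)) ⟨
      z ^ (suc (suc m) ℕ.+ suc (suc m))   ≡⟨ ≡.cong (z ^_) 2+m+2+m≡1+q ⟩
      z * z ^ q                           ≈⟨ norm ⟩
      x                                   ∎)
      where
      2+m+2+m≡1+q : suc (suc m) ℕ.+ suc (suc m) ≡ suc q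
      2+m+2+m≡1+q = ≡.trans (≡.cong suc (ℕₚ.+-suc (suc m) (suc m))) (≡.cong suc (≡.sym (≡.trans q≡1+n (≡.cong suc n≡2+2m))))

-- The anisotropic form Q and the quadratic map W

module QuadraticExtension (F : CommutativeRing a b) (isField : IsField F)
  (K : Pred (CommutativeRing.Carrier F) p) (isSubfield : IsSubfield F K)
  {N : ℕ} (sizeF : HasSize (CommutativeRing.setoid F) U N) (conjugation : Conjugation F K) where

  open CommutativeRing F hiding (zero)
  open IsField isField
  open IsSubfield isSubfield
  open IntegerCoefficients F
  open FiniteField F isField sizeF
  open Conjugation conjugation
  open import Relation.Binary.Reasoning.Setoid setoid

  infixl 7 _+ᶜ_
  infixl 8 _*ᶜ_
  infix 9 -ᶜ_

  -- These combinators compute the conjugate of a compound expression by a proof of the same shape;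
  -- at a leaf, `refl` leaves `conj x` standing and `conj-involutive` cancels a double conjugate.
  _+ᶜ_ : ∀ {x y x′ y′} → conj x ≈ x′ → conj y ≈ y′ → conj (x + y) ≈ x′ + y′
  eq₁ +ᶜ eq₂ = trans (conj-+ _ _) (+-cong eq₁ eq₂)

  _*ᶜ_ : ∀ {x y x′ y′} → conj x ≈ x′ → conj y ≈ y′ → conj (x * y) ≈ x′ * y′
  eq₁ *ᶜ eq₂ = trans (conj-* _ _) (*-cong eq₁ eq₂)

  -ᶜ_ : ∀ {x x′} → conj x ≈ x′ → conj (- x) ≈ - x′
  -ᶜ eq = trans (conj-neg _) (-‿cong eq)

  1ᶜ : conj 1# ≈ 1#
  1ᶜ = conj-fixed 1-closed

  0ᶜ : conj 0# ≈ 0#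
  0ᶜ = conj-fixed 0-closed

  two four : Carrier
  two  = fromℤ (+ 2)
  four = fromℤ (+ 4)

  2ᶜ : conj two ≈ two
  2ᶜ = 1ᶜ +ᶜ 1ᶜ

  4ᶜ : conj four ≈ four
  4ᶜ = 1ᶜ +ᶜ 1ᶜ +ᶜ 1ᶜ +ᶜ 1ᶜ

  4≉0 : ¬ four ≈ 0#
  4≉0 eq = *-nonzero 2≉0 2≉0 (trans (solve 0 (con (+ 2) :* con (+ 2) := con (+ 4)) refl) eq)

  -- Together with `_⊕_` this closes the many proofs in which the solver rewrites a goal as a
  -- combination of expressions known to vanish.
  scale : ∀ k {x} → x ≈ 0# → k * x ≈ 0#
  scale k x≈0 = trans (*-congˡ x≈0) (zeroʳ k)

  infixr 6 _⊕_
  _⊕_ : ∀ {x y} → x ≈ 0# → y ≈ 0# → x + y ≈ 0#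
  x≈0 ⊕ y≈0 = trans (+-cong x≈0 y≈0) (+-identityʳ 0#)

  conj-zero : ∀ {x} → conj x ≈ 0# → x ≈ 0#
  conj-zero eq = trans (sym (conj-involutive _)) (trans (conj-cong eq) 0ᶜ)

  conj-nonzero : ∀ {x} → ¬ x ≈ 0# → ¬ conj x ≈ 0#
  conj-nonzero x≉0 = x≉0 ∘ conj-zero

  square-zero : ∀ {x} → x * x ≈ 0# → x ≈ 0#
  square-zero eq with *-zero eq
  ... | inj₁ x≈0 = x≈0
  ... | inj₂ x≈0 = x≈0

  x+y≈0⇒x≈-y : ∀ {x y} → x + y ≈ 0# → x ≈ - y
  x+y≈0⇒x≈-y {x} {y} eq = trans (solve 2 (λ x y → x := (x :+ y) :- y) refl x y) (trans (+-congʳ eq) (+-identityˡ _))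

  equal-squares : ∀ {x y} → x * x ≈ y * y → x ≈ y ⊎ x ≈ - y
  equal-squares {x} {y} eq = Sum.map difference-zero x+y≈0⇒x≈-y (*-zero (begin
    (x - y) * (x + y)   ≈⟨ solve 2 (λ x y → (x :- y) :* (x :+ y) := x :* x :- y :* y) refl x y ⟩
    x * x - y * y       ≈⟨ zero-difference eq ⟩
    0#                  ∎))

  distinct₂ : ∀ (f : Fin 2 → Carrier) → ¬ f 0F ≈ f 1F → ∀ {i j} → f i ≈ f j → i ≡ j
  distinct₂ f 0≉1 {0F} {0F} eq = ≡.refl
  distinct₂ f 0≉1 {0F} {1F} eq = contradiction eq 0≉1
  distinct₂ f 0≉1 {1F} {0F} eq = contradiction (sym eq) 0≉1
  distinct₂ f 0≉1 {1F} {1F} eq = ≡.refl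

  distinct₄ : ∀ (f : Fin 4 → Carrier) → ¬ f 0F ≈ f 1F → ¬ f 0F ≈ f 2F → ¬ f 0F ≈ f 3F →
    ¬ f 1F ≈ f 2F → ¬ f 1F ≈ f 3F → ¬ f 2F ≈ f 3F → ∀ {i j} → f i ≈ f j → i ≡ j
  distinct₄ f n01 n02 n03 n12 n13 n23 {0F} {0F} eq = ≡.refl
  distinct₄ f n01 n02 n03 n12 n13 n23 {0F} {1F} eq = contradiction eq n01
  distinct₄ f n01 n02 n03 n12 n13 n23 {0F} {2F} eq = contradiction eq n02
  distinct₄ f n01 n02 n03 n12 n13 n23 {0F} {3F} eq = contradiction eq n03
  distinct₄ f n01 n02 n03 n12 n13 n23 {1F} {0F} eq = contradiction (sym eq) n01
  distinct₄ f n01 n02 n03 n12 n13 n23 {1F} {1F} eq = ≡.refl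
  distinct₄ f n01 n02 n03 n12 n13 n23 {1F} {2F} eq = contradiction eq n12
  distinct₄ f n01 n02 n03 n12 n13 n23 {1F} {3F} eq = contradiction eq n13
  distinct₄ f n01 n02 n03 n12 n13 n23 {2F} {0F} eq = contradiction (sym eq) n02
  distinct₄ f n01 n02 n03 n12 n13 n23 {2F} {1F} eq = contradiction (sym eq) n12
  distinct₄ f n01 n02 n03 n12 n13 n23 {2F} {2F} eq = ≡.refl
  distinct₄ f n01 n02 n03 n12 n13 n23 {2F} {3F} eq = contradiction eq n23
  distinct₄ f n01 n02 n03 n12 n13 n23 {3F} {0F} eq = contradiction (sym eq) n03
  distinct₄ f n01 n02 n03 n12 n13 n23 {3F} {1F} eq = contradiction (sym eq) n13
  distinct₄ f n01 n02 n03 n12 n13 n23 {3F} {2F} eq = contradiction (sym eq) n23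
  distinct₄ f n01 n02 n03 n12 n13 n23 {3F} {3F} eq = ≡.refl

  x≈-x⇒x≈0 : ∀ {x} → x ≈ - x → x ≈ 0#
  x≈-x⇒x≈0 {x} eq = *-zero⇒ʳ 2≉0 (trans (solve 1 (λ x → con (+ 2) :* x := x :- :- x) refl x) (zero-difference eq))

  subset-≤ : ∀ {k m} (h : Fin k → Carrier) (f : Fin m → Carrier) → (∀ {i j} → f i ≈ f j → i ≡ j) →
    (∀ i → ∃ λ t → h t ≈ f i) → m ℕ.≤ k
  subset-≤ h f f-injective cover = Finₚ.injective⇒≤ {f = λ i → proj₁ (cover i)} λ {i} {j} eq →
    f-injective (trans (sym (proj₂ (cover i))) (trans (reflexive (≡.cong h eq)) (proj₂ (cover j))))

  -- (α + g)² = α (α + ᾱ + 2g), and α + ᾱ + 2g ∈ K is a square in F.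
  square-norm⇒square : ∀ {α g} → g ∈ K → g * g ≈ α * conj α → ∃ λ y → y * y ≈ α
  square-norm⇒square {α} {g} g∈K gg≈αᾱ = split (f ≟ 0#) (square-root f∈K)
    where
    f : Carrier
    f = α + conj α + (g + g)
    f∈K : f ∈ K
    f∈K = fixed⇒∈ (trans ((refl +ᶜ conj-involutive α) +ᶜ (conj-fixed g∈K +ᶜ conj-fixed g∈K)) (+-congʳ (+-comm _ _)))
    [α+g]² : (α + g) * (α + g) ≈ α * f
    [α+g]² = difference-zero (trans
      (solve 3 (λ α ᾱ g → (α :+ g) :* (α :+ g) :- α :* (α :+ ᾱ :+ (g :+ g)) := g :* g :- α :* ᾱ) refl α (conj α) g)
      (zero-difference gg≈αᾱ))
    split : Dec (f ≈ 0#) → (∃ λ h → h * h ≈ f) → ∃ λ y → y * y ≈ α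
    -- Here (α + g)² = 0, so α = -g already lies in `K`, all of whose elements have square roots.
    split (yes f≈0) _ = square-root (resp-≈ (sym (x+y≈0⇒x≈-y (square-zero (trans [α+g]² (scale α f≈0))))) (-‿closed g∈K))
    split (no f≉0) (h , hh≈f) = (α + g) * i , (begin
      (α + g) * i * ((α + g) * i)   ≈⟨ solve 3 (λ α g i → (α :+ g) :* i :* ((α :+ g) :* i) := (α :+ g) :* (α :+ g) :* (i :* i)) refl α g i ⟩
      (α + g) * (α + g) * (i * i)   ≈⟨ *-congʳ (trans [α+g]² (*-congˡ (sym hh≈f))) ⟩
      α * (h * h) * (i * i)         ≈⟨ solve 3 (λ α h i → α :* (h :* h) :* (i :* i) := α :* ((i :* h) :* (i :* h))) refl α h i ⟩
      α * (i * h * (i * h))         ≈⟨ *-congˡ (*-cong (inv-* h≉0) (inv-* h≉0)) ⟩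
      α * (1# * 1#)                 ≈⟨ trans (*-congˡ (*-identityʳ 1#)) (*-identityʳ α) ⟩
      α                             ∎)
      where
      h≉0 : ¬ h ≈ 0#
      h≉0 h≈0 = f≉0 (trans (sym hh≈f) (scale h h≈0))
      i : Carrier
      i = inv h≉0

  -- The form `Q`, its polarisation and the map `W`

  module Form (α δ : Carrier) (α≉0 : ¬ α ≈ 0#) (conj-δ : conj δ ≈ - δ)
    (nonsquare : ¬ IsSquareIn F K (δ * δ + fromℤ (+ 4) * (α * conj α))) where

    d : Carrier
    d = δ * δ + four * (α * conj α)

    -- `slope` is the gradient of `Q`: the polar form of `Q` is `I (slope u * v)`. In the plane,
    -- `slope u + A` will be the slope of a line through P.
    slope W Q : Carrier → Carrier
    slope u = two * α * u + δ * conj u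
    W u = slope u * u
    Q u = α * (u * u) - conj α * (conj u * conj u) + δ * (u * conj u)

    slopeᶜ : ∀ u → conj (slope u) ≈ two * conj α * conj u + - δ * u
    slopeᶜ u = 2ᶜ *ᶜ refl *ᶜ refl +ᶜ conj-δ *ᶜ conj-involutive u

    -- Hence `W` determines `Q`, and values of `W` at points with equal `Q` differ by elements of
    -- `K`.
    W-conj : ∀ u → W u - conj (W u) ≈ two * Q u
    W-conj u = begin
      W u - conj (W u)
        ≈⟨ +-congˡ (-‿cong (slopeᶜ u *ᶜ refl)) ⟩
      W u - (two * conj α * conj u + - δ * u) * conj u
        ≈⟨ solve 5 (λ α α′ δ u u′ → (con (+ 2) :* α :* u :+ δ :* u′) :* u :- (con (+ 2) :* α′ :* u′ :+ :- δ :* u) :* u′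
             := con (+ 2) :* (α :* (u :* u) :- α′ :* (u′ :* u′) :+ δ :* (u :* u′))) refl α (conj α) δ u (conj u) ⟩
      two * Q u
        ∎

    -- A nonzero zero of `Q` would make `slope u` divided by `conj u` a square root of `d` in `K`.
    -- It is fixed by conjugation because `W u` is, by `W-conj`, and its square is `d` because the
    -- square of `slope u` is dū² + 4αQ(u).
    Q-anisotropic : ∀ {u} → Q u ≈ 0# → u ≈ 0#
    Q-anisotropic {u} Qu≈0 = decide (u ≟ 0#)
      where
      decide : Dec (u ≈ 0#) → u ≈ 0#
      decide (yes u≈0) = u≈0
      decide (no u≉0)  = contradiction (e , e∈K , ee≈d) nonsquare
        where
        ū≉0 : ¬ conj u ≈ 0#
        ū≉0 = conj-nonzero u≉0
        i e : Carrier
        i = inv ū≉0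
        e = slope u * i
        i*ū : i * conj u ≈ 1#
        i*ū = inv-* ū≉0
        ī*u : conj i * u ≈ 1#
        ī*u = trans (sym (refl *ᶜ conj-involutive u)) (trans (conj-cong i*ū) 1ᶜ)
        e∈K : e ∈ K
        e∈K = fixed⇒∈ (sym (difference-zero (*-zero⇒ʳ (*-nonzero u≉0 ū≉0) (begin
          u * conj u * (e - conj e)
            ≈⟨ *-congˡ (+-congˡ (-‿cong (conj-* _ _))) ⟩
          u * conj u * (slope u * i - conj (slope u) * conj i)
            ≈⟨ solve 6 (λ u u′ s s′ i i′ → u :* u′ :* (s :* i :- s′ :* i′) := (s :* u) :* (i :* u′) :- (s′ :* u′) :* (i′ :* u)) refl
                 u (conj u) (slope u) (conj (slope u)) i (conj i) ⟩
          W u * (i * conj u) - conj (slope u) * conj u * (conj i * u)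
            ≈⟨ +-cong (trans (*-congˡ i*ū) (*-identityʳ _)) (-‿cong (trans (*-congˡ ī*u) (*-identityʳ _))) ⟩
          W u - conj (slope u) * conj u
            ≈⟨ +-congˡ (-‿cong (conj-* _ _)) ⟨
          W u - conj (W u)
            ≈⟨ W-conj u ⟩
          two * Q u
            ≈⟨ scale two Qu≈0 ⟩
          0#
            ∎))))
        ee≈d : e * e ≈ d
        ee≈d = *-cancelˡ (*-nonzero ū≉0 ū≉0) (begin
          conj u * conj u * (e * e)
            ≈⟨ solve 3 (λ u′ s i → u′ :* u′ :* (s :* i :* (s :* i)) := s :* s :* ((i :* u′) :* (i :* u′))) refl (conj u) (slope u) i ⟩
          slope u * slope u * (i * conj u * (i * conj u))
            ≈⟨ trans (*-congˡ (trans (*-cong i*ū i*ū) (*-identityʳ 1#))) (*-identityʳ _) ⟩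
          slope u * slope u
            ≈⟨ solve 5 (λ α α′ δ u u′ → (con (+ 2) :* α :* u :+ δ :* u′) :* (con (+ 2) :* α :* u :+ δ :* u′)
               := u′ :* u′ :* (δ :* δ :+ con (+ 4) :* (α :* α′))
                  :+ con (+ 4) :* α :* (α :* (u :* u) :- α′ :* (u′ :* u′) :+ δ :* (u :* u′))) refl α (conj α) δ u (conj u) ⟩
          conj u * conj u * d + four * α * Q u
            ≈⟨ trans (+-congˡ (scale (four * α) Qu≈0)) (+-identityʳ _) ⟩
          conj u * conj u * d
            ∎)

    abstract
      d∈K : d ∈ K
      d∈K = fixed⇒∈ (trans (conj-δ *ᶜ conj-δ +ᶜ 4ᶜ *ᶜ (refl *ᶜ conj-involutive α))
        (solve 3 (λ α α′ δ → :- δ :* :- δ :+ con (+ 4) :* (α′ :* α) := δ :* δ :+ con (+ 4) :* (α :* α′)) refl α (conj α) δ))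

    e : Carrier
    e = proj₁ (square-root d∈K)

    ee≈d : e * e ≈ d
    ee≈d = proj₂ (square-root d∈K)

    e∉K : e ∉ K
    e∉K e∈K = nonsquare (e , e∈K , ee≈d)

    conj-e : conj e ≈ - e
    conj-e = Sum.[ (λ ē≈e → contradiction (fixed⇒∈ ē≈e) e∉K) , id ]′ (equal-squares (begin
        conj e * conj e   ≈⟨ conj-* e e ⟨
        conj (e * e)      ≈⟨ conj-cong ee≈d ⟩
        conj d            ≈⟨ conj-fixed d∈K ⟩
        d                 ≈⟨ ee≈d ⟨
        e * e             ∎))

    e≉0 : ¬ e ≈ 0#
    e≉0 e≈0 = e∉K (resp-≈ (sym e≈0) 0-closed)

    d≉0 : ¬ d ≈ 0#
    d≉0 d≈0 = e≉0 (square-zero (trans ee≈d d≈0))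

    αᾱ≉0 : ¬ α * conj α ≈ 0#
    αᾱ≉0 = *-nonzero α≉0 (conj-nonzero α≉0)

    slope-cong : ∀ {u v} → u ≈ v → slope u ≈ slope v
    slope-cong u≈v = +-cong (*-congˡ u≈v) (*-congˡ (conj-cong u≈v))

    W-cong : ∀ {u v} → u ≈ v → W u ≈ W v
    W-cong u≈v = *-cong (slope-cong u≈v) u≈v

    Q-cong : ∀ {u v} → u ≈ v → Q u ≈ Q v
    Q-cong u≈v = +-cong (+-cong (*-congˡ (*-cong u≈v u≈v)) (-‿cong (*-congˡ (*-cong (conj-cong u≈v) (conj-cong u≈v)))))
      (*-congˡ (*-cong u≈v (conj-cong u≈v)))

    -- Cramer's rule for the equation and its conjugate, a linear system in `u` and `conj u` with
    -- determinant `d`. It makes every non-vertical direction through P of the form `slope u + A`.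
    slope-surjective : ∀ m → ∃ λ u → slope u ≈ m
    slope-surjective m = (two * conj α * m - δ * conj m) * i , (begin
      slope ((two * conj α * m - δ * conj m) * i)
        ≈⟨ +-congˡ (*-congˡ ((2ᶜ *ᶜ conj-involutive α *ᶜ refl +ᶜ -ᶜ (conj-δ *ᶜ conj-involutive m)) *ᶜ conj-fixed i∈K)) ⟩
      two * α * ((two * conj α * m - δ * conj m) * i) + δ * ((two * α * conj m - - δ * m) * i)
        ≈⟨ solve 6 (λ α α′ δ m m′ i → con (+ 2) :* α :* ((con (+ 2) :* α′ :* m :- δ :* m′) :* i) :+ δ :* ((con (+ 2) :* α :* m′ :- :- δ :* m) :* i)
             := m :* (i :* (δ :* δ :+ con (+ 4) :* (α :* α′)))) refl α (conj α) δ m (conj m) i ⟩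
      m * (i * d)
        ≈⟨ trans (*-congˡ (inv-* d≉0)) (*-identityʳ m) ⟩
      m ∎)
      where
      i : Carrier
      i = inv d≉0
      i∈K : i ∈ K
      i∈K = ⁻¹-closed d∈K (trans (*-comm _ _) (inv-* d≉0))

    I : Carrier → Carrier
    I x = x - conj x

    I-slope : ∀ u v → I (slope u * v) ≈ slope u * v - (two * conj α * conj u + - δ * u) * conj v
    I-slope u v = +-congˡ (-‿cong (slopeᶜ u *ᶜ refl))

    Q-+ : ∀ u v → Q (u + v) ≈ Q u + I (slope u * v) + Q v
    Q-+ u v = begin
      Q (u + v)
        ≈⟨ +-cong (+-congˡ (-‿cong (*-congˡ (*-cong (conj-+ u v) (conj-+ u v))))) (*-congˡ (*-congˡ (conj-+ u v))) ⟩
      α * ((u + v) * (u + v)) - conj α * ((conj u + conj v) * (conj u + conj v)) + δ * ((u + v) * (conj u + conj v))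
        ≈⟨ solve 7 (λ α α′ δ u u′ v v′ →
             α :* ((u :+ v) :* (u :+ v)) :- α′ :* ((u′ :+ v′) :* (u′ :+ v′)) :+ δ :* ((u :+ v) :* (u′ :+ v′))
             := (α :* (u :* u) :- α′ :* (u′ :* u′) :+ δ :* (u :* u′))
                :+ ((con (+ 2) :* α :* u :+ δ :* u′) :* v :- (con (+ 2) :* α′ :* u′ :+ :- δ :* u) :* v′)
                :+ (α :* (v :* v) :- α′ :* (v′ :* v′) :+ δ :* (v :* v′))) refl α (conj α) δ u (conj u) v (conj v) ⟩
      Q u + (slope u * v - (two * conj α * conj u + - δ * u) * conj v) + Q v
        ≈⟨ +-congʳ (+-congˡ (I-slope u v)) ⟨
      Q u + I (slope u * v) + Q v
        ∎

    Q-- : ∀ u v → Q (v - u) ≈ Q u - I (slope u * v) + Q v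
    Q-- u v = begin
      Q (v - u)
        ≈⟨ +-cong (+-congˡ (-‿cong (*-congˡ (*-cong (refl +ᶜ conj-neg u) (refl +ᶜ conj-neg u))))) (*-congˡ (*-congˡ (refl +ᶜ conj-neg u))) ⟩
      α * ((v - u) * (v - u)) - conj α * ((conj v - conj u) * (conj v - conj u)) + δ * ((v - u) * (conj v - conj u))
        ≈⟨ solve 7 (λ α α′ δ u u′ v v′ →
             α :* ((v :- u) :* (v :- u)) :- α′ :* ((v′ :- u′) :* (v′ :- u′)) :+ δ :* ((v :- u) :* (v′ :- u′))
             := (α :* (u :* u) :- α′ :* (u′ :* u′) :+ δ :* (u :* u′))
                :- ((con (+ 2) :* α :* u :+ δ :* u′) :* v :- (con (+ 2) :* α′ :* u′ :+ :- δ :* u) :* v′)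
                :+ (α :* (v :* v) :- α′ :* (v′ :* v′) :+ δ :* (v :* v′))) refl α (conj α) δ u (conj u) v (conj v) ⟩
      Q u - (slope u * v - (two * conj α * conj u + - δ * u) * conj v) + Q v
        ≈⟨ +-congʳ (+-congˡ (-‿cong (I-slope u v))) ⟨
      Q u - I (slope u * v) + Q v
        ∎

    Q-neg : ∀ u → Q (- u) ≈ Q u
    Q-neg u = trans
      (+-cong (+-congˡ (-‿cong (*-congˡ (*-cong (conj-neg u) (conj-neg u))))) (*-congˡ (*-congˡ (conj-neg u))))
      (solve 5 (λ α α′ δ u u′ → α :* (:- u :* :- u) :- α′ :* (:- u′ :* :- u′) :+ δ :* (:- u :* :- u′)
        := α :* (u :* u) :- α′ :* (u′ :* u′) :+ δ :* (u :* u′)) refl α (conj α) δ u (conj u))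

    W-neg : ∀ u → W (- u) ≈ W u
    W-neg u = trans (*-congʳ (+-congˡ (*-congˡ (conj-neg u))))
      (solve 4 (λ α δ u u′ → (con (+ 2) :* α :* :- u :+ δ :* :- u′) :* :- u := (con (+ 2) :* α :* u :+ δ :* u′) :* u) refl α δ u (conj u))

    Q-scale : ∀ {r} → conj r ≈ r → ∀ u → Q (u * r) ≈ r * r * Q u
    Q-scale {r} r̄≈r u = begin
      Q (u * r)
        ≈⟨ +-cong (+-congˡ (-‿cong (*-congˡ (*-cong (refl *ᶜ r̄≈r) (refl *ᶜ r̄≈r))))) (*-congˡ (*-congˡ (refl *ᶜ r̄≈r))) ⟩
      α * (u * r * (u * r)) - conj α * (conj u * r * (conj u * r)) + δ * (u * r * (conj u * r))
        ≈⟨ solve 6 (λ α α′ δ u u′ r → α :* (u :* r :* (u :* r)) :- α′ :* (u′ :* r :* (u′ :* r)) :+ δ :* (u :* r :* (u′ :* r))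
             := r :* r :* (α :* (u :* u) :- α′ :* (u′ :* u′) :+ δ :* (u :* u′))) refl α (conj α) δ u (conj u) r ⟩
      r * r * Q u
        ∎

    -- The increment of `Q` along τr has the factor r; what remains after cancelling it is linear in
    -- r.
    chord : ∀ {r} → conj r ≈ r → ¬ r ≈ 0# → ∀ u τ → Q (u + τ * r) ≈ Q u → I (slope u * τ) + r * Q τ ≈ 0#
    chord {r} r̄≈r r≉0 u τ eq = *-zero⇒ʳ r≉0 (begin
      r * (I (slope u * τ) + r * Q τ)
        ≈⟨ solve 5 (λ r x x′ q q₁ → r :* (x :- x′ :+ r :* q) := q₁ :+ (r :* x :- r :* x′) :+ r :* r :* q :- q₁) refl
             r (slope u * τ) (conj (slope u * τ)) (Q τ) (Q u) ⟩
      Q u + (r * (slope u * τ) - r * conj (slope u * τ)) + r * r * Q τ - Q u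
        ≈⟨ +-congʳ (+-cong (+-congˡ (+-cong (r*sτ≈) (-‿cong (trans (*-comm _ _) (sym (trans (conj-cong (sym (*-assoc _ _ _))) (refl *ᶜ r̄≈r))))))) (sym (Q-scale r̄≈r τ))) ⟩
      Q u + I (slope u * (τ * r)) + Q (τ * r) - Q u
        ≈⟨ +-congʳ (Q-+ u (τ * r)) ⟨
      Q (u + τ * r) - Q u
        ≈⟨ zero-difference eq ⟩
      0#
        ∎)
      where
      r*sτ≈ : r * (slope u * τ) ≈ slope u * (τ * r)
      r*sτ≈ = trans (*-comm _ _) (*-assoc _ _ _)

    -- Two different solutions of the linear equation in `chord` force its leading coefficient `Q τ`
    -- to vanish.
    two-on-chord : ∀ {r r′} → conj r ≈ r → conj r′ ≈ r′ → ¬ r ≈ 0# → ¬ r′ ≈ 0# → ¬ r ≈ r′ → ∀ u τ →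
      Q (u + τ * r) ≈ Q u → Q (u + τ * r′) ≈ Q u → τ ≈ 0#
    two-on-chord {r} {r′} r̄≈r r̄′≈r′ r≉0 r′≉0 r≉r′ u τ eq eq′ = Q-anisotropic (*-zero⇒ʳ (r≉r′ ∘ difference-zero) (begin
      (r - r′) * Q τ
        ≈⟨ solve 4 (λ r r′ q x → (r :- r′) :* q := (x :+ r :* q) :- (x :+ r′ :* q)) refl r r′ (Q τ) (I (slope u * τ)) ⟩
      (I (slope u * τ) + r * Q τ) - (I (slope u * τ) + r′ * Q τ)
        ≈⟨ zero-difference (trans (chord r̄≈r r≉0 u τ eq) (sym (chord r̄′≈r′ r′≉0 u τ eq′))) ⟩
      0#
        ∎))

    -- Level sets of `W`

    W≈⇒Q≈ : ∀ {u v} → W u ≈ W v → Q u ≈ Q v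
    W≈⇒Q≈ {u} {v} Wu≈Wv = *-cancelˡ 2≉0 (trans (sym (W-conj u)) (trans (+-cong Wu≈Wv (-‿cong (conj-cong Wu≈Wv))) (W-conj v)))

    W-nonzero : ∀ {u} → ¬ Q u ≈ 0# → ¬ W u ≈ 0#
    W-nonzero {u} Qu≉0 Wu≈0 = Qu≉0 (*-zero⇒ʳ 2≉0 (trans (sym (W-conj u))
      (trans (+-cong Wu≈0 (trans (-‿cong (trans (conj-cong Wu≈0) 0ᶜ)) -0≈0)) (+-identityʳ 0#))))

    -- With n = uū, W = 2αu² + δn and its conjugate is 2ᾱū² - δn, so (W - δn)(conj W + δn) = 4αᾱn².
    -- Expanding with W - conj W = 2Q gives the quadratic for n.
    norm-quadratic : ∀ u → d * (u * conj u * (u * conj u)) - two * δ * Q u * (u * conj u) - W u * conj (W u) ≈ 0#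
    norm-quadratic u = begin
      d * (u * conj u * (u * conj u)) - two * δ * Q u * (u * conj u) - W u * conj (W u)
        ≈⟨ +-congˡ (-‿cong (*-congˡ (slopeᶜ u *ᶜ refl))) ⟩
      d * (u * conj u * (u * conj u)) - two * δ * Q u * (u * conj u) - W u * ((two * conj α * conj u + - δ * u) * conj u)
        ≈⟨ solve 5 (λ α α′ δ u u′ → (δ :* δ :+ con (+ 4) :* (α :* α′)) :* (u :* u′ :* (u :* u′))
             :- con (+ 2) :* δ :* (α :* (u :* u) :- α′ :* (u′ :* u′) :+ δ :* (u :* u′)) :* (u :* u′)
             :- (con (+ 2) :* α :* u :+ δ :* u′) :* u :* ((con (+ 2) :* α′ :* u′ :+ :- δ :* u) :* u′)
             := con 0ℤ) refl α (conj α) δ u (conj u) ⟩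
      0#
        ∎

    -- Different norms on a level set are the two roots of one quadratic, that of `norm-quadratic`;
    -- this and `norms-product` are Vieta's relations for it.
    norms-sum : ∀ {u v} → W u ≈ W v → ¬ u * conj u ≈ v * conj v → d * (u * conj u + v * conj v) - two * δ * Q u ≈ 0#
    norms-sum {u} {v} Wu≈Wv nu≉nv = *-zero⇒ʳ (nu≉nv ∘ difference-zero) (begin
      (u * conj u - v * conj v) * (d * (u * conj u + v * conj v) - two * δ * Q u)
        ≈⟨ solve 5 (λ d n n′ x t → (n :- n′) :* (d :* (n :+ n′) :- x)
             := (d :* (n :* n) :- x :* n :- t) :- (d :* (n′ :* n′) :- x :* n′ :- t)) refl
             d (u * conj u) (v * conj v) (two * δ * Q u) (W u * conj (W u)) ⟩
      (d * (u * conj u * (u * conj u)) - two * δ * Q u * (u * conj u) - W u * conj (W u))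
        - (d * (v * conj v * (v * conj v)) - two * δ * Q u * (v * conj v) - W u * conj (W u))
        ≈⟨ zero-difference (trans (norm-quadratic u) (sym (trans
             (+-cong (+-congˡ (-‿cong (*-congʳ (*-congˡ (W≈⇒Q≈ Wu≈Wv))))) (-‿cong (*-cong Wu≈Wv (conj-cong Wu≈Wv))))
             (norm-quadratic v)))) ⟩
      0#
        ∎)

    norms-product : ∀ {u v} → W u ≈ W v → ¬ u * conj u ≈ v * conj v → d * (u * conj u * (v * conj v)) + W u * conj (W u) ≈ 0#
    norms-product {u} {v} Wu≈Wv nu≉nv = begin
      d * (u * conj u * (v * conj v)) + W u * conj (W u)
        ≈⟨ solve 5 (λ d n n′ x t → d :* (n :* n′) :+ t := n :* (d :* (n :+ n′) :- x) :- (d :* (n :* n) :- x :* n :- t)) refl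
             d (u * conj u) (v * conj v) (two * δ * Q u) (W u * conj (W u)) ⟩
      u * conj u * (d * (u * conj u + v * conj v) - two * δ * Q u)
        - (d * (u * conj u * (u * conj u)) - two * δ * Q u * (u * conj u) - W u * conj (W u))
        ≈⟨ zero-difference (trans (scale _ (norms-sum Wu≈Wv nu≉nv)) (sym (norm-quadratic u))) ⟩
      0#
        ∎

    -- By `leading`, 4α²u²v² is (W - δn)(W - δn′), a symmetric function of the two roots n and n′,
    -- so Vieta's relations eliminate them; `W-conj` then eliminates `Q u`.
    squares-product : ∀ {u v} → W u ≈ W v → ¬ u * conj u ≈ v * conj v →
      α * (u * v * (u * v)) * d ≈ conj α * (W u * W u)
    squares-product {u} {v} Wu≈Wv nu≉nv = difference-zero (*-zero⇒ʳ (*-nonzero 4≉0 α≉0) (begin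
      four * α * (α * (u * v * (u * v)) * d - conj α * (t * t))
        ≈⟨ solve 6 (λ α α′ δ t u v → con (+ 4) :* α :* (α :* (u :* v :* (u :* v)) :* (δ :* δ :+ con (+ 4) :* (α :* α′)) :- α′ :* (t :* t))
             := (con (+ 2) :* α :* u :* u) :* (con (+ 2) :* α :* v :* v) :* (δ :* δ :+ con (+ 4) :* (α :* α′)) :- con (+ 4) :* (α :* α′) :* (t :* t)) refl
             α (conj α) δ t u v ⟩
      two * α * u * u * (two * α * v * v) * d - four * (α * conj α) * (t * t)
        ≈⟨ +-congʳ (*-congʳ (*-cong (leading u) (trans (leading v) (+-congʳ (sym Wu≈Wv))))) ⟩
      (t - δ * n) * (t - δ * n′) * d - four * (α * conj α) * (t * t)
        ≈⟨ solve 7 (λ δ a t t′ n n′ Q → (t :- δ :* n) :* (t :- δ :* n′) :* (δ :* δ :+ con (+ 4) :* a) :- con (+ 4) :* a :* (t :* t)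
             := :- (t :* δ) :* ((δ :* δ :+ con (+ 4) :* a) :* (n :+ n′) :- con (+ 2) :* δ :* Q)
                :+ (δ :* δ :* ((δ :* δ :+ con (+ 4) :* a) :* (n :* n′) :+ t :* t′)
                :+ δ :* δ :* t :* ((t :- t′) :- con (+ 2) :* Q))) refl
             δ (α * conj α) t (conj t) n n′ (Q u) ⟩
      - (t * δ) * (d * (n + n′) - two * δ * Q u) + (δ * δ * (d * (n * n′) + t * conj t) + δ * δ * t * ((t - conj t) - two * Q u))
        ≈⟨ scale _ (norms-sum Wu≈Wv nu≉nv) ⊕ (scale _ (norms-product Wu≈Wv nu≉nv) ⊕ scale _ (zero-difference (W-conj u))) ⟩
      0#
        ∎))
      where
      t n n′ : Carrier
      t  = W u
      n  = u * conj u
      n′ = v * conj v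
      leading : ∀ u → two * α * u * u ≈ W u - δ * (u * conj u)
      leading u = solve 4 (λ α δ u u′ → con (+ 2) :* α :* u :* u := (con (+ 2) :* α :* u :+ δ :* u′) :* u :- δ :* (u :* u′)) refl α δ u (conj u)

    equal-norms : ∀ {u v} → W u ≈ W v → u * conj u ≈ v * conj v → v ≈ u ⊎ v ≈ - u
    equal-norms {u} {v} Wu≈Wv nu≈nv = equal-squares (sym (*-cancelˡ (*-nonzero 2≉0 α≉0) (difference-zero (begin
      two * α * (u * u) - two * α * (v * v)
        ≈⟨ solve 6 (λ α δ u u′ v v′ → con (+ 2) :* α :* (u :* u) :- con (+ 2) :* α :* (v :* v)
             := ((con (+ 2) :* α :* u :+ δ :* u′) :* u :- (con (+ 2) :* α :* v :+ δ :* v′) :* v) :+ :- δ :* (u :* u′ :- v :* v′)) refl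
             α δ u (conj u) v (conj v) ⟩
      (W u - W v) + - δ * (u * conj u - v * conj v)
        ≈⟨ zero-difference Wu≈Wv ⊕ scale _ (zero-difference nu≈nv) ⟩
      0#
        ∎))))

    -- `squares-product` gives g² = αᾱ. `norms-product`, whose minus sign is absorbed by conj e =
    -- -e, gives the same value for g times `conj g`, so g is fixed by conjugation and
    -- `square-norm⇒square` applies.
    different-norms : ∀ {u v} → ¬ Q u ≈ 0# → W u ≈ W v → ¬ u * conj u ≈ v * conj v → ∃ λ y → y * y ≈ α
    different-norms {u} {v} Qu≉0 Wu≈Wv nu≉nv = square-norm⇒square (fixed⇒∈ ḡ≈g) gg≈αᾱ
      where
      t i g : Carrier
      t = W u
      i = inv (W-nonzero Qu≉0)
      g = α * (u * v) * e * i
      i*t : i * t ≈ 1#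
      i*t = inv-* (W-nonzero Qu≉0)
      ī*t̄ : conj i * conj t ≈ 1#
      ī*t̄ = trans (sym (conj-* i t)) (trans (conj-cong i*t) 1ᶜ)
      gg≈αᾱ : g * g ≈ α * conj α
      gg≈αᾱ = begin
        g * g
          ≈⟨ solve 5 (λ α u v e i → α :* (u :* v) :* e :* i :* (α :* (u :* v) :* e :* i) := α :* (i :* i) :* (α :* (u :* v :* (u :* v)) :* (e :* e))) refl α u v e i ⟩
        α * (i * i) * (α * (u * v * (u * v)) * (e * e))
          ≈⟨ *-congˡ (trans (*-congˡ ee≈d) (squares-product Wu≈Wv nu≉nv)) ⟩
        α * (i * i) * (conj α * (t * t))
          ≈⟨ solve 4 (λ α α′ i t → α :* (i :* i) :* (α′ :* (t :* t)) := α :* α′ :* (i :* t :* (i :* t))) refl α (conj α) i t ⟩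
        α * conj α * (i * t * (i * t))
          ≈⟨ trans (*-congˡ (trans (*-cong i*t i*t) (*-identityʳ 1#))) (*-identityʳ _) ⟩
        α * conj α
          ∎
      gḡ≈αᾱ : g * conj g ≈ α * conj α
      gḡ≈αᾱ = begin
        g * conj g
          ≈⟨ *-congˡ (refl *ᶜ conj-* u v *ᶜ conj-e *ᶜ refl) ⟩
        g * (conj α * (conj u * conj v) * - e * conj i)
          ≈⟨ solve 9 (λ α α′ u u′ v v′ e i i′ → α :* (u :* v) :* e :* i :* (α′ :* (u′ :* v′) :* :- e :* i′)
               := :- (α :* α′ :* (i :* i′) :* (e :* e :* (u :* u′ :* (v :* v′))))) refl α (conj α) u (conj u) v (conj v) e i (conj i) ⟩
        - (α * conj α * (i * conj i) * (e * e * (u * conj u * (v * conj v))))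
          ≈⟨ -‿cong (*-congˡ (trans (*-congʳ ee≈d) (x+y≈0⇒x≈-y (norms-product Wu≈Wv nu≉nv)))) ⟩
        - (α * conj α * (i * conj i) * - (t * conj t))
          ≈⟨ solve 5 (λ a i i′ t t′ → :- (a :* (i :* i′) :* :- (t :* t′)) := a :* (i :* t :* (i′ :* t′))) refl (α * conj α) i (conj i) t (conj t) ⟩
        α * conj α * (i * t * (conj i * conj t))
          ≈⟨ trans (*-congˡ (trans (*-cong i*t ī*t̄) (*-identityʳ 1#))) (*-identityʳ _) ⟩
        α * conj α
          ∎
      g≉0 : ¬ g ≈ 0#
      g≉0 g≈0 = αᾱ≉0 (trans (sym gg≈αᾱ) (scale g g≈0))
      ḡ≈g : conj g ≈ g
      ḡ≈g = *-cancelˡ g≉0 (trans gḡ≈αᾱ (sym gg≈αᾱ))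

    nonsquare-equal-W : (∀ y → ¬ y * y ≈ α) → ∀ {u v} → ¬ Q u ≈ 0# → W u ≈ W v → v ≈ u ⊎ v ≈ - u
    nonsquare-equal-W α-nonsquare {u} {v} Qu≉0 Wu≈Wv = decide (u * conj u ≟ v * conj v)
      where
      decide : Dec (u * conj u ≈ v * conj v) → v ≈ u ⊎ v ≈ - u
      decide (yes nu≈nv) = equal-norms Wu≈Wv nu≈nv
      decide (no nu≉nv)  = contradiction (proj₂ (different-norms Qu≉0 Wu≈Wv nu≉nv)) (α-nonsquare _)

    -- Norm circles and the orbits of sign change and conjugation

    Norm S : Carrier → Carrier
    Norm z = z * conj z
    S z    = z * z + conj z * conj z

    Norm-cong : ∀ {z z′} → z ≈ z′ → Norm z ≈ Norm z′
    Norm-cong z≈z′ = *-cong z≈z′ (conj-cong z≈z′)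

    S-cong : ∀ {z z′} → z ≈ z′ → S z ≈ S z′
    S-cong z≈z′ = +-cong (*-cong z≈z′ z≈z′) (*-cong (conj-cong z≈z′) (conj-cong z≈z′))

    Norm-neg : ∀ z → Norm (- z) ≈ Norm z
    Norm-neg z = trans (*-congˡ (conj-neg z)) (solve 2 (λ z z′ → :- z :* :- z′ := z :* z′) refl z (conj z))

    Norm-conj : ∀ z → Norm (conj z) ≈ Norm z
    Norm-conj z = trans (*-congˡ (conj-involutive z)) (*-comm _ _)

    S-neg : ∀ z → S (- z) ≈ S z
    S-neg z = trans (+-congˡ (*-cong (conj-neg z) (conj-neg z))) (solve 2 (λ z z′ → :- z :* :- z :+ :- z′ :* :- z′ := z :* z :+ z′ :* z′) refl z (conj z))

    S-conj : ∀ z → S (conj z) ≈ S z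
    S-conj z = trans (+-congˡ (*-cong (conj-involutive z) (conj-involutive z))) (+-comm _ _)

    orbit : Carrier → Fin 4 → Carrier
    orbit z 0F = z
    orbit z 1F = - z
    orbit z 2F = conj z
    orbit z 3F = - conj z

    Norm-orbit : ∀ z i → Norm (orbit z i) ≈ Norm z
    Norm-orbit z 0F = refl
    Norm-orbit z 1F = Norm-neg z
    Norm-orbit z 2F = Norm-conj z
    Norm-orbit z 3F = trans (Norm-neg _) (Norm-conj z)

    S-orbit : ∀ z i → S (orbit z i) ≈ S z
    S-orbit z 0F = refl
    S-orbit z 1F = S-neg z
    S-orbit z 2F = S-conj z
    S-orbit z 3F = trans (S-neg _) (S-conj z)

    -- `Norm z` and `S z` are the data of the polynomial X² - S(z)X + Norm(z)² with roots z² and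
    -- z̄². The square of `z′` is a root of the same polynomial.
    orbit-complete : ∀ {z z′} → Norm z ≈ Norm z′ → S z ≈ S z′ → ∃ λ i → orbit z i ≈ z′
    orbit-complete {z} {z′} norms sums = Sum.[ Sum.[ (λ eq → 0F , sym eq) , (λ eq → 1F , sym eq) ]′ ∘ equal-squares ∘ difference-zero ,
      Sum.[ (λ eq → 2F , sym eq) , (λ eq → 3F , sym eq) ]′ ∘ equal-squares ∘ difference-zero ]′ (*-zero (begin
      (z′ * z′ - z * z) * (z′ * z′ - conj z * conj z)
        ≈⟨ solve 4 (λ z z̄ w w̄ → (w :* w :- z :* z) :* (w :* w :- z̄ :* z̄)
             := :- (w :* w) :* ((z :* z :+ z̄ :* z̄) :- (w :* w :+ w̄ :* w̄)) :+ (z :* z̄ :+ w :* w̄) :* (z :* z̄ :- w :* w̄)) refl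
             z (conj z) z′ (conj z′) ⟩
      - (z′ * z′) * (S z - S z′) + (Norm z + Norm z′) * (Norm z - Norm z′)
        ≈⟨ scale _ (zero-difference sums) ⊕ scale _ (zero-difference norms) ⟩
      0#
        ∎))

    -- For nonzero `z` this is the condition that `orbit z` has four different entries.
    Good : Carrier → Set b
    Good z = ¬ conj z ≈ z × ¬ conj z ≈ - z

    good? : ∀ z → Dec (Good z)
    good? z = ¬? (conj z ≟ z) ×-dec ¬? (conj z ≟ - z)

    orbit-injective : ∀ {z} → ¬ z ≈ 0# → Good z → ∀ {i j} → orbit z i ≈ orbit z j → i ≡ j
    orbit-injective {z} z≉0 (z̄≉z , z̄≉-z) = distinct₄ (orbit z)
      (z≉0 ∘ x≈-x⇒x≈0)
      (z̄≉z ∘ sym)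
      (λ z≈-z̄ → z̄≉-z (negate z≈-z̄))
      (z̄≉-z ∘ sym)
      (λ -z≈-z̄ → z̄≉z (trans (negate -z≈-z̄) (-‿involutive z)))
      (conj-nonzero z≉0 ∘ x≈-x⇒x≈0)
      where
      -‿involutive : ∀ x → - - x ≈ x
      -‿involutive = solve 1 (λ x → :- :- x := x) refl
      negate : ∀ {x y} → x ≈ - y → y ≈ - x
      negate eq = trans (sym (-‿involutive _)) (-‿cong (sym eq))

    exceptional : Carrier → Carrier → Fin 4 → Carrier
    exceptional x y 0F = x
    exceptional x y 1F = - x
    exceptional x y 2F = y
    exceptional x y 3F = - y

    -- If `conj z` is z, then z² is the norm; if it is -z, then z² is minus the norm. Only the
    -- square roots of κ and -κ remain.
    ¬good⇒exceptional : ∀ {x y κ z} → x * x ≈ κ → y * y ≈ - κ → Norm z ≈ κ → ¬ Good z → ∃ λ i → exceptional x y i ≈ z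
    ¬good⇒exceptional {x} {y} {κ} {z} xx≈κ yy≈-κ norm ¬good = decide (conj z ≟ z) (conj z ≟ - z)
      where
      decide : Dec (conj z ≈ z) → Dec (conj z ≈ - z) → ∃ λ i → exceptional x y i ≈ z
      decide (yes z̄≈z) _ = Sum.[ (λ eq → 0F , sym eq) , (λ eq → 1F , sym eq) ]′
        (equal-squares (trans (*-congˡ (sym z̄≈z)) (trans norm (sym xx≈κ))))
      decide (no _) (yes z̄≈-z) = Sum.[ (λ eq → 2F , sym eq) , (λ eq → 3F , sym eq) ]′
        (equal-squares (trans (solve 1 (λ z → z :* z := :- (z :* :- z)) refl z)
          (trans (-‿cong (trans (*-congˡ (sym z̄≈-z)) norm)) (sym yy≈-κ))))
      decide (no z̄≉z) (no z̄≉-z) = contradiction (z̄≉z , z̄≉-z) ¬good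

    -- A transversal of the levels of `S` on the good members of `f`. On transported feet `S` and
    -- `W` determine each other, so `S-injective` will make the lines attached to the
    -- representatives distinct.
    record Representatives {k : ℕ} (f : Fin k → Carrier) : Set (a ⊔ b) where
      field
        size        : ℕ
        rep         : Fin size → Carrier
        rep-∈       : ∀ j → ∃ λ i → rep j ≡ f i
        rep-good    : ∀ j → Good (rep j)
        S-injective : ∀ {i j} → S (rep i) ≈ S (rep j) → i ≡ j
        complete    : ∀ i → Good (f i) → ∃ λ j → S (rep j) ≈ S (f i)

    representatives : ∀ {k} (f : Fin k → Carrier) → Representatives f
    representatives {zero}  f = record
      { size = 0 ; rep = λ () ; rep-∈ = λ () ; rep-good = λ () ; S-injective = λ { {()} } ; complete = λ () }
    representatives {suc k} f = extend (good? (f 0F)) (Finₚ.any? (λ j → S (R.rep j) ≟ S (f 0F)))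
      where
      module R = Representatives (representatives (f ∘ suc))
      keep : (Good (f 0F) → ∃ λ j → S (R.rep j) ≈ S (f 0F)) → Representatives f
      keep old = record
        { size = R.size ; rep = R.rep ; rep-∈ = λ j → suc (proj₁ (R.rep-∈ j)) , proj₂ (R.rep-∈ j)
        ; rep-good = R.rep-good ; S-injective = R.S-injective
        ; complete = λ { zero → old ; (suc i) → R.complete i } }
      extend : Dec (Good (f 0F)) → Dec (∃ λ j → S (R.rep j) ≈ S (f 0F)) → Representatives f
      extend (no bad)   _         = keep (λ good → contradiction good bad)
      extend (yes _)    (yes old) = keep (λ _ → old)
      extend (yes good) (no new)  = record
        { size = suc R.size ; rep = rep ; rep-∈ = rep-∈ ; rep-good = rep-good ; S-injective = S-injective ; complete = complete }
        where
        rep : Fin (suc R.size) → Carrier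
        rep zero    = f 0F
        rep (suc j) = R.rep j
        rep-∈ : ∀ j → ∃ λ i → rep j ≡ f i
        rep-∈ zero    = 0F , ≡.refl
        rep-∈ (suc j) = suc (proj₁ (R.rep-∈ j)) , proj₂ (R.rep-∈ j)
        rep-good : ∀ j → Good (rep j)
        rep-good zero    = good
        rep-good (suc j) = R.rep-good j
        S-injective : ∀ {i j} → S (rep i) ≈ S (rep j) → i ≡ j
        S-injective {zero}  {zero}  eq = ≡.refl
        S-injective {zero}  {suc j} eq = contradiction (j , sym eq) new
        S-injective {suc i} {zero}  eq = contradiction (i , eq) new
        S-injective {suc i} {suc j} eq = ≡.cong suc (R.S-injective eq)
        complete : ∀ i → Good (f i) → ∃ λ j → S (rep j) ≈ S (f i)
        complete zero    _      = zero , refl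
        complete (suc i) good-i = suc (proj₁ (R.complete i good-i)) , proj₂ (R.complete i good-i)

    -- Good members lie in the orbit of a representative, and the others are among the four
    -- exceptional elements, so 4 · size + 4 values cover the injective family.
    representatives-bound : ∀ {k κ} {f : Fin k → Carrier} → κ ∈ K → (∀ i → Norm (f i) ≈ κ) → (∀ {i j} → f i ≈ f j → i ≡ j) →
      (R : Representatives f) → k ℕ.≤ 4 ℕ.+ 4 ℕ.* Representatives.size R
    representatives-bound {k} {κ} {f} κ∈K norms f-injective R = ℕₚ.≤-trans (subset-≤ h f f-injective (λ i → cover i (good? (f i))))
      (ℕₚ.≤-reflexive (≡.trans (ℕₚ.+-comm (size ℕ.* 4) 4) (≡.cong (4 ℕ.+_) (ℕₚ.*-comm size 4))))
      where
      open Representatives R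
      x y : Carrier
      x = proj₁ (square-root κ∈K)
      y = proj₁ (square-root (-‿closed κ∈K))
      value : (Fin size × Fin 4) ⊎ Fin 4 → Carrier
      value (inj₁ (j , c)) = orbit (rep j) c
      value (inj₂ c)       = exceptional x y c
      encode : (Fin size × Fin 4) ⊎ Fin 4 → Fin (size ℕ.* 4 ℕ.+ 4)
      encode = join (size ℕ.* 4) 4 ∘ Sum.map₁ (λ (j , c) → combine j c)
      decode : Fin (size ℕ.* 4 ℕ.+ 4) → (Fin size × Fin 4) ⊎ Fin 4
      decode = Sum.map₁ (remQuot 4) ∘ splitAt (size ℕ.* 4)
      h : Fin (size ℕ.* 4 ℕ.+ 4) → Carrier
      h = value ∘ decode
      decode-encode : ∀ t → decode (encode t) ≡ t
      decode-encode (inj₁ (j , c)) = ≡.trans (≡.cong (Sum.map₁ (remQuot 4)) (Finₚ.splitAt-join (size ℕ.* 4) 4 (inj₁ (combine j c))))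
        (≡.cong inj₁ (Finₚ.remQuot-combine j c))
      decode-encode (inj₂ c) = ≡.cong (Sum.map₁ (remQuot 4)) (Finₚ.splitAt-join (size ℕ.* 4) 4 (inj₂ c))
      cover′ : ∀ i t → value t ≈ f i → ∃ λ t → h t ≈ f i
      cover′ i t eq = encode t , trans (reflexive (≡.cong value (decode-encode t))) eq
      norm-rep : ∀ j → Norm (rep j) ≈ κ
      norm-rep j = trans (reflexive (≡.cong Norm (proj₂ (rep-∈ j)))) (norms (proj₁ (rep-∈ j)))
      cover : ∀ i → Dec (Good (f i)) → ∃ λ t → h t ≈ f i
      cover i (yes good) = cover′ i (inj₁ (j , proj₁ member)) (proj₂ member)
        where
        j : Fin size
        j = proj₁ (complete i good)
        member : ∃ λ c → orbit (rep j) c ≈ f i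
        member = orbit-complete (trans (norm-rep j) (sym (norms i))) (proj₂ (complete i good))
      cover i (no bad) = cover′ i (inj₂ (proj₁ member)) (proj₂ member)
        where
        member : ∃ λ c → exceptional x y c ≈ f i
        member = ¬good⇒exceptional (proj₂ (square-root κ∈K)) (proj₂ (square-root (-‿closed κ∈K))) (norms i) bad

    module _ {q : ℕ} (sizeK : HasSize setoid K q) where

      open Enumeration setoid sizeK

      -- One generator for each of the q + 1 one-dimensional `K`-subspaces of the field, with
      -- respect to the basis 1, e.
      direction : Fin (suc q) → Carrier
      direction zero    = 1#
      direction (suc i) = element i + e

      conj-direction : ∀ i → conj (direction (suc i)) ≈ element i - e
      conj-direction i = conj-fixed (element-∈ i) +ᶜ conj-e

      direction≉0 : ∀ i → ¬ direction i ≈ 0#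
      direction≉0 zero    = 1≉0
      direction≉0 (suc i) eq = e∉K (resp-≈ (sym (x+y≈0⇒x≈-y (trans (+-comm _ _) eq))) (-‿closed (element-∈ i)))

      -- The hypothesis equates the quotients t/t̄ of the two directions, cleared of denominators.
      direction-injective : ∀ i j → direction i * conj (direction j) ≈ direction j * conj (direction i) → i ≡ j
      direction-injective zero    zero    eq = ≡.refl
      direction-injective zero    (suc j) eq = contradiction (x≈-x⇒x≈0 (sym (difference-zero (begin
        - e - e                                ≈⟨ solve 2 (λ x e → :- e :- e := con 1ℤ :* (x :- e) :- (x :+ e) :* con 1ℤ) refl (element j) e ⟩
        1# * (element j - e) - (element j + e) * 1#
          ≈⟨ zero-difference (trans (*-congˡ (sym (conj-direction j))) (trans eq (*-congˡ 1ᶜ))) ⟩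
        0# ∎)))) e≉0
      direction-injective (suc i) zero    eq = contradiction (x≈-x⇒x≈0 (difference-zero (begin
        e - - e                                ≈⟨ solve 2 (λ x e → e :- :- e := (x :+ e) :* con 1ℤ :- con 1ℤ :* (x :- e)) refl (element i) e ⟩
        (element i + e) * 1# - 1# * (element i - e)
          ≈⟨ zero-difference (trans (*-congˡ (sym 1ᶜ)) (trans eq (*-congˡ (conj-direction i)))) ⟩
        0# ∎))) e≉0
      direction-injective (suc i) (suc j) eq = ≡.cong suc (element-injective (difference-zero (*-zero⇒ʳ (*-nonzero 2≉0 e≉0) (begin
        two * e * (element i - element j)
          ≈⟨ solve 3 (λ x y e → con (+ 2) :* e :* (x :- y) := (y :+ e) :* (x :- e) :- (x :+ e) :* (y :- e)) refl (element i) (element j) e ⟩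
        (element j + e) * (element i - e) - (element i + e) * (element j - e)
          ≈⟨ zero-difference (trans (*-congˡ (sym (conj-direction i))) (trans (sym eq) (*-congˡ (conj-direction j)))) ⟩
        0# ∎))))

      -- The quotients t/t̄ of the directions are q + 1 distinct elements of norm 1, as in Hilbert
      -- 90; multiplication by one element of norm κ moves them to the required circle.
      norm-circle : ∀ {κ} → κ ∈ K → ¬ κ ≈ 0# →
        ∃ λ (f : Fin (suc q) → Carrier) → (∀ i → Norm (f i) ≈ κ) × (∀ {i j} → f i ≈ f j → i ≡ j)
      norm-circle {κ} κ∈K κ≉0 = f , norms , f-injective
        where
        z : Carrier
        z = proj₁ (norm-surjective κ∈K)
        zz̄≈κ : z * conj z ≈ κ
        zz̄≈κ = proj₂ (norm-surjective κ∈K)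
        w f : Fin (suc q) → Carrier
        w i = inv (conj-nonzero (direction≉0 i))
        f i = z * (direction i * w i)
        w*t̄ : ∀ i → w i * conj (direction i) ≈ 1#
        w*t̄ i = inv-* (conj-nonzero (direction≉0 i))
        w̄*t : ∀ i → conj (w i) * direction i ≈ 1#
        w̄*t i = trans (sym (refl *ᶜ conj-involutive (direction i))) (trans (conj-cong (w*t̄ i)) 1ᶜ)
        norms : ∀ i → Norm (f i) ≈ κ
        norms i = begin
          f i * conj (f i)
            ≈⟨ *-congˡ (refl *ᶜ conj-* _ _) ⟩
          z * (direction i * w i) * (conj z * (conj (direction i) * conj (w i)))
            ≈⟨ solve 6 (λ z z′ t t′ w w′ → z :* (t :* w) :* (z′ :* (t′ :* w′)) := z :* z′ :* ((w :* t′) :* (w′ :* t))) refl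
                 z (conj z) (direction i) (conj (direction i)) (w i) (conj (w i)) ⟩
          z * conj z * (w i * conj (direction i) * (conj (w i) * direction i))
            ≈⟨ *-cong zz̄≈κ (trans (*-cong (w*t̄ i) (w̄*t i)) (*-identityʳ 1#)) ⟩
          κ * 1#
            ≈⟨ *-identityʳ κ ⟩
          κ ∎
        z≉0 : ¬ z ≈ 0#
        z≉0 z≈0 = κ≉0 (trans (sym zz̄≈κ) (trans (*-congʳ z≈0) (zeroˡ _)))
        f-injective : ∀ {i j} → f i ≈ f j → i ≡ j
        f-injective {i} {j} eq = direction-injective i j (begin
          direction i * conj (direction j)
            ≈⟨ trans (sym (*-identityʳ _)) (*-congˡ (sym (w*t̄ i))) ⟩
          direction i * conj (direction j) * (w i * conj (direction i))
            ≈⟨ solve 4 (λ t t′ w s → t :* s :* (w :* t′) := t :* w :* (t′ :* s)) refl (direction i) (conj (direction i)) (w i) (conj (direction j)) ⟩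
          direction i * w i * (conj (direction i) * conj (direction j))
            ≈⟨ *-congʳ (*-cancelˡ z≉0 eq) ⟩
          direction j * w j * (conj (direction i) * conj (direction j))
            ≈⟨ solve 4 (λ t t′ w s → t :* w :* (s :* t′) := t :* s :* (w :* t′)) refl (direction j) (conj (direction j)) (w j) (conj (direction i)) ⟩
          direction j * conj (direction i) * (w j * conj (direction j))
            ≈⟨ trans (*-congˡ (w*t̄ j)) (*-identityʳ _) ⟩
          direction j * conj (direction i) ∎)

      few-elements : q ℕ.≤ 3 → ∀ {x} → x ∈ K → ¬ x ≈ 0# → ¬ x ≈ 1# → ¬ x ≈ - 1# → ⊥
      few-elements q≤3 {x} x∈K x≉0 x≉1 x≉-1 = ℕₚ.<⇒≱ (ℕ.s≤s q≤3) (subset-≤ element f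
        (distinct₄ f (1≉0 ∘ sym) 0≉-1 (x≉0 ∘ sym) (1≉0 ∘ x≈-x⇒x≈0) (x≉1 ∘ sym) (x≉-1 ∘ sym))
        (λ i → index (f∈K i) , element-index (f∈K i)))
        where
        f : Fin 4 → Carrier
        f 0F = 0#
        f 1F = 1#
        f 2F = - 1#
        f 3F = x
        f∈K : ∀ i → f i ∈ K
        f∈K 0F = 0-closed
        f∈K 1F = 1-closed
        f∈K 2F = -‿closed 1-closed
        f∈K 3F = x∈K
        0≉-1 : ¬ 0# ≈ - 1#
        0≉-1 eq = 1≉0 (trans (sym (+-identityʳ 1#)) (trans (+-congˡ eq) (-‿inverseʳ 1#)))

    -- Square α: transport of `Q` and `W` to `Norm` and `S`

    module SquareCase (s : Carrier) (ss≈α : s * s ≈ α) where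

      g σ : Carrier
      g = s * conj s
      σ = e - δ

      conj-g : conj g ≈ g
      conj-g = trans (refl *ᶜ conj-involutive s) (*-comm _ _)

      conj-σ : conj σ ≈ - σ
      conj-σ = trans (conj-e +ᶜ -ᶜ conj-δ) (solve 2 (λ e δ → :- e :- :- δ := :- (e :- δ)) refl e δ)

      s≉0 : ¬ s ≈ 0#
      s≉0 s≈0 = α≉0 (trans (sym ss≈α) (scale s s≈0))

      g≉0 : ¬ g ≈ 0#
      g≉0 = *-nonzero s≉0 (conj-nonzero s≉0)

      ᾱ≈ : conj α ≈ conj s * conj s
      ᾱ≈ = trans (conj-cong (sym ss≈α)) (conj-* s s)

      -- The definition of `d` with αᾱ = g², equivalently σ(e + δ) = 4g². The formulas for `ζ` and
      -- its inverse all reduce to this one relation.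
      ee-δδ-4gg≈0 : e * e - δ * δ - four * (g * g) ≈ 0#
      ee-δδ-4gg≈0 = begin
        e * e - δ * δ - four * (g * g)
          ≈⟨ +-congʳ (+-congʳ (trans ee≈d (+-congˡ (*-congˡ (*-cong (sym ss≈α) ᾱ≈))))) ⟩
        δ * δ + four * (s * s * (conj s * conj s)) - δ * δ - four * (g * g)
          ≈⟨ solve 3 (λ δ s s′ → δ :* δ :+ con (+ 4) :* (s :* s :* (s′ :* s′)) :- δ :* δ :- con (+ 4) :* (s :* s′ :* (s :* s′)) := con 0ℤ) refl δ s (conj s) ⟩
        0# ∎

      σ≉0 : ¬ σ ≈ 0#
      σ≉0 σ≈0 = *-nonzero 4≉0 (*-nonzero g≉0 g≉0) (begin
        four * (g * g)
          ≈⟨ solve 3 (λ e δ g → con (+ 4) :* (g :* g) := (e :+ δ) :* (e :- δ) :+ :- con 1ℤ :* (e :* e :- δ :* δ :- con (+ 4) :* (g :* g))) refl e δ g ⟩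
        (e + δ) * σ + - 1# * (e * e - δ * δ - four * (g * g))
          ≈⟨ scale _ σ≈0 ⊕ scale _ ee-δδ-4gg≈0 ⟩
        0# ∎)

      -- With w = su, `Q u` is w² - w̄² + (δ/g)ww̄, which splits as (w - λw̄)(w + w̄/λ) for λ =
      -- σ/(2g), since 1/λ = (e + δ)/(2g). `ζ u` is 2g times the first factor. As conj λ = -λ, its
      -- conjugate is σ times the second, whence `Norm-ζ`.
      ζ : Carrier → Carrier
      ζ u = two * g * (s * u) - σ * conj (s * u)

      ζ-cong : ∀ {u v} → u ≈ v → ζ u ≈ ζ v
      ζ-cong u≈v = +-cong (*-congˡ (*-congˡ u≈v)) (-‿cong (*-congˡ (conj-cong (*-congˡ u≈v))))

      conj-ζ : ∀ u → conj (ζ u) ≈ two * g * conj (s * u) - - σ * (s * u)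
      conj-ζ u = 2ᶜ *ᶜ conj-g *ᶜ refl +ᶜ -ᶜ (conj-σ *ᶜ conj-involutive (s * u))

      Q-square : ∀ u → Q u ≈ s * s * (u * u) - conj s * conj s * (conj u * conj u) + δ * (u * conj u)
      Q-square u = +-congʳ (+-cong (*-congʳ (sym ss≈α)) (-‿cong (*-congʳ ᾱ≈)))

      Norm-ζ : ∀ u → Norm (ζ u) ≈ two * g * σ * Q u
      Norm-ζ u = difference-zero (begin
        ζ u * conj (ζ u) - two * g * σ * Q u
          ≈⟨ +-cong (*-cong (+-congˡ (-‿cong (*-congˡ (conj-* s u)))) (trans (conj-ζ u) (+-congʳ (*-congˡ (conj-* s u))))) (-‿cong (*-congˡ (Q-square u))) ⟩
        (two * g * (s * u) - σ * (conj s * conj u)) * (two * g * (conj s * conj u) - - σ * (s * u))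
          - two * g * σ * (s * s * (u * u) - conj s * conj s * (conj u * conj u) + δ * (u * conj u))
          ≈⟨ solve 6 (λ s s′ u u′ δ e →
               (con (+ 2) :* (s :* s′) :* (s :* u) :- (e :- δ) :* (s′ :* u′)) :* (con (+ 2) :* (s :* s′) :* (s′ :* u′) :- :- (e :- δ) :* (s :* u))
               :- con (+ 2) :* (s :* s′) :* (e :- δ) :* (s :* s :* (u :* u) :- s′ :* s′ :* (u′ :* u′) :+ δ :* (u :* u′))
               := :- (s :* u :* (s′ :* u′)) :* (e :* e :- δ :* δ :- con (+ 4) :* (s :* s′ :* (s :* s′)))) refl
               s (conj s) u (conj u) δ e ⟩
        - (s * u * (conj s * conj u)) * (e * e - δ * δ - four * (g * g))
          ≈⟨ scale _ ee-δδ-4gg≈0 ⟩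
        0# ∎)

      -- With w = su, W - Q is w² + w̄². The mixed terms of ζ² and of its conjugate cancel, and the
      -- squares appear with the factor 4g² + σ² = 2σe.
      S-ζ : ∀ u → S (ζ u) ≈ two * σ * e * (W u - Q u)
      S-ζ u = difference-zero (begin
        ζ u * ζ u + conj (ζ u) * conj (ζ u) - two * σ * e * (W u - Q u)
          ≈⟨ +-cong (+-cong (*-cong ζ≈ ζ≈) (*-cong ζ̄≈ ζ̄≈)) (-‿cong (*-congˡ W-Q≈)) ⟩
        (two * g * (s * u) - σ * (conj s * conj u)) * (two * g * (s * u) - σ * (conj s * conj u))
          + (two * g * (conj s * conj u) - - σ * (s * u)) * (two * g * (conj s * conj u) - - σ * (s * u))
          - two * σ * e * (s * s * (u * u) + conj s * conj s * (conj u * conj u))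
          ≈⟨ solve 6 (λ s s′ u u′ δ e →
               (con (+ 2) :* (s :* s′) :* (s :* u) :- (e :- δ) :* (s′ :* u′)) :* (con (+ 2) :* (s :* s′) :* (s :* u) :- (e :- δ) :* (s′ :* u′))
               :+ (con (+ 2) :* (s :* s′) :* (s′ :* u′) :- :- (e :- δ) :* (s :* u)) :* (con (+ 2) :* (s :* s′) :* (s′ :* u′) :- :- (e :- δ) :* (s :* u))
               :- con (+ 2) :* (e :- δ) :* e :* (s :* s :* (u :* u) :+ s′ :* s′ :* (u′ :* u′))
               := :- (s :* s :* (u :* u) :+ s′ :* s′ :* (u′ :* u′)) :* (e :* e :- δ :* δ :- con (+ 4) :* (s :* s′ :* (s :* s′)))) refl
               s (conj s) u (conj u) δ e ⟩
        - (s * s * (u * u) + conj s * conj s * (conj u * conj u)) * (e * e - δ * δ - four * (g * g))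
          ≈⟨ scale _ ee-δδ-4gg≈0 ⟩
        0# ∎)
        where
        ζ≈ : ζ u ≈ two * g * (s * u) - σ * (conj s * conj u)
        ζ≈ = +-congˡ (-‿cong (*-congˡ (conj-* s u)))
        ζ̄≈ : conj (ζ u) ≈ two * g * (conj s * conj u) - - σ * (s * u)
        ζ̄≈ = trans (conj-ζ u) (+-congʳ (*-congˡ (conj-* s u)))
        W-Q≈ : W u - Q u ≈ s * s * (u * u) + conj s * conj s * (conj u * conj u)
        W-Q≈ = begin
          W u - Q u
            ≈⟨ solve 5 (λ α α′ δ u u′ → (con (+ 2) :* α :* u :+ δ :* u′) :* u :- (α :* (u :* u) :- α′ :* (u′ :* u′) :+ δ :* (u :* u′))
                 := α :* (u :* u) :+ α′ :* (u′ :* u′)) refl α (conj α) δ u (conj u) ⟩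
          α * (u * u) + conj α * (conj u * conj u)
            ≈⟨ +-cong (*-congʳ (sym ss≈α)) (*-congʳ ᾱ≈) ⟩
          s * s * (u * u) + conj s * conj s * (conj u * conj u)
            ∎

      σe≉0 : ¬ two * σ * e ≈ 0#
      σe≉0 = *-nonzero (*-nonzero 2≉0 σ≉0) e≉0

      j : Carrier
      j = inv σe≉0

      j∈K : j ∈ K
      j∈K = ⁻¹-closed (fixed⇒∈ (trans (2ᶜ *ᶜ conj-σ *ᶜ conj-e)
        (solve 2 (λ σ e → con (+ 2) :* :- σ :* :- e := con (+ 2) :* σ :* e) refl σ e))) (trans (*-comm _ _) (inv-* σe≉0))

      -- The inverse of `ζ` by Cramer's rule in `s * u` and its conjugate; `j` inverts the
      -- determinant 4g² + σ² = 2σe.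
      θ : Carrier → Carrier
      θ z = inv s≉0 * ((two * g * z + σ * conj z) * j)

      θ-cong : ∀ {z z′} → z ≈ z′ → θ z ≈ θ z′
      θ-cong z≈z′ = *-congˡ (*-congʳ (+-cong (*-congˡ z≈z′) (*-congˡ (conj-cong z≈z′))))

      4gg+σσ : four * (g * g) + σ * σ ≈ two * σ * e
      4gg+σσ = difference-zero (trans (solve 3 (λ g e δ → con (+ 4) :* (g :* g) :+ (e :- δ) :* (e :- δ) :- con (+ 2) :* (e :- δ) :* e
        := :- con 1ℤ :* (e :* e :- δ :* δ :- con (+ 4) :* (g :* g))) refl g e δ) (scale _ ee-δδ-4gg≈0))

      ζ-θ : ∀ z → ζ (θ z) ≈ z
      ζ-θ z = begin
        ζ (θ z)
          ≈⟨ +-cong (*-congˡ sθ≈) (-‿cong (*-congˡ (trans (conj-cong sθ≈) ((2ᶜ *ᶜ conj-g *ᶜ refl +ᶜ conj-σ *ᶜ conj-involutive z) *ᶜ conj-fixed j∈K)))) ⟩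
        two * g * ((two * g * z + σ * conj z) * j) - σ * ((two * g * conj z + - σ * z) * j)
          ≈⟨ solve 5 (λ g σ z z′ j → con (+ 2) :* g :* ((con (+ 2) :* g :* z :+ σ :* z′) :* j) :- σ :* ((con (+ 2) :* g :* z′ :+ :- σ :* z) :* j)
               := z :* (j :* (con (+ 4) :* (g :* g) :+ σ :* σ))) refl g σ z (conj z) j ⟩
        z * (j * (four * (g * g) + σ * σ))
          ≈⟨ *-congˡ (trans (*-congˡ 4gg+σσ) (inv-* σe≉0)) ⟩
        z * 1#
          ≈⟨ *-identityʳ z ⟩
        z ∎
        where
        sθ≈ : s * θ z ≈ (two * g * z + σ * conj z) * j
        sθ≈ = trans (sym (*-assoc _ _ _)) (trans (*-congʳ (trans (*-comm _ _) (inv-* s≉0))) (*-identityˡ _))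

      θ-ζ : ∀ u → θ (ζ u) ≈ u
      θ-ζ u = begin
        θ (ζ u)
          ≈⟨ *-congˡ (*-congʳ (+-congˡ (*-congˡ (conj-ζ u)))) ⟩
        inv s≉0 * ((two * g * (two * g * (s * u) - σ * conj (s * u)) + σ * (two * g * conj (s * u) - - σ * (s * u))) * j)
          ≈⟨ solve 7 (λ i g σ s u v̄ j → i :* ((con (+ 2) :* g :* (con (+ 2) :* g :* (s :* u) :- σ :* v̄) :+ σ :* (con (+ 2) :* g :* v̄ :- :- σ :* (s :* u))) :* j)
               := (i :* s) :* (u :* (j :* (con (+ 4) :* (g :* g) :+ σ :* σ)))) refl (inv s≉0) g σ s u (conj (s * u)) j ⟩
        inv s≉0 * s * (u * (j * (four * (g * g) + σ * σ)))
          ≈⟨ *-cong (inv-* s≉0) (*-congˡ (trans (*-congˡ 4gg+σσ) (inv-* σe≉0))) ⟩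
        1# * (u * 1#)
          ≈⟨ trans (*-identityˡ _) (*-identityʳ u) ⟩
        u ∎

      Norm≈⇒Q≈ : ∀ {u v} → Norm (ζ u) ≈ Norm (ζ v) → Q u ≈ Q v
      Norm≈⇒Q≈ eq = *-cancelˡ (*-nonzero (*-nonzero 2≉0 g≉0) σ≉0) (trans (sym (Norm-ζ _)) (trans eq (Norm-ζ _)))

      S≈⇒W≈ : ∀ {u v} → Q u ≈ Q v → S (ζ u) ≈ S (ζ v) → W u ≈ W v
      S≈⇒W≈ {u} {v} Qu≈Qv eq = begin
        W u              ≈⟨ solve 2 (λ w q → w := (w :- q) :+ q) refl (W u) (Q u) ⟩
        (W u - Q u) + Q u ≈⟨ +-cong (*-cancelˡ σe≉0 (trans (sym (S-ζ u)) (trans eq (S-ζ v)))) Qu≈Qv ⟩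
        (W v - Q v) + Q v ≈⟨ solve 2 (λ w q → w := (w :- q) :+ q) refl (W v) (Q v) ⟨
        W v              ∎

      W≈⇒orbit : ∀ {u v} → W u ≈ W v → ∃ λ i → θ (orbit (ζ u) i) ≈ v
      W≈⇒orbit {u} {v} Wu≈Wv = proj₁ member , trans (θ-cong (proj₂ member)) (θ-ζ v)
        where
        member : ∃ λ i → orbit (ζ u) i ≈ ζ v
        member = orbit-complete (trans (Norm-ζ u) (trans (*-congˡ (W≈⇒Q≈ Wu≈Wv)) (sym (Norm-ζ v))))
          (trans (S-ζ u) (trans (*-congˡ (+-cong Wu≈Wv (-‿cong (W≈⇒Q≈ Wu≈Wv)))) (sym (S-ζ v))))

      orbit⇒Q≈ : ∀ u i → Q (θ (orbit (ζ u) i)) ≈ Q u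
      orbit⇒Q≈ u i = Norm≈⇒Q≈ (trans (Norm-cong (ζ-θ _)) (Norm-orbit (ζ u) i))

      orbit⇒W≈ : ∀ u i → W (θ (orbit (ζ u) i)) ≈ W u
      orbit⇒W≈ u i = S≈⇒W≈ (orbit⇒Q≈ u i) (trans (S-cong (ζ-θ _)) (S-orbit (ζ u) i))

      -- For q = 3 one would have g² = 1 and d = δ² + 1, so d = -1 and δ = ±1, contradicting conj δ = - δ.
      q≰3 : ∀ {q} → HasSize setoid K q → ¬ q ℕ.≤ 3
      q≰3 sizeK q≤3 = d≉-1 (only d∈K d≉0 d≉1)
        where
        only : ∀ {x} → x ∈ K → ¬ x ≈ 0# → ¬ x ≈ 1# → x ≈ - 1#
        only {x} x∈K x≉0 x≉1 = decidable-stable (x ≟ - 1#) (few-elements sizeK q≤3 x∈K x≉0 x≉1)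
        2≈-1 : two ≈ - 1#
        2≈-1 = only (+-closed 1-closed 1-closed) 2≉0 (λ 2≈1 → 1≉0 (trans (solve 0 (con 1ℤ := con (+ 2) :- con 1ℤ) refl) (zero-difference 2≈1)))
        gg≈1 : g * g ≈ 1#
        gg≈1 = decide (g ≟ 1#)
          where
          decide : Dec (g ≈ 1#) → g * g ≈ 1#
          decide (yes g≈1) = trans (*-cong g≈1 g≈1) (*-identityʳ 1#)
          decide (no g≉1)  = trans (*-cong g≈-1 g≈-1) (solve 0 (:- con 1ℤ :* :- con 1ℤ := con 1ℤ) refl)
            where
            g≈-1 : g ≈ - 1#
            g≈-1 = only (fixed⇒∈ conj-g) g≉0 g≉1
        d≉1 : ¬ d ≈ 1#
        d≉1 d≈1 = nonsquare (1# , 1-closed , trans (*-identityʳ 1#) (sym d≈1))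
        d≉-1 : ¬ d ≈ - 1#
        d≉-1 d≈-1 = δ≉0 (x≈-x⇒x≈0 (trans (sym (conj-fixed δ∈K)) conj-δ))
          where
          δδ≈1 : δ * δ ≈ 1# * 1#
          δδ≈1 = difference-zero (trans
            (solve 4 (λ δ d e g → δ :* δ :- con 1ℤ :* con 1ℤ := (d :- :- con 1ℤ) :+ (e :* e :- d)
               :+ :- con 1ℤ :* (e :* e :- δ :* δ :- con (+ 4) :* (g :* g)) :+ :- con (+ 4) :* (g :* g :- con 1ℤ) :+ :- con (+ 2) :* (con (+ 2) :- :- con 1ℤ)) refl δ d e g)
            ((((zero-difference d≈-1 ⊕ zero-difference ee≈d) ⊕ scale _ ee-δδ-4gg≈0) ⊕ scale _ (zero-difference gg≈1)) ⊕ scale _ (zero-difference 2≈-1)))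
          δ∈K : δ ∈ K
          δ∈K = Sum.[ (λ eq → resp-≈ (sym eq) 1-closed) , (λ eq → resp-≈ (sym eq) (-‿closed 1-closed)) ]′ (equal-squares δδ≈1)
          δ≉0 : ¬ δ ≈ 0#
          δ≉0 δ≈0 = 1≉0 (trans (sym (trans δδ≈1 (*-identityʳ 1#))) (scale δ δ≈0))

Fin1-unique : (i j : Fin 1) → i ≡ j
Fin1-unique 0F 0F = ≡.refl

-- Pedals of orthogonal Buekenhout-Metz unitals

module Plane (F : CommutativeRing a b) (isField : IsField F)
  (K : Pred (CommutativeRing.Carrier F) p) (isSubfield : IsSubfield F K) (q : ℕ)
  (sizeF : HasSize (CommutativeRing.setoid F) U (q ℕ.^ 2)) (conjugation : Conjugation F K) where

  open CommutativeRing F hiding (zero)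
  open IsField isField
  open IsSubfield isSubfield
  open IntegerCoefficients F
  open FiniteField F isField sizeF
  open Conjugation conjugation
  open QuadraticExtension F isField K isSubfield sizeF conjugation
  open PG2 F isField K q
  open AbelianGroupProperties +-abelianGroup using () renaming (∙-cancelˡ to +-cancelˡ)
  open import Relation.Binary.Reasoning.Setoid setoid

  -- Affine coordinates in the plane

  infix 4 _∼′_
  _∼′_ : Point → Point → Set (a ⊔ b)
  R ∼′ R′ = coords R ∼ coords R′

  affine : Carrier → Carrier → Vector Carrier 3
  affine x y = x ∷ᵥ y ∷ᵥ 1# ∷ᵥ []ᵥ

  affinePoint : Carrier → Carrier → Point
  affinePoint x y = affine x y , λ eq → 1≉0 (eq 2F)

  affine-∼ : ∀ {x y x′ y′} → affine x y ∼ affine x′ y′ → x ≈ x′ × y ≈ y′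
  affine-∼ (c , _ , eq) = cancel (eq 0F) , cancel (eq 1F)
    where
    cancel : ∀ {x y} → x ≈ c * y → x ≈ y
    cancel eq′ = trans eq′ (trans (*-congʳ (trans (sym (*-identityʳ c)) (sym (eq 2F)))) (*-identityˡ _))

  affine-cong : ∀ {x y x′ y′} → x ≈ x′ → y ≈ y′ → affine x y ∼ affine x′ y′
  affine-cong x≈x′ y≈y′ = 1# , 1≉0 , λ where
    0F → trans x≈x′ (sym (*-identityˡ _))
    1F → trans y≈y′ (sym (*-identityˡ _))
    2F → sym (*-identityˡ _)

  dot-∼ : ∀ {l v w} → v ∼ w → dot l w ≈ 0# → dot l v ≈ 0#
  dot-∼ {l} {v} {w} (c , _ , v≈cw) lw≈0 = begin
    dot l v
      ≈⟨ +-cong (*-congˡ (v≈cw 0F)) (+-cong (*-congˡ (v≈cw 1F)) (+-congʳ (*-congˡ (v≈cw 2F)))) ⟩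
    l 0F * (c * w 0F) + (l 1F * (c * w 1F) + (l 2F * (c * w 2F) + 0#))
      ≈⟨ solve 7 (λ l₀ l₁ l₂ w₀ w₁ w₂ c → l₀ :* (c :* w₀) :+ (l₁ :* (c :* w₁) :+ (l₂ :* (c :* w₂) :+ con 0ℤ))
           := c :* (l₀ :* w₀ :+ (l₁ :* w₁ :+ (l₂ :* w₂ :+ con 0ℤ)))) refl (l 0F) (l 1F) (l 2F) (w 0F) (w 1F) (w 2F) c ⟩
    c * dot l w
      ≈⟨ scale c lw≈0 ⟩
    0# ∎

  dot-affine : ∀ l x y → dot l (affine x y) ≈ l 0F * x + l 1F * y + l 2F
  dot-affine l x y = solve 5 (λ l₀ l₁ l₂ x y → l₀ :* x :+ (l₁ :* y :+ (l₂ :* con 1ℤ :+ con 0ℤ)) := l₀ :* x :+ l₁ :* y :+ l₂) refl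
    (l 0F) (l 1F) (l 2F) x y

  on-affine⁻ : ∀ {R ℓ x y} → coords R ∼ affine x y → R on ℓ → coeffs ℓ 0F * x + coeffs ℓ 1F * y + coeffs ℓ 2F ≈ 0#
  on-affine⁻ {R} {ℓ} {x} {y} R∼ R-on = trans (sym (dot-affine (coeffs ℓ) x y)) (dot-∼ {coeffs ℓ} (∼-sym R∼) R-on)

  on-affine⁺ : ∀ {R ℓ x y} → coords R ∼ affine x y → coeffs ℓ 0F * x + coeffs ℓ 1F * y + coeffs ℓ 2F ≈ 0# → R on ℓ
  on-affine⁺ {R} {ℓ} {x} {y} R∼ eq = dot-∼ {coeffs ℓ} R∼ (trans (dot-affine (coeffs ℓ) x y) eq)

  affine-form : ∀ R → ¬ R on ℓ∞ → ∃ λ x → ∃ λ y → coords R ∼ affine x y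
  affine-form R R∉ℓ∞ = inv r≉0 * coords R 0F , inv r≉0 * coords R 1F , coords R 2F , r≉0 , λ where
      0F → cancel _
      1F → cancel _
      2F → sym (*-identityʳ _)
    where
    r≉0 : ¬ coords R 2F ≈ 0#
    r≉0 r≈0 = R∉ℓ∞ (trans (solve 3 (λ x y z → con 0ℤ :* x :+ (con 0ℤ :* y :+ (con 1ℤ :* z :+ con 0ℤ)) := z) refl (coords R 0F) (coords R 1F) (coords R 2F)) r≈0)
    cancel : ∀ x → x ≈ coords R 2F * (inv r≉0 * x)
    cancel x = sym (trans (sym (*-assoc _ _ _)) (trans (*-congʳ (trans (*-comm _ _) (inv-* r≉0))) (*-identityˡ x)))

  size-1-unique : ∀ {s} {𝒦 : Pred Point s} → HasSize Points 𝒦 1 → ∀ {R R′} → R ∈ 𝒦 → R′ ∈ 𝒦 → coords R ∼ coords R′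
  size-1-unique size {R} {R′} R∈ R′∈ = ∼-trans (∼-sym (E.element-index R∈))
    (≡.subst (λ i → coords (E.element i) ∼ coords R′) (Fin1-unique (E.index R′∈) (E.index R∈)) (E.element-index R′∈))
    where
    module E = Enumeration Points size

  -- The unital and its affine equation

  module _ (conj-power : ∀ x → conj x ≈ x ^ q) (α β : Carrier) (α≉0 : ¬ α ≈ 0#)
           (disc-nonsquare : ¬ IsSquareIn F K (discriminant α β)) where

    δ : Carrier
    δ = β - conj β

    abstract
      conj-δ : conj δ ≈ - δ
      conj-δ = trans (refl +ᶜ -ᶜ conj-involutive β) (solve 2 (λ β β′ → β′ :- β := :- (β :- β′)) refl β (conj β))

      x^[q+1] : ∀ x → x ^ (q ℕ.+ 1) ≈ x * conj x
      x^[q+1] x = trans (^-homo-* x q 1) (trans (*-cong (sym (conj-power x)) (*-identityʳ x)) (*-comm _ _))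

      discriminant≈ : discriminant α β ≈ δ * δ + fromℤ (+ 4) * (α * conj α)
      discriminant≈ = begin
        discriminant α β
          ≈⟨ +-cong (*-cong β̄-β (*-congʳ β̄-β)) (+-cong x+1 (+-cong x+1 (+-cong x+1 (+-congʳ x+1)))) ⟩
        (conj β - β) * ((conj β - β) * 1#) + (α * conj α + (α * conj α + (α * conj α + (α * conj α + 0#))))
          ≈⟨ solve 3 (λ β β′ n → (β′ :- β) :* ((β′ :- β) :* con 1ℤ) :+ (n :+ (n :+ (n :+ (n :+ con 0ℤ))))
               := (β :- β′) :* (β :- β′) :+ con (+ 4) :* n) refl β (conj β) (α * conj α) ⟩
        δ * δ + fromℤ (+ 4) * (α * conj α)
          ∎
        where
        β̄-β : β ^ q - β ≈ conj β - β
        β̄-β = +-congʳ (sym (conj-power β))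
        x+1 : α ^ (q ℕ.+ 1) ≈ α * conj α
        x+1 = x^[q+1] α

      nonsquare : ¬ IsSquareIn F K (δ * δ + fromℤ (+ 4) * (α * conj α))
      nonsquare (y , y∈K , yy≈d) = disc-nonsquare (y , y∈K , trans yy≈d (sym discriminant≈))

    open Form α δ α≉0 conj-δ nonsquare

    -- The unital asks that y - αx² - βx^(q+1) lie in `K`, that is, be killed by `I`. Applying `I`
    -- leaves β only through δ, and `h x y ≈ 0#` is the resulting affine equation.
    h : Carrier → Carrier → Carrier
    h x y = I y - Q x

    h-cong : ∀ {x y x′ y′} → x ≈ x′ → y ≈ y′ → h x y ≈ h x′ y′
    h-cong x≈x′ y≈y′ = +-cong (+-cong y≈y′ (-‿cong (conj-cong y≈y′))) (-‿cong (Q-cong x≈x′))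

    abstract
      h-unital : ∀ x y → h x y ≈ I (y - (α * x ^ 2 + β * x ^ (q ℕ.+ 1)))
      h-unital x y = begin
        y - conj y - (α * (x * x) - conj α * (conj x * conj x) + δ * (x * conj x))
          ≈⟨ solve 8 (λ α α′ β β′ x x′ y y′ → y :- y′ :- (α :* (x :* x) :- α′ :* (x′ :* x′) :+ (β :- β′) :* (x :* x′))
               := (y :- (α :* (x :* (x :* con 1ℤ)) :+ β :* (x :* x′))) :- (y′ :- (α′ :* (x′ :* (x′ :* con 1ℤ)) :+ β′ :* (x′ :* x)))) refl
               α (conj α) β (conj β) x (conj x) y (conj y) ⟩
        (y - (α * x ^ 2 + β * (x * conj x))) - (conj y - (conj α * (conj x * (conj x * 1#)) + conj β * (conj x * x)))
          ≈⟨ +-congˡ (-‿cong (refl +ᶜ -ᶜ (refl *ᶜ (refl *ᶜ (refl *ᶜ 1ᶜ)) +ᶜ refl *ᶜ (refl *ᶜ conj-involutive x)))) ⟨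
        I (y - (α * x ^ 2 + β * (x * conj x)))
          ≈⟨ +-cong y-≈ (-‿cong (conj-cong y-≈)) ⟨
        I (y - (α * x ^ 2 + β * x ^ (q ℕ.+ 1)))
          ∎
        where
        y-≈ : y - (α * x ^ 2 + β * x ^ (q ℕ.+ 1)) ≈ y - (α * x ^ 2 + β * (x * conj x))
        y-≈ = +-congˡ (-‿cong (+-congˡ (*-congˡ (x^[q+1] x))))

    I≈0⇒∈K : ∀ {x} → I x ≈ 0# → x ∈ K
    I≈0⇒∈K eq = fixed⇒∈ (sym (difference-zero eq))

    ∈K⇒I≈0 : ∀ {x} → x ∈ K → I x ≈ 0#
    ∈K⇒I≈0 x∈K = zero-difference (sym (conj-fixed x∈K))

    unital⇒h : ∀ x r → r ∈ K → h x (α * x ^ 2 + β * x ^ (q ℕ.+ 1) + r) ≈ 0#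
    unital⇒h x r r∈K = trans (h-unital x _) (∈K⇒I≈0 (resp-≈ (solve 2 (λ t r → r := t :+ r :- t) refl (α * x ^ 2 + β * x ^ (q ℕ.+ 1)) r) r∈K))

    unital-affine⁻ : ∀ {R x y} → coords R ∼ affine x y → R ∈ 𝒰 α β → h x y ≈ 0#
    unital-affine⁻ {R} {x} {y} R∼ (inj₁ (x′ , r , r∈K , R∼′)) = trans (h-cong (proj₁ eqs) (proj₂ eqs)) (unital⇒h x′ r r∈K)
      where
      eqs : x ≈ x′ × y ≈ α * x′ ^ 2 + β * x′ ^ (q ℕ.+ 1) + r
      eqs = affine-∼ (∼-trans (∼-sym R∼) R∼′)
    unital-affine⁻ R∼ (inj₂ R∼∞) = contradiction (proj₂ (proj₂ 1∼0) 2F) λ eq → 1≉0 (trans eq (zeroʳ _))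
      where
      1∼0 : affine _ _ ∼ (0# ∷ᵥ 1# ∷ᵥ 0# ∷ᵥ []ᵥ)
      1∼0 = ∼-trans (∼-sym R∼) R∼∞

    unital-affine⁺ : ∀ {R x y} → coords R ∼ affine x y → h x y ≈ 0# → R ∈ 𝒰 α β
    unital-affine⁺ {R} {x} {y} R∼ hxy≈0 = inj₁ (x , y - f , I≈0⇒∈K (trans (sym (h-unital x y)) hxy≈0) ,
      ∼-trans R∼ (affine-cong refl (solve 2 (λ y f → y := f :+ (y :- f)) refl y f)))
      where
      f : Carrier
      f = α * x ^ 2 + β * x ^ (q ℕ.+ 1)

    -- Tangents through P and their feet

    module _ (P : Point) (x₀ y₀ : Carrier) (P∼ : coords P ∼ affine x₀ y₀) (P∉𝒰 : P ∉ 𝒰 α β) where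

      c A : Carrier
      c = h x₀ y₀
      A = slope x₀

      c≉0 : ¬ c ≈ 0#
      c≉0 = P∉𝒰 ∘ unital-affine⁺ {P} P∼

      foot-y : Carrier → Carrier
      foot-y u = y₀ + (slope u + A) * u

      foot : Carrier → Vector Carrier 3
      foot u = affine (x₀ + u) (foot-y u)

      footPoint : Carrier → Point
      footPoint u = affinePoint (x₀ + u) (foot-y u)

      Foot : Pred Carrier b
      Foot u = c + Q u ≈ 0#

      abstract
        -- The summand `A` of the slope cancels the polar term of `Q` at `x₀`; the rest is completed
        -- to a square by `Q--`. For `Foot u` the restriction of `h` to the line is therefore -Q(v -
        -- u).
        h-line : ∀ u v → h (x₀ + v) (y₀ + (slope u + A) * v) ≈ c + Q u - Q (v - u)
        h-line u v = begin
          I (y₀ + (slope u + A) * v) - Q (x₀ + v)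
            ≈⟨ +-cong (+-cong (+-congˡ (distribʳ v _ _)) (-‿cong (trans (conj-+ _ _) (+-congˡ (trans (conj-cong (distribʳ v _ _)) (conj-+ _ _)))))) (-‿cong (Q-+ x₀ v)) ⟩
          (y₀ + (slope u * v + A * v)) - (conj y₀ + (conj (slope u * v) + conj (A * v))) - (Q x₀ + I (A * v) + Q v)
            ≈⟨ solve 9 (λ y y′ s s′ t t′ q q′ q″ → (y :+ (s :+ t)) :- (y′ :+ (s′ :+ t′)) :- (q :+ (t :- t′) :+ q′)
                 := (y :- y′ :- q) :+ q″ :- (q″ :- (s :- s′) :+ q′)) refl
                 y₀ (conj y₀) (slope u * v) (conj (slope u * v)) (A * v) (conj (A * v)) (Q x₀) (Q v) (Q u) ⟩
          c + Q u - (Q u - I (slope u * v) + Q v)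
            ≈⟨ +-congˡ (-‿cong (Q-- u v)) ⟨
          c + Q u - Q (v - u)
            ∎

        Q-zero : ∀ {u} → u ≈ 0# → Q u ≈ 0#
        Q-zero {u} u≈0 = begin
          α * (u * u) - conj α * (conj u * conj u) + δ * (u * conj u)
            ≈⟨ solve 5 (λ α α′ δ u u′ → α :* (u :* u) :- α′ :* (u′ :* u′) :+ δ :* (u :* u′) := (α :* u :+ δ :* u′) :* u :+ (:- α′ :* u′) :* u′) refl
                 α (conj α) δ u (conj u) ⟩
          (α * u + δ * conj u) * u + - conj α * conj u * conj u
            ≈⟨ scale _ u≈0 ⊕ scale _ (trans (conj-cong u≈0) 0ᶜ) ⟩
          0# ∎

        Foot⇒h : ∀ {u} → Foot u → h (x₀ + u) (foot-y u) ≈ 0#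
        Foot⇒h {u} foot-u = trans (h-line u u) (trans (+-cong foot-u (trans (-‿cong (Q-zero (-‿inverseʳ u))) -0≈0)) (+-identityʳ 0#))

        line-equation : ∀ {l₀ l₁ l₂ x y} → ¬ l₁ ≈ 0# → l₀ * x₀ + l₁ * y₀ + l₂ ≈ 0# → l₀ * x + l₁ * y + l₂ ≈ 0# →
          ∀ {m} → l₁ * m ≈ - l₀ → y ≈ y₀ + m * (x - x₀)
        line-equation {l₀} {l₁} {l₂} {x} {y} l₁≉0 eq₀ eq {m} lm = difference-zero (*-zero⇒ʳ l₁≉0 (begin
          l₁ * (y - (y₀ + m * (x - x₀)))
            ≈⟨ solve 8 (λ l₀ l₁ l₂ x y x₀ y₀ m → l₁ :* (y :- (y₀ :+ m :* (x :- x₀)))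
                 := (l₀ :* x :+ l₁ :* y :+ l₂) :- (l₀ :* x₀ :+ l₁ :* y₀ :+ l₂) :+ :- (x :- x₀) :* (l₁ :* m :- :- l₀)) refl l₀ l₁ l₂ x y x₀ y₀ m ⟩
          (l₀ * x + l₁ * y + l₂) - (l₀ * x₀ + l₁ * y₀ + l₂) + - (x - x₀) * (l₁ * m - - l₀)
            ≈⟨ zero-difference (trans eq (sym eq₀)) ⊕ scale _ (zero-difference lm) ⟩
          0# ∎))

        line-equation⁻ : ∀ {l₀ l₁ l₂} → l₀ * x₀ + l₁ * y₀ + l₂ ≈ 0# → ∀ {m} → l₁ * m ≈ - l₀ →
          ∀ v → l₀ * (x₀ + v) + l₁ * (y₀ + m * v) + l₂ ≈ 0#
        line-equation⁻ {l₀} {l₁} {l₂} eq₀ {m} lm v = begin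
          l₀ * (x₀ + v) + l₁ * (y₀ + m * v) + l₂
            ≈⟨ solve 7 (λ l₀ l₁ l₂ x₀ y₀ m v → l₀ :* (x₀ :+ v) :+ l₁ :* (y₀ :+ m :* v) :+ l₂
                 := (l₀ :* x₀ :+ l₁ :* y₀ :+ l₂) :+ v :* (l₁ :* m :- :- l₀)) refl l₀ l₁ l₂ x₀ y₀ m v ⟩
          (l₀ * x₀ + l₁ * y₀ + l₂) + v * (l₁ * m - - l₀)
            ≈⟨ eq₀ ⊕ scale v (zero-difference lm) ⟩
          0# ∎

      P₂ : Point
      P₂ = (0# ∷ᵥ 1# ∷ᵥ 0# ∷ᵥ []ᵥ) , λ eq → 1≉0 (eq 1F)

      P₂∈𝒰 : P₂ ∈ 𝒰 α β
      P₂∈𝒰 = inj₂ ∼-refl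

      dot-P₂ : ∀ l → dot l (coords P₂) ≈ l 1F
      dot-P₂ l = solve 3 (λ l₀ l₁ l₂ → l₀ :* con 0ℤ :+ (l₁ :* con 1ℤ :+ (l₂ :* con 0ℤ :+ con 0ℤ)) := l₁) refl (l 0F) (l 1F) (l 2F)

      h-vertical : ∃ λ y → h x₀ y ≈ 0#
      h-vertical = _ , unital⇒h x₀ 0# 0-closed

      -- The vertical line through P meets the unital at infinity in `P₂` and also in the affine
      -- point supplied by `h-vertical`.
      tangent-not-vertical : ∀ ℓ → ℓ ∈ Tangent (𝒰 α β) → P on ℓ → ¬ coeffs ℓ 1F ≈ 0#
      tangent-not-vertical ℓ tangent P-on l₁≈0 = 1≉0 (trans (1∼0 2F) (zeroʳ _))
        where
        y : Carrier
        y = proj₁ h-vertical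
        R : Point
        R = affinePoint x₀ y
        R-on : R on ℓ
        R-on = on-affine⁺ {R} {ℓ} ∼-refl (begin
          coeffs ℓ 0F * x₀ + coeffs ℓ 1F * y + coeffs ℓ 2F
            ≈⟨ solve 6 (λ l₀ l₁ l₂ x y y₀ → l₀ :* x :+ l₁ :* y :+ l₂ := (l₀ :* x :+ l₁ :* y₀ :+ l₂) :+ (y :- y₀) :* l₁) refl
                 (coeffs ℓ 0F) (coeffs ℓ 1F) (coeffs ℓ 2F) x₀ y y₀ ⟩
          (coeffs ℓ 0F * x₀ + coeffs ℓ 1F * y₀ + coeffs ℓ 2F) + (y - y₀) * coeffs ℓ 1F
            ≈⟨ on-affine⁻ {P} {ℓ} P∼ P-on ⊕ scale _ l₁≈0 ⟩
          0# ∎)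
        R∼P₂ : coords R ∼ coords P₂
        R∼P₂ = size-1-unique tangent {R} {P₂} (unital-affine⁺ {R} ∼-refl (proj₂ h-vertical) , R-on) (P₂∈𝒰 , trans (dot-P₂ (coeffs ℓ)) l₁≈0)
        1∼0 : ∀ i → coords R i ≈ proj₁ R∼P₂ * coords P₂ i
        1∼0 = proj₂ (proj₂ R∼P₂)

      -- The points of the unital on the line of slope slope u + A through P are symmetric about the abscissa x₀ + u, so a
      -- tangent touches there.
      pedal⁻ : ∀ {R} → R ∈ pedal (𝒰 α β) P → ∃ λ u → Foot u × coords R ∼ foot u
      pedal⁻ {R} (ℓ , tangent , P-on , inj₂ R∼∞ , R-on) =
        contradiction (trans (sym (dot-P₂ (coeffs ℓ))) (dot-∼ {coeffs ℓ} (∼-sym R∼∞) R-on)) (tangent-not-vertical ℓ tangent P-on)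
      pedal⁻ {R} (ℓ , tangent , P-on , R∈𝒰@(inj₁ (x , r , r∈K , R∼)) , R-on) = v , foot-v , ∼-trans R∼ (affine-cong x≈ y≈foot)
        where
        l₁≉0 : ¬ coeffs ℓ 1F ≈ 0#
        l₁≉0 = tangent-not-vertical ℓ tangent P-on
        y m v u v′ : Carrier
        y = α * x ^ 2 + β * x ^ (q ℕ.+ 1) + r
        m = inv l₁≉0 * - coeffs ℓ 0F
        v = x - x₀
        u = proj₁ (slope-surjective (m - A))
        v′ = u + (u - v)
        lm : coeffs ℓ 1F * m ≈ - coeffs ℓ 0F
        lm = trans (sym (*-assoc _ _ _)) (trans (*-congʳ (trans (*-comm _ _) (inv-* l₁≉0))) (*-identityˡ _))
        su+A≈m : slope u + A ≈ m
        su+A≈m = trans (+-congʳ (proj₂ (slope-surjective (m - A)))) (solve 2 (λ m a → m :- a :+ a := m) refl m A)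
        eq₀ : coeffs ℓ 0F * x₀ + coeffs ℓ 1F * y₀ + coeffs ℓ 2F ≈ 0#
        eq₀ = on-affine⁻ {P} {ℓ} P∼ P-on
        x≈ : x ≈ x₀ + v
        x≈ = solve 2 (λ x x₀ → x := x₀ :+ (x :- x₀)) refl x x₀
        y≈ : y ≈ y₀ + (slope u + A) * v
        y≈ = trans (line-equation l₁≉0 eq₀ (on-affine⁻ {R} {ℓ} R∼ R-on) lm) (+-congˡ (*-congʳ (sym su+A≈m)))
        h-v : c + Q u - Q (v - u) ≈ 0#
        h-v = trans (sym (h-line u v)) (trans (sym (h-cong x≈ y≈)) (unital-affine⁻ {R} R∼ R∈𝒰))
        R′ : Point
        R′ = affinePoint (x₀ + v′) (y₀ + (slope u + A) * v′)
        R′∈ : R′ ∈ (𝒰 α β ∩ (_on ℓ))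
        R′∈ = unital-affine⁺ {R′} ∼-refl (trans (h-line u v′) (trans (+-congˡ (-‿cong (trans
                (Q-cong (solve 2 (λ u v → u :+ (u :- v) :- u := :- (v :- u)) refl u v)) (Q-neg (v - u))))) h-v)) ,
              on-affine⁺ {R′} {ℓ} ∼-refl (trans (+-congʳ (+-congˡ (*-congˡ (+-congˡ (*-congʳ su+A≈m))))) (line-equation⁻ eq₀ lm v′))
        x-v′ : x ≈ x₀ + v′
        x-v′ = proj₁ (affine-∼ (∼-trans (∼-sym R∼) (size-1-unique tangent {R} {R′} (R∈𝒰 , R-on) R′∈)))
        u≈v : u ≈ v
        u≈v = difference-zero (*-zero⇒ʳ 2≉0 (trans (solve 4 (λ u v x x₀ → con (+ 2) :* (u :- v) := (x₀ :+ (u :+ (u :- v))) :- (x₀ :+ v)) refl u v x x₀)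
          (zero-difference (trans (sym x-v′) x≈))))
        foot-v : Foot v
        foot-v = trans (solve 3 (λ c q q′ → c :+ q := (c :+ q :- q′) :+ q′) refl c (Q v) (Q (v - u)))
          (trans (+-cong (trans (+-congʳ (+-congˡ (Q-cong (sym u≈v)))) h-v) (Q-zero (zero-difference (sym u≈v)))) (+-identityʳ 0#))
        y≈foot : y ≈ foot-y v
        y≈foot = trans y≈ (+-congˡ (*-congʳ (+-congʳ (slope-cong u≈v))))

      -- By `h-line`, a point of the unital on the line of slope `slope u + A` through P satisfies
      -- Q(v - u) = 0, and anisotropy leaves only v = u.
      pedal⁺ : ∀ {R u} → Foot u → coords R ∼ foot u → R ∈ pedal (𝒰 α β) P
      pedal⁺ {R} {u} foot-u R∼ = ℓ , tangent , P-on , unital-affine⁺ {R} R∼ (Foot⇒h foot-u) , on-ℓ R R∼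
        where
        m : Carrier
        m = slope u + A
        ℓ : Line
        ℓ = (m ∷ᵥ - 1# ∷ᵥ (y₀ - m * x₀) ∷ᵥ []ᵥ) , λ eq → 1≉0 (-‿zero (eq 1F))
          where
          -‿zero : - 1# ≈ 0# → 1# ≈ 0#
          -‿zero eq = trans (solve 0 (con 1ℤ := :- (:- con 1ℤ)) refl) (trans (-‿cong eq) -0≈0)
        -1≉0 : ¬ - 1# ≈ 0#
        -1≉0 eq = 1≉0 (trans (solve 0 (con 1ℤ := :- (:- con 1ℤ)) refl) (trans (-‿cong eq) -0≈0))
        lm : - 1# * m ≈ - m
        lm = solve 1 (λ m → :- con 1ℤ :* m := :- m) refl m
        eq₀ : m * x₀ + - 1# * y₀ + (y₀ - m * x₀) ≈ 0#
        eq₀ = solve 3 (λ m x y → m :* x :+ :- con 1ℤ :* y :+ (y :- m :* x) := con 0ℤ) refl m x₀ y₀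
        P-on : P on ℓ
        P-on = on-affine⁺ {P} {ℓ} P∼ eq₀
        on-ℓ : ∀ R → coords R ∼ foot u → R on ℓ
        on-ℓ R R∼ = on-affine⁺ {R} {ℓ} R∼ (line-equation⁻ eq₀ lm u)
        unique : ∀ R′ → R′ ∈ (𝒰 α β ∩ (_on ℓ)) → footPoint u ∼′ R′
        unique R′ (inj₂ R′∼∞ , R′-on) = contradiction (trans (sym (dot-P₂ (coeffs ℓ))) (dot-∼ {coeffs ℓ} (∼-sym R′∼∞) R′-on)) -1≉0
        unique R′ (R′∈𝒰@(inj₁ (x , r , r∈K , R′∼)) , R′-on) = ∼-sym (∼-trans R′∼ (affine-cong x≈ y≈))
          where
          y v : Carrier
          y = α * x ^ 2 + β * x ^ (q ℕ.+ 1) + r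
          v = x - x₀
          x≈x₀+v : x ≈ x₀ + v
          x≈x₀+v = solve 2 (λ x x₀ → x := x₀ :+ (x :- x₀)) refl x x₀
          y≈y₀+mv : y ≈ y₀ + m * v
          y≈y₀+mv = line-equation -1≉0 eq₀ (on-affine⁻ {R′} {ℓ} R′∼ R′-on) lm
          v≈u : v ≈ u
          v≈u = difference-zero (Q-anisotropic (begin
            Q (v - u)                    ≈⟨ solve 2 (λ t q → q := t :- (t :- q)) refl (c + Q u) (Q (v - u)) ⟩
            c + Q u - (c + Q u - Q (v - u)) ≈⟨ +-cong foot-u (-‿cong (trans (sym (h-line u v)) (trans (sym (h-cong x≈x₀+v y≈y₀+mv)) (unital-affine⁻ {R′} R′∼ R′∈𝒰)))) ⟩
            0# - 0#                      ≈⟨ -‿inverseʳ 0# ⟩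
            0# ∎))
          x≈ : x ≈ x₀ + u
          x≈ = trans x≈x₀+v (+-congˡ v≈u)
          y≈ : y ≈ foot-y u
          y≈ = trans y≈y₀+mv (+-congˡ (*-congˡ v≈u))
        tangent : ℓ ∈ Tangent (𝒰 α β)
        tangent = hasSize Points (λ _ → footPoint u)
          (λ _ → unital-affine⁺ {footPoint u} ∼-refl (Foot⇒h foot-u) , on-ℓ (footPoint u) ∼-refl)
          (λ {i} {j} _ → Fin1-unique i j) (λ R′ R′∈ → 0F , unique R′ R′∈)

      -- Feet with different parameters have different abscissas, so intersections with the pedal
      -- may be counted in the parameter `u`.
      pedal-size : ∀ ℓ {n} → HasSize setoid (λ u → Foot u × dot (coeffs ℓ) (foot u) ≈ 0#) n → ℓ ∈ MeetsIn (pedal (𝒰 α β) P) n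
      pedal-size ℓ size = hasSize Points (footPoint ∘ E.element)
        (λ i → pedal⁺ {footPoint (E.element i)} (proj₁ (E.element-∈ i)) ∼-refl , proj₂ (E.element-∈ i))
        (λ eq → E.element-injective (+-cancelˡ x₀ _ _ (proj₁ (affine-∼ eq))))
        surjective
        where
        module E = Enumeration setoid size
        surjective : ∀ R → R ∈ (pedal (𝒰 α β) P ∩ (_on ℓ)) → ∃ λ i → footPoint (E.element i) ∼′ R
        surjective R (R∈pedal , R-on) with pedal⁻ {R} R∈pedal
        ... | u , foot-u , R∼ = E.index u∈ , ∼-trans (affine-cong (+-congˡ u≈) (+-congˡ (*-cong (+-congʳ (slope-cong u≈)) u≈))) (∼-sym R∼)
          where
          u∈ : Foot u × dot (coeffs ℓ) (foot u) ≈ 0#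
          u∈ = foot-u , dot-∼ {coeffs ℓ} (∼-sym R∼) R-on
          u≈ : E.element (E.index u∈) ≈ u
          u≈ = E.element-index u∈

      -- Feet on a line

      vertex : Point
      vertex = (1# ∷ᵥ A ∷ᵥ 0# ∷ᵥ []ᵥ) , λ eq → 1≉0 (eq 0F)

      -- The value of the line at the vertex, by `dot-vertex`, and at the same time the coefficient
      -- of `u` in its equation on the feet, by `dot-foot`. Its vanishing separates the two kinds of
      -- lines.
      direction-of : Line → Carrier
      direction-of ℓ = coeffs ℓ 0F + coeffs ℓ 1F * A

      dot-vertex : ∀ ℓ → dot (coeffs ℓ) (coords vertex) ≈ direction-of ℓ
      dot-vertex ℓ = solve 4 (λ l₀ l₁ l₂ A → l₀ :* con 1ℤ :+ (l₁ :* A :+ (l₂ :* con 0ℤ :+ con 0ℤ)) := l₀ :+ l₁ :* A) refl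
        (coeffs ℓ 0F) (coeffs ℓ 1F) (coeffs ℓ 2F) A

      FootOn : Line → Pred Carrier b
      FootOn ℓ u = Foot u × dot (coeffs ℓ) (foot u) ≈ 0#

      constant : Line → Carrier
      constant ℓ = coeffs ℓ 0F * x₀ + coeffs ℓ 1F * y₀ + coeffs ℓ 2F

      dot-foot : ∀ ℓ u → dot (coeffs ℓ) (foot u) ≈ direction-of ℓ * u + coeffs ℓ 1F * W u + constant ℓ
      dot-foot ℓ u = trans (dot-affine (coeffs ℓ) (x₀ + u) (foot-y u))
        (solve 8 (λ l₀ l₁ l₂ x₀ y₀ u s A → l₀ :* (x₀ :+ u) :+ l₁ :* (y₀ :+ (s :+ A) :* u) :+ l₂
          := (l₀ :+ l₁ :* A) :* u :+ l₁ :* (s :* u) :+ (l₀ :* x₀ :+ l₁ :* y₀ :+ l₂)) refl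
          (coeffs ℓ 0F) (coeffs ℓ 1F) (coeffs ℓ 2F) x₀ y₀ u (slope u) A)

      FootOn-equation : ∀ ℓ {u} → FootOn ℓ u → direction-of ℓ * u + coeffs ℓ 1F * W u + constant ℓ ≈ 0#
      FootOn-equation ℓ {u} (_ , eq) = trans (sym (dot-foot ℓ u)) eq

      Foot-cong : ∀ {u v} → u ≈ v → Foot u → Foot v
      Foot-cong u≈v foot-u = trans (+-congˡ (Q-cong (sym u≈v))) foot-u

      FootOn-cong : ∀ ℓ {u v} → u ≈ v → FootOn ℓ u → FootOn ℓ v
      FootOn-cong ℓ {u} {v} u≈v (foot-u , eq) = Foot-cong u≈v foot-u ,
        trans (dot-foot ℓ v) (trans (+-congʳ (+-cong (*-congˡ (sym u≈v)) (*-congˡ (W-cong (sym u≈v))))) (trans (sym (dot-foot ℓ u)) eq))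

      FootOn? : ∀ ℓ u → Dec (FootOn ℓ u)
      FootOn? ℓ u = (c + Q u ≟ 0#) ×-dec (dot (coeffs ℓ) (foot u) ≟ 0#)

      Foot⇒Q≈ : ∀ {u v} → Foot u → Foot v → Q u ≈ Q v
      Foot⇒Q≈ foot-u foot-v = +-cancelˡ c _ _ (trans foot-u (sym foot-v))

      Foot⇒Q≉0 : ∀ {u} → Foot u → ¬ Q u ≈ 0#
      Foot⇒Q≉0 foot-u Qu≈0 = c≉0 (trans (sym (+-identityʳ c)) (trans (+-congˡ (sym Qu≈0)) foot-u))

      Foot⇒≉0 : ∀ {u} → Foot u → ¬ u ≈ 0#
      Foot⇒≉0 foot-u = Foot⇒Q≉0 foot-u ∘ Q-zero

      W≈⇒Foot : ∀ {u v} → W u ≈ W v → Foot u → Foot v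
      W≈⇒Foot Wu≈Wv foot-u = trans (+-congˡ (sym (W≈⇒Q≈ Wu≈Wv))) foot-u

      -- On a line not through the vertex the feet are u + τ r with r ∈ K, and the anisotropic form Q takes each value
      -- at most twice on such a K-line.
      module _ (ℓ : Line) (transversal : ¬ direction-of ℓ ≈ 0#) where

        τ : Carrier
        τ = inv transversal * coeffs ℓ 1F

        FootOn-chord : ∀ {u v} → FootOn ℓ u → FootOn ℓ v → v ≈ u + τ * (W u - W v)
        FootOn-chord {u} {v} on-u on-v = difference-zero (*-zero⇒ʳ transversal (begin
          direction-of ℓ * (v - (u + τ * (W u - W v)))
            ≈⟨ solve 8 (λ d l g t u v w w′ → d :* (v :- (u :+ t :* (w :- w′)))
                 := (d :* v :+ l :* w′ :+ g) :- (d :* u :+ l :* w :+ g) :+ (w :- w′) :* (l :- d :* t)) refl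
                 (direction-of ℓ) (coeffs ℓ 1F) (constant ℓ) τ u v (W u) (W v) ⟩
          (direction-of ℓ * v + coeffs ℓ 1F * W v + constant ℓ) - (direction-of ℓ * u + coeffs ℓ 1F * W u + constant ℓ)
            + (W u - W v) * (coeffs ℓ 1F - direction-of ℓ * τ)
            ≈⟨ zero-difference (trans (FootOn-equation ℓ on-v) (sym (FootOn-equation ℓ on-u)))
               ⊕ scale _ (zero-difference (sym (trans (sym (*-assoc _ _ _)) (trans (*-congʳ (trans (*-comm _ _) (inv-* transversal))) (*-identityˡ _))))) ⟩
          0# ∎))

        -- W - conj W is 2Q, which is constant on the feet and drops out of differences.
        W-difference-fixed : ∀ {u v} → Foot u → Foot v → conj (W u - W v) ≈ W u - W v
        W-difference-fixed {u} {v} foot-u foot-v = trans (refl +ᶜ conj-neg (W v)) (difference-zero (begin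
          conj (W u) - conj (W v) - (W u - W v)
            ≈⟨ solve 4 (λ w w̄ x x̄ → w̄ :- x̄ :- (w :- x) := (x :- x̄) :- (w :- w̄)) refl (W u) (conj (W u)) (W v) (conj (W v)) ⟩
          I (W v) - I (W u)
            ≈⟨ zero-difference (trans (W-conj v) (trans (*-congˡ (Foot⇒Q≈ foot-v foot-u)) (sym (W-conj u)))) ⟩
          0# ∎))

        collinear-feet : ∀ {u v w} → FootOn ℓ u → FootOn ℓ v → FootOn ℓ w → ¬ u ≈ v → ¬ u ≈ w → ¬ v ≈ w → ⊥
        collinear-feet {u} {v} {w} on-u on-v on-w u≉v u≉w v≉w = u≉v (sym (v≈u _ (FootOn-chord on-u on-v) (*-congʳ τ≈0)))
          where
          v≈u : ∀ {v} r → v ≈ u + τ * r → τ * r ≈ 0# * r → v ≈ u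
          v≈u r eq τr≈0 = trans eq (trans (+-congˡ (trans τr≈0 (zeroˡ r))) (+-identityʳ u))
          Q-chord : ∀ {v} → FootOn ℓ v → Q (u + τ * (W u - W v)) ≈ Q u
          Q-chord on-v = trans (Q-cong (sym (FootOn-chord on-u on-v))) (Foot⇒Q≈ (proj₁ on-v) (proj₁ on-u))
          r≉0 : ∀ {v} → FootOn ℓ v → ¬ u ≈ v → ¬ W u - W v ≈ 0#
          r≉0 on-v u≉v r≈0 = u≉v (sym (v≈u _ (FootOn-chord on-u on-v) (trans (*-congˡ r≈0) (trans (zeroʳ τ) (sym (trans (*-congˡ r≈0) (zeroʳ 0#)))))))
          τ≈0 : τ ≈ 0#
          τ≈0 = two-on-chord (W-difference-fixed (proj₁ on-u) (proj₁ on-v)) (W-difference-fixed (proj₁ on-u) (proj₁ on-w))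
            (r≉0 on-v u≉v) (r≉0 on-w u≉w)
            (λ r≈r′ → v≉w (trans (FootOn-chord on-u on-v) (trans (+-congˡ (*-congˡ r≈r′)) (sym (FootOn-chord on-u on-w)))))
            u τ (Q-chord on-v) (Q-chord on-w)

      search : ∀ {s} {T : Pred Carrier s} → Decidable T → (∀ {u v} → u ≈ v → T u → T v) → (∃ λ u → T u) ⊎ (∀ u → ¬ T u)
      search {T = T} T? T-cong = decide (Finₚ.any? (T? ∘ 𝔽.element))
        where
        module 𝔽 = Enumeration setoid sizeF
        decide : Dec (∃ λ i → T (𝔽.element i)) → (∃ λ u → T u) ⊎ (∀ u → ¬ T u)
        decide (yes (i , Ti)) = inj₁ (𝔽.element i , Ti)
        decide (no none)      = inj₂ λ u Tu → none (𝔽.index {u} _ , T-cong (sym (𝔽.element-index {u} _)) Tu)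

      size-0 : ∀ {s} {T : Pred Carrier s} → (∀ u → ¬ T u) → HasSize setoid T 0
      size-0 none = hasSize setoid (λ ()) (λ ()) (λ { {()} }) (λ u Tu → contradiction Tu (none u))

      size-1 : ∀ {s} {T : Pred Carrier s} {u} → T u → (∀ v → T v → u ≈ v) → HasSize setoid T 1
      size-1 {u = u} Tu all = hasSize setoid (λ _ → u) (λ _ → Tu) (λ {i} {j} _ → Fin1-unique i j) (λ v Tv → 0F , all v Tv)

      size-2 : ∀ {s} {T : Pred Carrier s} {u v} → T u → T v → ¬ u ≈ v → (∀ w → T w → u ≈ w ⊎ v ≈ w) → HasSize setoid T 2
      size-2 {T = T} {u} {v} Tu Tv u≉v all = hasSize setoid f (λ { 0F → Tu ; 1F → Tv }) (distinct₂ f u≉v)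
        (λ w Tw → Sum.[ (λ eq → 0F , eq) , (λ eq → 1F , eq) ]′ (all w Tw))
        where
        f : Fin 2 → Carrier
        f 0F = u
        f 1F = v

      size-2-chord : ∀ ℓ → ¬ direction-of ℓ ≈ 0# → ∀ {u v} → FootOn ℓ u → FootOn ℓ v → ¬ u ≈ v → HasSize setoid (FootOn ℓ) 2
      size-2-chord ℓ transversal {u} {v} on-u on-v u≉v = size-2 on-u on-v u≉v λ w on-w → decide w on-w (u ≟ w) (v ≟ w)
        where
        decide : ∀ w → FootOn ℓ w → Dec (u ≈ w) → Dec (v ≈ w) → u ≈ w ⊎ v ≈ w
        decide w on-w (yes u≈w) _         = inj₁ u≈w
        decide w on-w (no _)    (yes v≈w) = inj₂ v≈w
        decide w on-w (no u≉w)  (no v≉w)  = contradiction v≉w (λ v≉w → collinear-feet ℓ transversal on-u on-v on-w u≉v u≉w v≉w)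

      transversal-size : ∀ ℓ → ¬ direction-of ℓ ≈ 0# →
        HasSize setoid (FootOn ℓ) 0 ⊎ HasSize setoid (FootOn ℓ) 1 ⊎ HasSize setoid (FootOn ℓ) 2
      transversal-size ℓ transversal = first (search (FootOn? ℓ) (FootOn-cong ℓ))
        where
        Other : Carrier → Pred Carrier b
        Other u v = FootOn ℓ v × ¬ u ≈ v
        second : ∀ {u} → FootOn ℓ u → (∃ λ v → Other u v) ⊎ (∀ v → ¬ Other u v) →
          HasSize setoid (FootOn ℓ) 0 ⊎ HasSize setoid (FootOn ℓ) 1 ⊎ HasSize setoid (FootOn ℓ) 2
        second on-u (inj₁ (v , on-v , u≉v)) = inj₂ (inj₂ (size-2-chord ℓ transversal on-u on-v u≉v))
        second {u} on-u (inj₂ none) = inj₂ (inj₁ (size-1 on-u (λ v on-v → decidable-stable (u ≟ v) (λ u≉v → none v (on-v , u≉v)))))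
        first : (∃ λ u → FootOn ℓ u) ⊎ (∀ u → ¬ FootOn ℓ u) →
          HasSize setoid (FootOn ℓ) 0 ⊎ HasSize setoid (FootOn ℓ) 1 ⊎ HasSize setoid (FootOn ℓ) 2
        first (inj₂ none) = inj₁ (size-0 none)
        first (inj₁ (u , on-u)) = second on-u (search (λ v → FootOn? ℓ v ×-dec ¬? (u ≟ v))
          (λ v≈w (on-v , u≉v) → FootOn-cong ℓ v≈w on-v , λ u≈w → u≉v (trans u≈w (sym v≈w))))

      -- The term linear in `u` is gone from the equation of the line on the feet, which thus
      -- prescribes `W`. Conversely, a point with the `W`-value of a foot is a foot, since `W`
      -- determines `Q`.
      vertex-line : ∀ ℓ → direction-of ℓ ≈ 0# → HasSize setoid (FootOn ℓ) 0 ⊎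
        (∃ λ u → Foot u × (∀ {v} → FootOn ℓ v → W u ≈ W v) × (∀ {v} → W u ≈ W v → FootOn ℓ v))
      vertex-line ℓ through = decide (coeffs ℓ 1F ≟ 0#) (search (FootOn? ℓ) (FootOn-cong ℓ))
        where
        decide : Dec (coeffs ℓ 1F ≈ 0#) → (∃ λ u → FootOn ℓ u) ⊎ (∀ u → ¬ FootOn ℓ u) → _
        decide _ (inj₂ none) = inj₁ (size-0 none)
        decide (no l₁≉0) (inj₁ (u , on-u)) = inj₂ (u , proj₁ on-u ,
            (λ {v} on-v → *-cancelˡ l₁≉0 (difference-zero (begin
              coeffs ℓ 1F * W u - coeffs ℓ 1F * W v
                ≈⟨ solve 7 (λ l w w′ d u v g → l :* w :- l :* w′ := (d :* u :+ l :* w :+ g) :- (d :* v :+ l :* w′ :+ g) :+ (v :- u) :* d) refl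
                     (coeffs ℓ 1F) (W u) (W v) (direction-of ℓ) u v (constant ℓ) ⟩
              (direction-of ℓ * u + coeffs ℓ 1F * W u + constant ℓ) - (direction-of ℓ * v + coeffs ℓ 1F * W v + constant ℓ) + (v - u) * direction-of ℓ
                ≈⟨ zero-difference (trans (FootOn-equation ℓ on-u) (sym (FootOn-equation ℓ on-v))) ⊕ scale _ through ⟩
              0# ∎))) ,
            λ {v} Wu≈Wv → W≈⇒Foot Wu≈Wv (proj₁ on-u) , (begin
              dot (coeffs ℓ) (foot v)
                ≈⟨ dot-foot ℓ v ⟩
              direction-of ℓ * v + coeffs ℓ 1F * W v + constant ℓ
                ≈⟨ solve 7 (λ l w w′ d u v g → d :* v :+ l :* w′ :+ g := (d :* u :+ l :* w :+ g) :+ (v :- u) :* d :+ l :* (w′ :- w)) refl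
                     (coeffs ℓ 1F) (W u) (W v) (direction-of ℓ) u v (constant ℓ) ⟩
              (direction-of ℓ * u + coeffs ℓ 1F * W u + constant ℓ) + (v - u) * direction-of ℓ + coeffs ℓ 1F * (W v - W u)
                ≈⟨ (FootOn-equation ℓ on-u ⊕ scale _ through) ⊕ scale _ (zero-difference (sym Wu≈Wv)) ⟩
              0# ∎))
        -- A line through the vertex with second coefficient 0 also has first coefficient 0; the
        -- affine foot on it then kills the third, so all coefficients vanish.
        decide (yes l₁≈0) (inj₁ (u , on-u)) = contradiction (λ { 0F → l₀≈0 ; 1F → l₁≈0 ; 2F → l₂≈0 }) (proj₂ ℓ)
          where
          l₀≈0 : coeffs ℓ 0F ≈ 0#
          l₀≈0 = trans (solve 3 (λ l₀ l₁ A → l₀ := (l₀ :+ l₁ :* A) :+ (:- A) :* l₁) refl (coeffs ℓ 0F) (coeffs ℓ 1F) A) (through ⊕ scale _ l₁≈0)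
          l₂≈0 : coeffs ℓ 2F ≈ 0#
          l₂≈0 = trans (trans (solve 5 (λ l₀ l₁ l₂ x y → l₂ := (l₀ :* x :+ l₁ :* y :+ l₂) :+ (:- x :* l₀ :+ :- y :* l₁)) refl
              (coeffs ℓ 0F) (coeffs ℓ 1F) (coeffs ℓ 2F) (x₀ + u) (foot-y u)) (+-congʳ (sym (dot-affine (coeffs ℓ) _ _))))
            (proj₂ on-u ⊕ (scale _ l₀≈0 ⊕ scale _ l₁≈0))

      arc-size : (∀ y → ¬ y * y ≈ α) → ∀ ℓ →
        HasSize setoid (FootOn ℓ) 0 ⊎ HasSize setoid (FootOn ℓ) 1 ⊎ HasSize setoid (FootOn ℓ) 2
      arc-size α-nonsquare ℓ = decide (direction-of ℓ ≟ 0#)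
        where
        decide : Dec (direction-of ℓ ≈ 0#) → HasSize setoid (FootOn ℓ) 0 ⊎ HasSize setoid (FootOn ℓ) 1 ⊎ HasSize setoid (FootOn ℓ) 2
        decide (no transversal) = transversal-size ℓ transversal
        decide (yes through)    = Sum.map₂ (λ (u , foot-u , on⇒W≈ , W≈⇒on) → inj₂ (size-2 (W≈⇒on refl) (W≈⇒on (sym (W-neg u)))
          (Foot⇒≉0 foot-u ∘ x≈-x⇒x≈0)
          (λ w on-w → Sum.map sym sym (nonsquare-equal-W α-nonsquare (Foot⇒Q≉0 foot-u) (on⇒W≈ on-w))))) (vertex-line ℓ through)

      -- The Baer pencil

      -- A line of slope `A`, hence through the vertex. The constant is normalised so that its feet
      -- are exactly those with `W u ≈ t`.
      horizontal : Carrier → Line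
      horizontal t = (- A ∷ᵥ 1# ∷ᵥ (A * x₀ - y₀ - t) ∷ᵥ []ᵥ) , λ eq → 1≉0 (eq 1F)

      horizontal-direction : ∀ t → direction-of (horizontal t) ≈ 0#
      horizontal-direction t = solve 1 (λ A → :- A :+ con 1ℤ :* A := con 0ℤ) refl A

      dot-horizontal : ∀ t u → dot (coeffs (horizontal t)) (foot u) ≈ W u - t
      dot-horizontal t u = trans (dot-foot (horizontal t) u)
        (solve 6 (λ A x y t u w → (:- A :+ con 1ℤ :* A) :* u :+ con 1ℤ :* w :+ (:- A :* x :+ con 1ℤ :* y :+ (A :* x :- y :- t)) := w :- t) refl A x₀ y₀ t u (W u))

      horizontal-injective : ∀ {t t′} → coeffs (horizontal t) ∼ coeffs (horizontal t′) → t ≈ t′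
      horizontal-injective {t} {t′} (k , _ , eq) = difference-zero (begin
        t - t′
          ≈⟨ solve 4 (λ k m t t′ → t :- t′ := k :* (m :- t′) :- (m :- t) :+ (m :- t′) :* (con 1ℤ :- k :* con 1ℤ)) refl k (A * x₀ - y₀) t t′ ⟩
        k * (A * x₀ - y₀ - t′) - (A * x₀ - y₀ - t) + (A * x₀ - y₀ - t′) * (1# - k * 1#)
          ≈⟨ zero-difference (sym (eq 2F)) ⊕ scale _ (zero-difference (eq 1F)) ⟩
        0# ∎)

      conj-c : conj c ≈ - c
      conj-c = trans (refl +ᶜ -ᶜ conj-involutive y₀ +ᶜ -ᶜ (refl *ᶜ (refl *ᶜ refl)
          +ᶜ -ᶜ (conj-involutive α *ᶜ (conj-involutive x₀ *ᶜ conj-involutive x₀)) +ᶜ conj-δ *ᶜ (refl *ᶜ conj-involutive x₀)))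
        (solve 7 (λ α α′ δ x x′ y y′ → y′ :- y :- (α′ :* (x′ :* x′) :- α :* (x :* x) :+ :- δ :* (x′ :* x))
          := :- (y :- y′ :- (α :* (x :* x) :- α′ :* (x′ :* x′) :+ δ :* (x :* x′)))) refl α (conj α) δ x₀ (conj x₀) y₀ (conj y₀))

      W+c∈K : ∀ {u} → Foot u → W u + c ∈ K
      W+c∈K {u} foot-u = fixed⇒∈ (difference-zero (begin
        conj (W u + c) - (W u + c)
          ≈⟨ +-congʳ (refl +ᶜ conj-c) ⟩
        conj (W u) - c - (W u + c)
          ≈⟨ solve 4 (λ w w̄ c q → w̄ :- c :- (w :+ c) := :- con (+ 2) :* (c :+ q) :+ :- con 1ℤ :* ((w :- w̄) :- con (+ 2) :* q)) refl (W u) (conj (W u)) c (Q u) ⟩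
        - two * (c + Q u) + - 1# * (I (W u) - two * Q u)
          ≈⟨ scale _ foot-u ⊕ scale _ (zero-difference (W-conj u)) ⟩
        0# ∎))

      -- The base lies on the vertical line through P: (s, t, 0) goes to (x₀s, (y₀ - c)s + t, s).
      -- The shift by `c` is needed because `W u + c`, and not `W u`, lies in `K`; with s = 1 and t
      -- = W(u) + c this is the point where `horizontal (W u)` meets the base line.
      base : Projectivity
      base = record { matrix = M ; inverse = M⁻¹ ; inverseˡ = M⁻¹M ; inverseʳ = MM⁻¹ }
        where
        dotₚ : ∀ {n} (l₀ l₁ l₂ v₀ v₁ v₂ : Polynomial n) → Polynomial n
        dotₚ l₀ l₁ l₂ v₀ v₁ v₂ = l₀ :* v₀ :+ (l₁ :* v₁ :+ (l₂ :* v₂ :+ con 0ℤ))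
        M M⁻¹ : Matrix
        M   = (x₀ ∷ᵥ 0# ∷ᵥ 1# ∷ᵥ []ᵥ) ∷ᵥ ((y₀ - c) ∷ᵥ 1# ∷ᵥ 0# ∷ᵥ []ᵥ) ∷ᵥ (1# ∷ᵥ 0# ∷ᵥ 0# ∷ᵥ []ᵥ) ∷ᵥ []ᵥ
        M⁻¹ = (0# ∷ᵥ 0# ∷ᵥ 1# ∷ᵥ []ᵥ) ∷ᵥ (0# ∷ᵥ 1# ∷ᵥ (- (y₀ - c)) ∷ᵥ []ᵥ) ∷ᵥ (1# ∷ᵥ 0# ∷ᵥ (- x₀) ∷ᵥ []ᵥ) ∷ᵥ []ᵥ
        M⁻¹M : ∀ v i → (M⁻¹ ⊙ M ⊙ v) i ≈ v i
        M⁻¹M v 0F = solve 5 (λ x y v₀ v₁ v₂ →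
          dotₚ (con 0ℤ) (con 0ℤ) (con 1ℤ)
            (dotₚ x (con 0ℤ) (con 1ℤ) v₀ v₁ v₂)
            (dotₚ y (con 1ℤ) (con 0ℤ) v₀ v₁ v₂)
            (dotₚ (con 1ℤ) (con 0ℤ) (con 0ℤ) v₀ v₁ v₂) := v₀)
          refl x₀ (y₀ - c) (v 0F) (v 1F) (v 2F)
        M⁻¹M v 1F = solve 5 (λ x y v₀ v₁ v₂ →
          dotₚ (con 0ℤ) (con 1ℤ) (:- y)
            (dotₚ x (con 0ℤ) (con 1ℤ) v₀ v₁ v₂)
            (dotₚ y (con 1ℤ) (con 0ℤ) v₀ v₁ v₂)
            (dotₚ (con 1ℤ) (con 0ℤ) (con 0ℤ) v₀ v₁ v₂) := v₁)
          refl x₀ (y₀ - c) (v 0F) (v 1F) (v 2F)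
        M⁻¹M v 2F = solve 5 (λ x y v₀ v₁ v₂ →
          dotₚ (con 1ℤ) (con 0ℤ) (:- x)
            (dotₚ x (con 0ℤ) (con 1ℤ) v₀ v₁ v₂)
            (dotₚ y (con 1ℤ) (con 0ℤ) v₀ v₁ v₂)
            (dotₚ (con 1ℤ) (con 0ℤ) (con 0ℤ) v₀ v₁ v₂) := v₂)
          refl x₀ (y₀ - c) (v 0F) (v 1F) (v 2F)
        MM⁻¹ : ∀ v i → (M ⊙ M⁻¹ ⊙ v) i ≈ v i
        MM⁻¹ v 0F = solve 5 (λ x y v₀ v₁ v₂ →
          dotₚ x (con 0ℤ) (con 1ℤ)
            (dotₚ (con 0ℤ) (con 0ℤ) (con 1ℤ) v₀ v₁ v₂)
            (dotₚ (con 0ℤ) (con 1ℤ) (:- y) v₀ v₁ v₂)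
            (dotₚ (con 1ℤ) (con 0ℤ) (:- x) v₀ v₁ v₂) := v₀)
          refl x₀ (y₀ - c) (v 0F) (v 1F) (v 2F)
        MM⁻¹ v 1F = solve 5 (λ x y v₀ v₁ v₂ →
          dotₚ y (con 1ℤ) (con 0ℤ)
            (dotₚ (con 0ℤ) (con 0ℤ) (con 1ℤ) v₀ v₁ v₂)
            (dotₚ (con 0ℤ) (con 1ℤ) (:- y) v₀ v₁ v₂)
            (dotₚ (con 1ℤ) (con 0ℤ) (:- x) v₀ v₁ v₂) := v₁)
          refl x₀ (y₀ - c) (v 0F) (v 1F) (v 2F)
        MM⁻¹ v 2F = solve 5 (λ x y v₀ v₁ v₂ →
          dotₚ (con 1ℤ) (con 0ℤ) (con 0ℤ)
            (dotₚ (con 0ℤ) (con 0ℤ) (con 1ℤ) v₀ v₁ v₂)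
            (dotₚ (con 0ℤ) (con 1ℤ) (:- y) v₀ v₁ v₂)
            (dotₚ (con 1ℤ) (con 0ℤ) (:- x) v₀ v₁ v₂) := v₂)
          refl x₀ (y₀ - c) (v 0F) (v 1F) (v 2F)

      pencil : BaerPencil
      pencil = record
        { vertex          = vertex
        ; φ               = base
        ; baseLine        = (1# ∷ᵥ 0# ∷ᵥ (- x₀) ∷ᵥ []ᵥ) , λ eq → 1≉0 (eq 0F)
        ; base⊆baseLine   = λ { {R} (s , t , _ , _ , _ , R∼) → dot-∼ {1# ∷ᵥ 0# ∷ᵥ (- x₀) ∷ᵥ []ᵥ} R∼
            (solve 4 (λ x y s t → con 1ℤ :* (x :* s :+ (con 0ℤ :* t :+ (con 1ℤ :* con 0ℤ :+ con 0ℤ)))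
              :+ (con 0ℤ :* (y :* s :+ (con 1ℤ :* t :+ (con 0ℤ :* con 0ℤ :+ con 0ℤ)))
              :+ (:- x :* (con 1ℤ :* s :+ (con 0ℤ :* t :+ (con 0ℤ :* con 0ℤ :+ con 0ℤ))) :+ con 0ℤ)) := con 0ℤ) refl x₀ (y₀ - c) s t) }
        ; vertex∉baseLine = λ on → 1≉0 (trans (solve 2 (λ A x → con 1ℤ := con 1ℤ :* con 1ℤ :+ (con 0ℤ :* A :+ (:- x :* con 0ℤ :+ con 0ℤ))) refl A x₀) on)
        }

      vertex-on-ℓ∞ : vertex on ℓ∞
      vertex-on-ℓ∞ = solve 1 (λ A → con 0ℤ :* con 1ℤ :+ (con 0ℤ :* A :+ (con 1ℤ :* con 0ℤ :+ con 0ℤ)) := con 0ℤ) refl A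

      covers : BaerPencil.Covers pencil (pedal (𝒰 α β) P)
      covers R R∈pedal = cover (pedal⁻ {R} R∈pedal)
        where
        cover : (∃ λ u → Foot u × coords R ∼ foot u) → ∃ λ ℓ → ℓ ∈ BaerPencil.lines pencil × R on ℓ
        cover (u , foot-u , R∼) = ℓ ,
          (trans (dot-vertex ℓ) (horizontal-direction (W u)) ,
            affinePoint x₀ (y₀ + W u) , (1# , W u + c , 1-closed , W+c∈K foot-u , (λ (1≈0 , _) → 1≉0 1≈0) , 1# , 1≉0 , base-point) ,
            on-affine⁺ {affinePoint x₀ (y₀ + W u)} {ℓ} ∼-refl
              (solve 4 (λ A x y w → :- A :* x :+ con 1ℤ :* (y :+ w) :+ (A :* x :- y :- w) := con 0ℤ) refl A x₀ y₀ (W u))) ,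
          dot-∼ {coeffs ℓ} R∼ (trans (dot-horizontal (W u) u) (-‿inverseʳ (W u)))
          where
          ℓ : Line
          ℓ = horizontal (W u)
          base-point : ∀ i → affine x₀ (y₀ + W u) i ≈ 1# * (Projectivity.matrix base ⊙ (1# ∷ᵥ (W u + c) ∷ᵥ 0# ∷ᵥ []ᵥ)) i
          base-point 0F = solve 2 (λ x t → x := con 1ℤ :* (x :* con 1ℤ :+ (con 0ℤ :* t :+ (con 1ℤ :* con 0ℤ :+ con 0ℤ)))) refl x₀ (W u + c)
          base-point 1F = solve 3 (λ y c w → y :+ w := con 1ℤ :* ((y :- c) :* con 1ℤ :+ (con 1ℤ :* (w :+ c) :+ (con 0ℤ :* con 0ℤ :+ con 0ℤ)))) refl y₀ c (W u)
          base-point 2F = solve 1 (λ t → con 1ℤ := con 1ℤ :* (con 1ℤ :* con 1ℤ :+ (con 0ℤ :* t :+ (con 0ℤ :* con 0ℤ :+ con 0ℤ)))) refl (W u + c)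

      -- Square α: intersection numbers of the pedal

      module _ (s : Carrier) (ss≈α : s * s ≈ α) where

        open SquareCase s ss≈α

        ζ≉0 : ∀ {u} → Foot u → ¬ ζ u ≈ 0#
        ζ≉0 {u} foot-u ζu≈0 = *-nonzero (*-nonzero (*-nonzero 2≉0 g≉0) σ≉0) (Foot⇒Q≉0 foot-u)
          (trans (sym (Norm-ζ u)) (trans (*-congʳ ζu≈0) (zeroˡ _)))

        θ-injective : ∀ {z z′} → θ z ≈ θ z′ → z ≈ z′
        θ-injective eq = trans (sym (ζ-θ _)) (trans (ζ-cong eq) (ζ-θ _))

        θ-neg : ∀ z → θ (- z) ≈ - θ z
        θ-neg z = trans (*-congˡ (*-congʳ (+-congˡ (*-congˡ (conj-neg z)))))
          (solve 6 (λ i g σ z z̄ j → i :* ((con (+ 2) :* g :* :- z :+ σ :* :- z̄) :* j) := :- (i :* ((con (+ 2) :* g :* z :+ σ :* z̄) :* j))) refl (inv s≉0) g σ z (conj z) j)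

        size-4 : ∀ {t} {T : Pred Carrier t} {u} → Foot u → Good (ζ u) → (∀ {v} → T v → W u ≈ W v) → (∀ {v} → W u ≈ W v → T v) → HasSize setoid T 4
        size-4 {u = u} foot-u good T⇒W≈ W≈⇒T = hasSize setoid (θ ∘ orbit (ζ u)) (λ i → W≈⇒T (sym (orbit⇒W≈ u i)))
          (λ eq → orbit-injective (ζ≉0 foot-u) good (θ-injective eq)) (λ v Tv → W≈⇒orbit (T⇒W≈ Tv))

        size-2-or-4 : ∀ {t} {T : Pred Carrier t} {u} → Foot u → (∀ {v} → T v → W u ≈ W v) → (∀ {v} → W u ≈ W v → T v) →
          HasSize setoid T 2 ⊎ HasSize setoid T 4
        size-2-or-4 {T = T} {u} foot-u T⇒W≈ W≈⇒T = decide (conj (ζ u) ≟ ζ u) (conj (ζ u) ≟ - ζ u)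
          where
          degenerate : (∀ i → orbit (ζ u) i ≈ ζ u ⊎ orbit (ζ u) i ≈ - ζ u) → HasSize setoid T 2
          degenerate cases = size-2 (W≈⇒T refl) (W≈⇒T (sym (W-neg u))) (Foot⇒≉0 foot-u ∘ x≈-x⇒x≈0) λ w Tw →
            member (W≈⇒orbit (T⇒W≈ Tw))
            where
            member : ∀ {w} → (∃ λ i → θ (orbit (ζ u) i) ≈ w) → u ≈ w ⊎ - u ≈ w
            member (i , eq) = Sum.map
              (λ o → trans (sym (θ-ζ u)) (trans (θ-cong (sym o)) eq))
              (λ o → trans (-‿cong (sym (θ-ζ u))) (trans (sym (θ-neg (ζ u))) (trans (θ-cong (sym o)) eq)))
              (cases i)
          decide : Dec (conj (ζ u) ≈ ζ u) → Dec (conj (ζ u) ≈ - ζ u) → HasSize setoid T 2 ⊎ HasSize setoid T 4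
          decide (yes z̄≈z) _ = inj₁ (degenerate λ where
            0F → inj₁ refl
            1F → inj₂ refl
            2F → inj₁ z̄≈z
            3F → inj₂ (-‿cong z̄≈z))
          decide (no _) (yes z̄≈-z) = inj₁ (degenerate λ where
            0F → inj₁ refl
            1F → inj₂ refl
            2F → inj₂ z̄≈-z
            3F → inj₁ (trans (-‿cong z̄≈-z) (solve 1 (λ z → :- :- z := z) refl (ζ u))))
          decide (no z̄≉z) (no z̄≉-z) = inj₂ (size-4 foot-u (z̄≉z , z̄≉-z) T⇒W≈ W≈⇒T)

        square-size : ∀ ℓ → (HasSize setoid (FootOn ℓ) 0 ⊎ HasSize setoid (FootOn ℓ) 1 ⊎ HasSize setoid (FootOn ℓ) 2) ⊎ HasSize setoid (FootOn ℓ) 4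
        square-size ℓ = decide (direction-of ℓ ≟ 0#)
          where
          decide : Dec (direction-of ℓ ≈ 0#) → _
          decide (no transversal) = inj₁ (transversal-size ℓ transversal)
          decide (yes through)    = Sum.[ inj₁ ∘ inj₁ ,
            (λ (u , foot-u , on⇒W≈ , W≈⇒on) → Sum.map₁ (inj₂ ∘ inj₂) (size-2-or-4 foot-u on⇒W≈ W≈⇒on)) ]′ (vertex-line ℓ through)

        -- The common norm of `ζ u` over all feet, read off from `Norm-ζ` at Q(u) = -c.
        κ : Carrier
        κ = two * g * σ * - c

        κ∈K : κ ∈ K
        κ∈K = fixed⇒∈ (trans (2ᶜ *ᶜ conj-g *ᶜ conj-σ *ᶜ -ᶜ conj-c)
          (solve 3 (λ g σ c → con (+ 2) :* g :* :- σ :* :- :- c := con (+ 2) :* g :* σ :* :- c) refl g σ c))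

        κ≉0 : ¬ κ ≈ 0#
        κ≉0 = *-nonzero (*-nonzero (*-nonzero 2≉0 g≉0) σ≉0)
          (λ -c≈0 → c≉0 (trans (solve 1 (λ c → c := :- :- c) refl c) (trans (-‿cong -c≈0) -0≈0)))

        Norm⇒Foot : ∀ {z} → Norm z ≈ κ → Foot (θ z)
        Norm⇒Foot {z} norm = trans (+-congˡ (*-cancelˡ (*-nonzero (*-nonzero 2≉0 g≉0) σ≉0)
          (trans (sym (Norm-ζ (θ z))) (trans (Norm-cong (ζ-θ z)) norm)))) (-‿inverseʳ c)

        W≈⇒S≈ : ∀ {z z′} → W (θ z) ≈ W (θ z′) → S z ≈ S z′
        W≈⇒S≈ {z} {z′} eq = begin
          S z                                  ≈⟨ S-cong (ζ-θ z) ⟨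
          S (ζ (θ z))                          ≈⟨ S-ζ (θ z) ⟩
          two * σ * e * (W (θ z) - Q (θ z))    ≈⟨ *-congˡ (+-cong eq (-‿cong (W≈⇒Q≈ eq))) ⟩
          two * σ * e * (W (θ z′) - Q (θ z′))  ≈⟨ S-ζ (θ z′) ⟨
          S (ζ (θ z′))                         ≈⟨ S-cong (ζ-θ z′) ⟩
          S z′                                 ∎

        horizontal-4 : ∀ {z} → Norm z ≈ κ → Good z → HasSize setoid (FootOn (horizontal (W (θ z)))) 4
        horizontal-4 {z} norm (z̄≉z , z̄≉-z) = size-4 (Norm⇒Foot norm)
          ((λ eq → z̄≉z (trans (sym (conj-cong (ζ-θ z))) (trans eq (ζ-θ z)))) ,
           (λ eq → z̄≉-z (trans (sym (conj-cong (ζ-θ z))) (trans eq (-‿cong (ζ-θ z))))))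
          (λ {v} (_ , eq) → sym (difference-zero (trans (sym (dot-horizontal _ v)) eq)))
          (λ {v} eq → W≈⇒Foot eq (Norm⇒Foot norm) , trans (dot-horizontal _ v) (zero-difference (sym eq)))

        module _ (sizeK : HasSize setoid K q) (circle : Fin (suc q) → Carrier) (Norm-circle : ∀ i → Norm (circle i) ≈ κ)
          (circle-injective : ∀ {i j} → circle i ≈ circle j → i ≡ j) (R : Representatives circle) where

          open Representatives R

          many-representatives : q ℕ.≤ 3 ℕ.+ 4 ℕ.* size
          -- The circle has q + 1 elements; one unit is cancelled from q + 1 ≤ 4 + 4 · size.
          many-representatives = ℕ.s≤s⁻¹ (representatives-bound κ∈K Norm-circle circle-injective R)

          Norm-rep : ∀ j → Norm (rep j) ≈ κ
          Norm-rep j = trans (reflexive (≡.cong Norm (proj₂ (rep-∈ j)))) (Norm-circle (proj₁ (rep-∈ j)))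

          line-4 : Fin size → Line
          line-4 j = horizontal (W (θ (rep j)))

          line-4-∈ : ∀ j → line-4 j ∈ MeetsIn (pedal (𝒰 α β) P) 4
          line-4-∈ j = pedal-size (line-4 j) (horizontal-4 (Norm-rep j) (rep-good j))

          many-4-secants : HasSizeAtLeast Lines (MeetsIn (pedal (𝒰 α β) P) 4) size
          many-4-secants = record
            { to        = λ j → line-4 j , line-4-∈ j
            ; cong      = λ where ≡.refl → ∼-refl
            ; injective = λ {i} {j} eq → S-injective (W≈⇒S≈ {rep i} {rep j} (horizontal-injective {W (θ (rep i))} {W (θ (rep j))} eq))
            }

          4-secant : ∃ λ ℓ → ℓ ∈ MeetsIn (pedal (𝒰 α β) P) 4
          4-secant = secant size line-4 line-4-∈ many-representatives
            where
            secant : ∀ n (ℓs : Fin n → Line) → (∀ j → ℓs j ∈ MeetsIn (pedal (𝒰 α β) P) 4) → q ℕ.≤ 3 ℕ.+ 4 ℕ.* n →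
              ∃ λ ℓ → ℓ ∈ MeetsIn (pedal (𝒰 α β) P) 4
            -- Without representatives the bound only says q ≤ 3, which `q≰3` rules out.
            secant zero    ℓs ℓs∈ q≤3 = contradiction q≤3 (q≰3 sizeK)
            secant (suc n) ℓs ℓs∈ _   = ℓs 0F , ℓs∈ 0F

          0-secant : ∃ λ ℓ → ℓ ∈ MeetsIn (pedal (𝒰 α β) P) 0
          0-secant = ℓ∞ , pedal-size ℓ∞ (size-0 λ u (_ , eq) → 1≉0 (trans
            (solve 2 (λ x y → con 1ℤ := con 0ℤ :* x :+ (con 0ℤ :* y :+ (con 1ℤ :* con 1ℤ :+ con 0ℤ))) refl (x₀ + u) (foot-y u)) eq))

          -- Feet are determined by their abscissas, so the vertical line through a foot contains no
          -- other.
          1-secant : ∃ λ ℓ → ℓ ∈ MeetsIn (pedal (𝒰 α β) P) 1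
          1-secant = ℓ , pedal-size ℓ (size-1 {u = u} (Norm⇒Foot (Norm-circle 0F) , trans (equation u) (-‿inverseʳ u))
              (λ v (_ , eq) → sym (difference-zero (trans (sym (equation v)) eq))))
            where
            u : Carrier
            u = θ (circle 0F)
            ℓ : Line
            ℓ = (1# ∷ᵥ 0# ∷ᵥ (- (x₀ + u)) ∷ᵥ []ᵥ) , λ eq → 1≉0 (eq 0F)
            equation : ∀ v → dot (coeffs ℓ) (foot v) ≈ v - u
            equation v = trans (dot-affine (coeffs ℓ) (x₀ + v) (foot-y v))
              (solve 4 (λ x y u v → con 1ℤ :* (x :+ v) :+ con 0ℤ :* y :+ :- (x :+ u) := v :- u) refl x₀ (foot-y v) u v)

          -- If `S` were constant on the circle, its q + 1 elements would all lie in one orbit of at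
          -- most four, forcing q ≤ 3.
          other-level : ∃ λ i → ¬ S (circle 0F) ≈ S (circle i)
          other-level = decide (Finₚ.any? (λ i → ¬? (S (circle 0F) ≟ S (circle i))))
            where
            decide : Dec (∃ λ i → ¬ S (circle 0F) ≈ S (circle i)) → ∃ λ i → ¬ S (circle 0F) ≈ S (circle i)
            decide (yes other) = other
            decide (no none)   = contradiction (ℕ.s≤s⁻¹ (subset-≤ (orbit (circle 0F)) circle circle-injective
              (λ i → orbit-complete (trans (Norm-circle 0F) (sym (Norm-circle i)))
                (decidable-stable (S (circle 0F) ≟ S (circle i)) (λ S≉ → none (i , S≉)))))) (q≰3 sizeK)

          -- The line joins two feet with different values of `W`. It therefore misses the vertex,
          -- and `size-2-chord` excludes a third foot.
          2-secant : ∃ λ ℓ → ℓ ∈ MeetsIn (pedal (𝒰 α β) P) 2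
          2-secant = ℓ , pedal-size ℓ (size-2-chord ℓ transversal
              (Norm⇒Foot (Norm-circle 0F) , trans (equation u) (solve 2 (λ m u → m :* (u :- u) := con 0ℤ) refl m u ⊕ -‿inverseʳ (W u)))
              (Norm⇒Foot (Norm-circle (proj₁ other-level)) , trans (equation v) through-v) u≉v)
            where
            u v : Carrier
            u = θ (circle 0F)
            v = θ (circle (proj₁ other-level))
            Wu≉Wv : ¬ W u ≈ W v
            Wu≉Wv eq = proj₂ other-level (W≈⇒S≈ {circle 0F} {circle (proj₁ other-level)} eq)
            u≉v : ¬ u ≈ v
            u≉v eq = Wu≉Wv (W-cong {u} {v} eq)
            u-v≉0 : ¬ u - v ≈ 0#
            u-v≉0 = u≉v ∘ difference-zero
            m : Carrier
            -- Solves m(v - u) + W(v) - W(u) = 0, the condition that the line through the foot of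
            -- `u` also contains that of `v`; `m` becomes the value of the line at the vertex.
            m = inv u-v≉0 * (W v - W u)
            ℓ : Line
            ℓ = ((m - A) ∷ᵥ 1# ∷ᵥ (- (m * u + W u) - (m - A) * x₀ - y₀) ∷ᵥ []ᵥ) , λ eq → 1≉0 (eq 1F)
            m≉0 : ¬ m ≈ 0#
            m≉0 m≈0 = Wu≉Wv (sym (difference-zero (*-zero⇒ʳ (λ i≈0 → 1≉0 (trans (sym (inv-* u-v≉0)) (trans (*-congʳ i≈0) (zeroˡ _)))) m≈0)))
            transversal : ¬ direction-of ℓ ≈ 0#
            transversal eq = m≉0 (trans (solve 2 (λ m A → m := m :- A :+ con 1ℤ :* A) refl m A) eq)
            equation : ∀ w → dot (coeffs ℓ) (foot w) ≈ m * (w - u) + (W w - W u)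
            equation w = trans (dot-foot ℓ w) (solve 8 (λ m A x y u v t t′ → (m :- A :+ con 1ℤ :* A) :* v :+ con 1ℤ :* t :+
              ((m :- A) :* x :+ con 1ℤ :* y :+ (:- (m :* u :+ t′) :- (m :- A) :* x :- y)) := m :* (v :- u) :+ (t :- t′)) refl m A x₀ y₀ u w (W w) (W u))
            through-v : m * (v - u) + (W v - W u) ≈ 0#
            through-v = trans (solve 4 (λ i u v t → i :* t :* (v :- u) :+ t := :- t :* (i :* (u :- v) :- con 1ℤ)) refl (inv u-v≉0) u v (W v - W u))
              (scale _ (zero-difference (inv-* u-v≉0)))

          secants : (∀ n → n ∈ˡ (0 ∷ 1 ∷ 2 ∷ 4 ∷ []) → ∃ λ ℓ → ℓ ∈ MeetsIn (pedal (𝒰 α β) P) n) ×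
            (∃ λ n → q ℕ.≤ 3 ℕ.+ 4 ℕ.* n × HasSizeAtLeast Lines (MeetsIn (pedal (𝒰 α β) P) 4) n)
          secants = (λ where
            _ (here ≡.refl)                         → 0-secant
            _ (there (here ≡.refl))                 → 1-secant
            _ (there (there (here ≡.refl)))         → 2-secant
            _ (there (there (there (here ≡.refl)))) → 4-secant) ,
            size , many-representatives , many-4-secants

        all-secants : HasSize setoid K q →
          (∀ n → n ∈ˡ (0 ∷ 1 ∷ 2 ∷ 4 ∷ []) → ∃ λ ℓ → ℓ ∈ MeetsIn (pedal (𝒰 α β) P) n) ×
          (∃ λ n → q ℕ.≤ 3 ℕ.+ 4 ℕ.* n × HasSizeAtLeast Lines (MeetsIn (pedal (𝒰 α β) P) 4) n)
        all-secants sizeK = apply (norm-circle sizeK κ∈K κ≉0)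
          where
          apply : (∃ λ (f : Fin (suc q) → Carrier) → (∀ i → Norm (f i) ≈ κ) × (∀ {i j} → f i ≈ f j → i ≡ j)) → _
          apply (f , norms , f-injective) = secants sizeK f norms f-injective (representatives f)

      -- A line missing the vertex has at most two feet by `transversal-size`, and `size-≤` sets
      -- this count against 4.
      4-secant-through-vertex : ∀ m → m ∈ MeetsIn (pedal (𝒰 α β) P) 4 → vertex on m
      4-secant-through-vertex m size₄ = decide (direction-of m ≟ 0#)
        where
        bounded : ∀ {n} → HasSize setoid (FootOn m) n → 4 ℕ.≤ n
        bounded sizeₙ = size-≤ Points {P = pedal (𝒰 α β) P ∩ (_on m)} {Q = pedal (𝒰 α β) P ∩ (_on m)} id size₄ (pedal-size m sizeₙ)
        decide : Dec (direction-of m ≈ 0#) → vertex on m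
        decide (yes through)    = trans (dot-vertex m) through
        decide (no transversal) = Sum.[ (λ size → contradiction (bounded size) λ ()) , Sum.[
          (λ size → contradiction (bounded size) λ { (ℕ.s≤s ()) }) , (λ size → contradiction (bounded size) λ { (ℕ.s≤s (ℕ.s≤s ())) }) ]′ ]′
          (transversal-size m transversal)

      baer-pencil : HasSize setoid K q → ∃ λ (𝓑 : BaerPencil) →
        BaerPencil.vertex 𝓑 on ℓ∞ ×
        BaerPencil.Covers 𝓑 (pedal (𝒰 α β) P) ×
        (¬ IsSquareIn F U α → IsArc (pedal (𝒰 α β) P)) ×
        (IsSquareIn F U α →
          OfClass (pedal (𝒰 α β) P) (0 ∷ 1 ∷ 2 ∷ 4 ∷ []) ×
          (∃ λ n → q ℕ.≤ 3 ℕ.+ 4 ℕ.* n × HasSizeAtLeast Lines (MeetsIn (pedal (𝒰 α β) P) 4) n) ×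
          (∀ m → m ∈ MeetsIn (pedal (𝒰 α β) P) 4 → BaerPencil.vertex 𝓑 on m))
      baer-pencil sizeK = pencil , vertex-on-ℓ∞ , covers ,
        (λ α-nonsquare ℓ → at-most-2 ℓ (arc-size (λ y yy≈α → α-nonsquare (y , _ , yy≈α)) ℓ)) ,
        λ (s , _ , ss≈α) →
          ((λ ℓ → at-most-4 ℓ (square-size s ss≈α ℓ)) , proj₁ (all-secants s ss≈α sizeK)) ,
          proj₂ (all-secants s ss≈α sizeK) ,
          4-secant-through-vertex
        where
        at-most-2 : ∀ ℓ {ns} → HasSize setoid (FootOn ℓ) 0 ⊎ HasSize setoid (FootOn ℓ) 1 ⊎ HasSize setoid (FootOn ℓ) 2 →
          ∃ λ n → n ∈ˡ (0 ∷ 1 ∷ 2 ∷ ns) × ℓ ∈ MeetsIn (pedal (𝒰 α β) P) n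
        at-most-2 ℓ (inj₁ size)        = 0 , here ≡.refl , pedal-size ℓ size
        at-most-2 ℓ (inj₂ (inj₁ size)) = 1 , there (here ≡.refl) , pedal-size ℓ size
        at-most-2 ℓ (inj₂ (inj₂ size)) = 2 , there (there (here ≡.refl)) , pedal-size ℓ size
        at-most-4 : ∀ ℓ → (HasSize setoid (FootOn ℓ) 0 ⊎ HasSize setoid (FootOn ℓ) 1 ⊎ HasSize setoid (FootOn ℓ) 2) ⊎ HasSize setoid (FootOn ℓ) 4 →
          ∃ λ n → n ∈ˡ (0 ∷ 1 ∷ 2 ∷ 4 ∷ []) × ℓ ∈ MeetsIn (pedal (𝒰 α β) P) n
        at-most-4 ℓ (inj₁ sizes) = at-most-2 ℓ sizes
        at-most-4 ℓ (inj₂ size)  = 4 , there (there (there (here ≡.refl))) , pedal-size ℓ size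

-- Odd q and the choice of conjugation

odd-form : ∀ q → ¬ 2 ∣ q → ∃ λ m → q ≡ suc (m ℕ.+ m)
odd-form zero          2∤q = contradiction (2 ∣0) 2∤q
odd-form (suc zero)    2∤q = 0 , ≡.refl
odd-form (suc (suc q)) 2∤q with odd-form q (2∤q ∘ ∣m∣n⇒∣m+n ∣-refl)
... | m , ≡.refl = suc m , ≡.cong (λ k → suc (suc k)) (≡.sym (ℕₚ.+-suc m m))

subfield-size≢1 : ∀ (F : CommutativeRing a b) (isField : IsField F) {K : Pred (CommutativeRing.Carrier F) p} →
  IsSubfield F K → ∀ {q} → HasSize (CommutativeRing.setoid F) K q → ¬ q ≡ 1
subfield-size≢1 F isField isSubfield sizeK ≡.refl = 1≉0 (trans (sym (element-index 1-closed))
  (trans (reflexive (≡.cong element (Fin1-unique (index 1-closed) (index 0-closed)))) (element-index 0-closed)))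
  where
  open CommutativeRing F
  open IsField isField
  open IsSubfield isSubfield
  open Enumeration setoid sizeK

theorem1p5 :
  ∀ {a b p} (F : CommutativeRing a b) (isField : IsField F)
  (K : Pred (CommutativeRing.Carrier F) p) → IsSubfield F K →
  (q : ℕ) → IsPrimePower q → ¬ (2 ∣ q) →
  HasSize (CommutativeRing.setoid F) U (q ℕ.^ 2) →
  HasSize (CommutativeRing.setoid F) K q →
  let open CommutativeRing F
      open PG2 F isField K q
  in
  (α β : Carrier) → ¬ (α ≈ 0#) →
  ¬ IsSquareIn F K (discriminant α β) →
  (P : Point) → P ∉ 𝒰 α β → ¬ (P on ℓ∞) →
  ∃ λ (𝓑 : BaerPencil) →
    let open BaerPencil 𝓑 in
    vertex on ℓ∞ ×
    Covers (pedal (𝒰 α β) P) ×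
    (¬ IsSquareIn F U α → IsArc (pedal (𝒰 α β) P)) ×
    (IsSquareIn F U α →
      OfClass (pedal (𝒰 α β) P) (0 ∷ 1 ∷ 2 ∷ 4 ∷ []) ×
      (∃ λ n → q ℕ.≤ 3 ℕ.+ 4 ℕ.* n ×
        HasSizeAtLeast Lines (MeetsIn (pedal (𝒰 α β) P) 4) n) ×
      (∀ m → m ∈ MeetsIn (pedal (𝒰 α β) P) 4 → vertex on m))
theorem1p5 F isField K isSubfield q _ 2∤q sizeF sizeK α β α≉0 d-nonsquare P P∉𝒰 P∉ℓ∞ = conclude (odd-form q 2∤q)
  where
  conclude : (∃ λ m → q ≡ suc (m ℕ.+ m)) → _
  -- The odd number 1 is not the size of a field, as 0 and 1 differ.
  conclude (zero  , q≡1)   = contradiction q≡1 (subfield-size≢1 F isField isSubfield sizeK)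
  -- Now q = 2m + 3, so q - 1 is `suc m ℕ.+ suc m` by `refl`. Conjugation is the q-th power by
  -- definition, which makes `conj-power` reflexivity.
  conclude (suc m , q≡1+n) = baer-pencil (λ _ → CommutativeRing.refl F) α β α≉0 d-nonsquare P
    (proj₁ affine-P) (proj₁ (proj₂ affine-P)) (proj₂ (proj₂ affine-P)) P∉𝒰 sizeK
    where
    open Plane F isField K isSubfield q sizeF (Frobenius.frobenius F isField K isSubfield q≡1+n ≡.refl sizeF sizeK)
    affine-P = affine-form P P∉ℓ∞
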